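{- There is an absolute constant $c$ such that the following holds. Let $X=\{x_1<x_2<\dots<x_n\}$ be a set of $n$ keys given as a uniformly random permutation, and let $X_r=\{x_i,x_{i+1},\dots,x_{i+r-1}\}\subseteq X$ be any subset of $r\ge 1$ order-consecutive keys. Then the expected total number of comparisons in which both compared keys belong to $X_r$, made by the modified Heapsort algorithm described in the context when sorting $X$, is at most $r\log r+c\,r$.
   Context: $\log$ is the logarithm to base $2$. All heaps are max-heaps stored in arrays indexed from $1$ (the children of position $a$ are $2a$ and $2a+1$). A comparison is counted only if both compared keys lie in $X_r$. The expectation is over the uniformly random input permutation. Almost binary expansion: $n=\sum_{k=1}^{t}(2^{s_k}-1)$ with $s_1\ge s_2\ge\dots\ge s_t\ge 1$, and each term $2^{s_k}-1$ at least as large as the sum of all the later (smaller) terms; such an expansion is unique for each $n$. Modified Heapsort: (1) Split the (uniformly permuted) input array into consecutive blocks of sizes $2^{s_1}-1,\dots,2^{s_t}-1$ given by the almost binary expansion of $n$. (2) For each block separately, run BuildHeap: for every position from the last to the first, sift the key at this position down, i.e. as long as the key is smaller than the larger of its children, swap it with that larger child (at each level the two children are compared with each other and the larger one is compared with the key being sifted). (3) For each block heap, append below it a full further level of dummy elements that are strictly smaller than all keys of $X$ (so that there are more dummy elements than keys in the block). Then run the sorting phase with Floyd's modification: repeatedly remove the root, leaving a hole; repeatedly compare the two children of the hole and promote the larger one into the hole until the hole reaches the bottom of the heap; put the right-most element of the lowest level of the heap into the hole; sift this element up while it is larger than its parent. Repeat until all keys of the block have been output. (4) Merge the sorted blocks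 with the standard Mergesort merging procedure, merging from the smallest blocks to the largest, so that the keys of the $k$-th block take part in at most $k$ merges. -}

module Defs where

open import Level using (0ℓ)
open import Data.Bool using (Bool; true; false; if_then_else_)
open import Data.Empty using (⊥)
open import Data.Fin using (Fin; toℕ)
open import Data.Fin.Properties using (any?)
open import Data.Integer as ℤ using (ℤ; ∣_∣)
open import Data.List using (List; []; _∷_; _++_; map; concatMap; length; filter; take; drop; tabulate)
open import Data.List.Properties using (length-map; length-++)
open import Data.List.Relation.Unary.All as All using (All; []; _∷_)
open import Data.List.Relation.Unary.All.Properties using (map⁺; concat⁺)
open import Data.List.Relation.Unary.Linked using (Linked; []; [-]; _∷_)
open import Data.Nat using (ℕ; zero; suc; _+_; _*_; _∸_; _^_; _≤_; _<_; _≥_; z≤n; s≤s; _≤?_; _<?_; _!; ⌊_/2⌋)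
open import Data.Nat.ListAction using (sum)
open import Data.Nat.Induction using (<-rec)
open import Data.Nat.Properties
open import Data.Product using (∃; ∃-syntax; _×_; _,_; proj₁; proj₂)
open import Data.Rational.Unnormalised as ℚᵘ using (ℚᵘ; ↥_; ↧ₙ_; 0ℚᵘ)
open import Data.Unit using (⊤; tt)
open import Relation.Binary using (StrictTotalOrder)
open import Relation.Binary.PropositionalEquality using (_≡_; refl; trans; cong; cong₂; subst)
open import Relation.Nullary using (Dec; yes; no; does)
open import Relation.Nullary.Construct.Add.Infimum using (_₋; ⊥₋; [_])
open import Relation.Nullary.Decidable using (_×-dec_)
import Relation.Binary.Construct.Add.Infimum.Strict as AddInfimum

blockSize : ℕ → ℕ
blockSize s = 2 ^ s ∸ 1

DominatesTails : List ℕ → Set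
DominatesTails []       = ⊤
DominatesTails (a ∷ as) = sum as ≤ a × DominatesTails as

record AlmostBinaryExpansion (n : ℕ) (ss : List ℕ) : Set where
  field
    sums-to     : sum (map blockSize ss) ≡ n
    decreasing  : Linked _≥_ ss
    positive    : All (1 ≤_) ss
    dominating  : DominatesTails (map blockSize ss)

-- Every n has an almost binary expansion, obtained greedily.
module _ where
  open ≤-Reasoning

  private
    largest : ∀ n → 1 ≤ n → ∃[ s ] (1 ≤ s × blockSize s ≤ n × suc n < 2 ^ suc s)
    largest (suc zero)    _ = 1 , ≤-refl , ≤-refl , s≤s (s≤s (s≤s z≤n))
    largest (suc (suc n)) _ with largest (suc n) (s≤s z≤n)
    ... | s , 1≤s , lo , hi with suc (suc (suc n)) <? 2 ^ suc s
    ...   | yes hi′ = s , 1≤s , m≤n⇒m≤1+n lo , hi′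
    ...   | no ¬hi  = suc s , s≤s z≤n , ∸-monoˡ-≤ 1 (≮⇒≥ ¬hi) , (begin-strict
        suc (suc (suc n))   ≤⟨ hi ⟩
        2 ^ suc s           <⟨ ^-monoʳ-< 2 (s≤s (s≤s z≤n)) (n<1+n (suc s)) ⟩
        2 ^ suc (suc s)     ∎)

    blockSize-positive : ∀ {s} → 1 ≤ s → 1 ≤ blockSize s
    blockSize-positive 1≤s = ∸-monoˡ-≤ 1 (^-monoʳ-≤ 2 1≤s)

    rest-small : ∀ {n s} → suc n < 2 ^ suc s → n ∸ blockSize s ≤ blockSize s
    rest-small {n} {s} hi = m≤n+o⇒m∸n≤o n (blockSize s) (begin
      n                         ≤⟨ ∸-monoˡ-≤ 2 hi ⟩
      2 ^ suc s ∸ 2             ≡⟨ cong (_∸ 2) (cong (2 ^ s +_) (+-identityʳ (2 ^ s))) ⟩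
      2 ^ s + 2 ^ s ∸ 2         ≡⟨ double (2 ^ s) (m^n>0 2 s) ⟩
      blockSize s + blockSize s ∎)
      where
      double : ∀ a → 1 ≤ a → a + a ∸ 2 ≡ (a ∸ 1) + (a ∸ 1)
      double (suc a) _ = cong (_∸ 1) (+-suc a a)

    blockSize-cancel-≤ : ∀ {s u} → 1 ≤ u → blockSize u ≤ blockSize s → u ≤ s
    blockSize-cancel-≤ {s} {u} 1≤u le = ≮⇒≥ λ s<u →
      <⇒≱ (∸-monoˡ-< (^-monoʳ-< 2 (s≤s (s≤s z≤n)) s<u) (m^n>0 2 s)) le

    linked : ∀ {s} ss → All (1 ≤_) ss → sum (map blockSize ss) ≤ blockSize s →
             Linked _≥_ ss → Linked _≥_ (s ∷ ss)
    linked []       _         _  _ = [-]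
    linked (u ∷ ss) (1≤u ∷ _) le l =
      blockSize-cancel-≤ 1≤u (≤-trans (m≤m+n _ _) le) ∷ l

  almostBinaryExpansion : ∀ n → ∃ (AlmostBinaryExpansion n)
  almostBinaryExpansion = <-rec _ λ where
    zero    rec → [] , record { sums-to = refl ; decreasing = [] ; positive = [] ; dominating = tt }
    (suc n) rec →
      let s , 1≤s , lo , hi = largest (suc n) (s≤s z≤n)
          ss , e            = rec (∸-monoʳ-< {o = 0} (blockSize-positive 1≤s) lo)
          module E          = AlmostBinaryExpansion e
          small             = ≤-trans (≤-reflexive E.sums-to) (rest-small {s = s} hi)
      in s ∷ ss , record
        { sums-to    = trans (cong (blockSize s +_) E.sums-to) (m+[n∸m]≡n lo)
        ; decreasing = linked ss E.positive small E.decreasing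
        ; positive   = 1≤s ∷ E.positive
        ; dominating = small , E.dominating
        }

-- All rearrangements of a list, one for each permutation of its positions;
-- a list of length n has n ! of them (length-permutations).
insertions : {A : Set} → A → List A → List (List A)
insertions x []       = (x ∷ []) ∷ []
insertions x (y ∷ ys) = (x ∷ y ∷ ys) ∷ map (y ∷_) (insertions x ys)

permutations : {A : Set} → List A → List (List A)
permutations []       = [] ∷ []
permutations (x ∷ xs) = concatMap (insertions x) (permutations xs)

private
  length-insertions : {A : Set} (x : A) (ys : List A) → length (insertions x ys) ≡ suc (length ys)
  length-insertions x []       = refl
  length-insertions x (y ∷ ys) =
    cong suc (trans (length-map (y ∷_) (insertions x ys)) (length-insertions x ys))

  HasLength : {A : Set} → ℕ → List A → Set
  HasLength n ys = length ys ≡ n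

  insertions-HasLength : {A : Set} (x : A) (ys : List A) →
                         All (HasLength (suc (length ys))) (insertions x ys)
  insertions-HasLength x []       = refl ∷ []
  insertions-HasLength x (y ∷ ys) =
    refl ∷ map⁺ (All.map (cong suc) (insertions-HasLength x ys))

  permutations-HasLength : {A : Set} (xs : List A) → All (HasLength (length xs)) (permutations xs)
  permutations-HasLength []       = refl ∷ []
  permutations-HasLength (x ∷ xs) = concat⁺ (map⁺ (All.map
    (λ {ys} eq → subst (λ m → All (HasLength (suc m)) (insertions x ys)) eq (insertions-HasLength x ys))
    (permutations-HasLength xs)))

  length-concatMap : {A B : Set} {m : ℕ} (f : A → List B) {as : List A} →
                     All (λ a → length (f a) ≡ m) as → length (concatMap f as) ≡ length as * m
  length-concatMap f []                 = refl
  length-concatMap f {a ∷ as} (eq ∷ eqs) =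
    trans (length-++ (f a)) (cong₂ _+_ eq (length-concatMap f eqs))

length-permutations : {A : Set} (xs : List A) → length (permutations xs) ≡ length xs !
length-permutations []       = refl
length-permutations (x ∷ xs) =
  trans (length-concatMap (insertions x)
          (All.map (λ {ys} eq → trans (length-insertions x ys) (cong suc eq))
                   (permutations-HasLength xs)))
        (trans (*-comm (length (permutations xs)) _)
               (cong (suc (length xs) *_) (length-permutations xs)))

-- The expectation of f over a uniformly random permutation of xs.
expectation : {A : Set} → (List A → ℕ) → List A → ℚᵘ
expectation f xs = (ℤ.+ sum (map f (permutations xs))) ℚᵘ./ (length xs !)
  where instance _ = (length xs) !≢0

-- log₂ m ≤ q, for m ≥ 1 and a rational q = p / d ≥ 0: this says m ≤ 2^(p/d).
record Log₂_≤_ (m : ℕ) (q : ℚᵘ) : Set where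
  constructor mkLog₂≤
  field
    nonNegative : 0ℚᵘ ℚᵘ.≤ q
    power       : m ^ ↧ₙ q ≤ 2 ^ ∣ ↥ q ∣

-- The inequality e ≤ a log₂ r + c b between real numbers, for r ≥ 1.  The number
-- log₂ r is given by its upper rational cut, i.e. as the infimum of the rationals
-- q ≥ 0 with log₂ r ≤ q; since a ≥ 0, the inequality holds iff it holds with
-- every such q in place of log₂ r.
_≤[_log₂_+_·_] : ℚᵘ → ℕ → ℕ → ℚᵘ → ℕ → Set
e ≤[ a log₂ r + c · b ] =
  ∀ q → Log₂ r ≤ q → e ℚᵘ.≤ ((ℤ.+ a) ℚᵘ./ 1) ℚᵘ.* q ℚᵘ.+ c ℚᵘ.* ((ℤ.+ b) ℚᵘ./ 1)

module Heapsort (O : StrictTotalOrder 0ℓ 0ℓ 0ℓ) where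

  open StrictTotalOrder O using (_≈_) renaming (Carrier to Key; _<_ to _<ᴷ_; _<?_ to _<ᴷ?_; _≟_ to _≟ᴷ_) public
  open AddInfimum _<ᴷ_ using (_<₋_; <₋-dec)

  -- A key, or a dummy element ⊥₋ strictly below all keys.
  Entry : Set
  Entry = Key ₋

  _<ᴱ?_ : (u v : Entry) → Dec (u <₋ v)
  _<ᴱ?_ = <₋-dec _<ᴷ?_

  -- A result together with the pairs of entries that were compared to obtain it.
  Logged : Set → Set
  Logged A = List (Entry × Entry) × A

  return : {A : Set} → A → Logged A
  return a = [] , a

  infixl 1 _>>=_
  _>>=_ : {A B : Set} → Logged A → (A → Logged B) → Logged B
  (w , a) >>= f = w ++ proj₁ (f a) , proj₂ (f a)

  infix 4 _<!_
  _<!_ : Entry → Entry → Logged Bool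
  u <! v = (u , v) ∷ [] , does (u <ᴱ? v)

  -- Arrays are indexed from 1.  The number of positions in use is passed
  -- separately; the entries at all other positions are irrelevant.
  Array : Set
  Array = ℕ → Entry

  fromList : List Key → Array
  fromList []       _             = ⊥₋
  fromList (k ∷ ks) zero          = ⊥₋
  fromList (k ∷ ks) (suc zero)    = [ k ]
  fromList (k ∷ ks) (suc (suc p)) = fromList ks (suc p)

  _[_≔_] : Array → ℕ → Entry → Array
  (A [ p ≔ e ]) q = if does (q ≟ p) then e else A q

  swap : ℕ → ℕ → Array → Array
  swap p q A = (A [ p ≔ A q ]) [ q ≔ A p ]

  -- The child of position p holding the larger entry, in a heap of size m in
  -- which p has at least one child.  An only child is chosen without comparison.
  largerChild : ℕ → ℕ → Array → Logged ℕ
  largerChild m p A =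
    if does (suc (2 * p) ≤? m)
    then (A (2 * p) <! A (suc (2 * p)) >>= λ b →
          return (if b then suc (2 * p) else 2 * p))
    else return (2 * p)

  -- In siftDown, sinkHole and siftUp the first argument only bounds the number
  -- of steps.  The position at least doubles in each step down and is at least
  -- halved in each step up, so the bounds used below are never exhausted.
  siftDown : ℕ → ℕ → ℕ → Array → Logged Array
  siftDown zero       m p A = return A
  siftDown (suc fuel) m p A =
    if does (2 * p ≤? m)
    then (largerChild m p A >>= λ c →
          A p <! A c        >>= λ b →
          if b then siftDown fuel m c (swap p c A) else return A)
    else return A

  siftDownFrom : ℕ → ℕ → Array → Logged Array
  siftDownFrom zero    m A = return A
  siftDownFrom (suc p) m A = siftDown m m (suc p) A >>= siftDownFrom p m

  buildHeap : ℕ → Array → Logged Array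
  buildHeap m = siftDownFrom m m

  -- A heap of 2 ^ s ∸ 1 keys becomes a heap of size 2 ^ suc s ∸ 1.
  addDummies : ℕ → Array → Array
  addDummies m A p = if does (p ≤? m) then A p else ⊥₋

  -- Moves a hole at position h to the bottom; returns its final position.
  sinkHole : ℕ → ℕ → ℕ → Array → Logged (ℕ × Array)
  sinkHole zero       m h A = return (h , A)
  sinkHole (suc fuel) m h A =
    if does (2 * h ≤? m)
    then (largerChild m h A >>= λ c → sinkHole fuel m c (A [ h ≔ A c ]))
    else return (h , A)

  siftUp : ℕ → ℕ → Array → Logged Array
  siftUp zero       p A = return A
  siftUp (suc fuel) p A =
    if does (2 ≤? p)
    then (A ⌊ p /2⌋ <! A p >>= λ b →
          if b then siftUp fuel ⌊ p /2⌋ (swap ⌊ p /2⌋ p A) else return A)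
    else return A

  -- Removes the root of a heap of size m, leaving a heap of size m ∸ 1.  If the
  -- hole ends up at the last position m, there is nothing to be put into it.
  removeRoot : ℕ → Array → Logged Array
  removeRoot m A =
    sinkHole m m 1 A >>= λ (h , B) →
    if does (h ≟ m) then return B else siftUp h h (B [ h ≔ B m ])

  -- Outputs the k largest entries of a heap of size m, in front of the entries
  -- out that were output before.
  output : ℕ → ℕ → Array → List Entry → Logged (List Entry)
  output zero    m A out = return out
  output (suc k) m A out =
    removeRoot m A >>= λ B → output k (m ∸ 1) B (A 1 ∷ out)

  sortBlock : List Key → Logged (List Entry)
  sortBlock ks =
    buildHeap m (fromList ks) >>= λ A →
    output m (suc (2 * m)) (addDummies m A) []
    where m = length ks

  merge : List Entry → List Entry → Logged (List Entry)
  merge []       vs       = return vs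
  merge (u ∷ us) []       = return (u ∷ us)
  merge (u ∷ us) (v ∷ vs) =
    v <! u >>= λ b →
    if b then (merge (u ∷ us) vs >>= λ ws → return (v ∷ ws))
         else (merge us (v ∷ vs) >>= λ ws → return (u ∷ ws))

  splitBlocks : List ℕ → List Key → List (List Key)
  splitBlocks []       ks = []
  splitBlocks (s ∷ ss) ks = take (blockSize s) ks ∷ splitBlocks ss (drop (blockSize s) ks)

  sortBlocks : List (List Key) → Logged (List (List Entry))
  sortBlocks []         = return []
  sortBlocks (ks ∷ kss) =
    sortBlock ks   >>= λ us →
    sortBlocks kss >>= λ uss →
    return (us ∷ uss)

  -- The first block is the largest one, so it is merged last.
  mergeBlocks : List (List Entry) → Logged (List Entry)
  mergeBlocks []         = return []
  mergeBlocks (us ∷ uss) = mergeBlocks uss >>= merge us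

  -- ss is the almost binary expansion of the number of keys.
  modifiedHeapsort : List ℕ → List Key → Logged (List Entry)
  modifiedHeapsort ss ks = sortBlocks (splitBlocks ss ks) >>= mergeBlocks

  StrictlyIncreasing : {n : ℕ} → (Fin n → Key) → Set
  StrictlyIncreasing x = ∀ {j k} → toℕ j < toℕ k → x j <ᴷ x k

  -- Membership in { x i , x (i + 1) , … , x (i + r ∸ 1) }, where indices start at 0.
  InRange : {n : ℕ} → (Fin n → Key) → ℕ → ℕ → Entry → Set
  InRange x i r ⊥₋    = ⊥
  InRange x i r [ k ] = ∃[ j ] (i ≤ toℕ j × toℕ j < i + r × k ≈ x j)

  inRange? : {n : ℕ} (x : Fin n → Key) (i r : ℕ) (u : Entry) → Dec (InRange x i r u)
  inRange? x i r ⊥₋    = no λ ()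
  inRange? x i r [ k ] =
    any? λ j → (i ≤? toℕ j) ×-dec ((toℕ j <? i + r) ×-dec (k ≟ᴷ x j))

  comparisonsWithin : {n : ℕ} → List ℕ → (Fin n → Key) → ℕ → ℕ → List Key → ℕ
  comparisonsWithin ss x i r ks =
    length (filter (λ (u , v) → inRange? x i r u ×-dec inRange? x i r v)
                   (proj₁ (modifiedHeapsort ss ks)))

  expectedComparisons : {n : ℕ} → List ℕ → (Fin n → Key) → ℕ → ℕ → ℚᵘ
  expectedComparisons ss x i r = expectation (comparisonsWithin ss x i r) (tabulate x)

{-# OPTIONS --safe #-}

-- Call the keys of X_r marked; only their positions matter for the number of counted
-- comparisons, except that the constructed heap must be shown to be uniformly random.
--
-- Sorting phase.  The right-most element of the lowest level is a dummy, so sifting it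
-- up costs nothing.  A comparison of two marked keys moves one of them up by one level,
-- so the cost is at most the sum over all nodes b of the cost of merging the marked keys
-- in the two subtrees below b: 0 if one subtree has none, and their number otherwise.
-- The first log r levels cost at most r each.  In a uniformly random heap the keys below
-- the root are split at random between the subtrees, so the expected number of pairs of
-- marked keys in a common subtree is at least halved from each level to the next; hence
-- all the remaining levels together cost O(r).
--
-- Construction.  Sifting a random key down above two independent random heaps produces
-- each heap H equally often, once for each final position of the sifted key.  The two
-- comparisons at a node count only if its subtree in H has two marked keys, and a node
-- of depth d lies on the path to a random position with probability about 2^-d.  Bounding
-- the number of such nodes trivially on the upper levels and by the number of pairs on
-- the lower ones gives O(r) again.
--
-- Merging.  A merge costs at most the number of marked keys involved, and this number is
-- halved in expectation each time the largest remaining block is removed.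
module Submission where

open import Defs
open import Data.Bool using (Bool; true; false; if_then_else_)
open import Data.Empty using (⊥-elim)
open import Data.Fin as Fin using (Fin; toℕ)
open import Data.Integer as ℤ using ()
open import Data.Integer.Properties using (pos-*; pos-+)
open import Data.List using (List; []; _∷_; _++_; map; concatMap; length; take; drop; filter; reverse; tabulate)
open import Data.List.Properties
  using (map-∘; map-cong; map-++; map-tabulate; length-++; length-map; length-reverse; length-tabulate; length-take; length-drop;
         ++-assoc; ++-identityʳ; take++drop≡id; take-map; drop-map; filter-++; unfold-reverse)
open import Data.List.Relation.Binary.Permutation.Propositional as Perm using (_↭_; ↭-refl; ↭-sym; ↭-reflexive)
open import Data.List.Relation.Binary.Permutation.Propositional.Properties as ↭ₚ using (shifts; ++⁺ˡ; ↭-length)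
open import Data.List.Relation.Unary.All as All using (All; []; _∷_)
import Data.List.Relation.Unary.All.Properties as Allₚ
open import Data.List.Relation.Unary.AllPairs using (AllPairs; []; _∷_)
import Data.List.Relation.Unary.AllPairs.Properties as AllPairsₚ
open import Data.Nat
open import Data.Nat.Induction using (<-rec)
open import Data.Nat.ListAction using (sum)
open import Data.Nat.ListAction.Properties using (sum-++; sum-↭)
open import Data.Nat.Logarithm
  using (⌊log₂_⌋; ⌊log₂⌋-mono-≤; ⌊log₂[2*b]⌋≡1+⌊log₂b⌋; ⌊log₂⌊n/2⌋⌋≡⌊log₂n⌋∸1; ⌊log₂[2^n]⌋≡n)
open import Data.Nat.Properties
open import Data.Nat.Tactic.RingSolver using (solve-∀)
open import Data.Product using (Σ-syntax; ∃-syntax; _×_; _,_; proj₁; proj₂)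
open import Data.Rational.Unnormalised as ℚᵘ using (ℚᵘ; mkℚᵘ; *≤*; *≡*)
import Data.Rational.Unnormalised.Properties as ℚᵘₚ
open import Data.Unit using (⊤; tt)
open import Function using (_∘_; id; flip)
open import Level using (0ℓ)
open import Relation.Binary using (StrictTotalOrder; tri<; tri≈; tri>)
import Relation.Binary.Construct.Add.Infimum.Strict as AddInfimum
open import Relation.Binary.PropositionalEquality
open import Relation.Nullary using (Dec; yes; no; does; ¬_)
open import Relation.Nullary.Construct.Add.Infimum using (⊥₋; [_])
open import Relation.Nullary.Decidable using (dec-true; dec-false; _×-dec_)
open import Relation.Nullary.Negation using (contradiction)

-- Expectations are cleared of denominators and become sums of natural numbers over explicit lists.
-- This is why the bounds carry the factors `size h !`, `numHeaps h` and `binom k l`, which count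
-- outcomes, and powers `2 ^ D` or `4 ^ D`, which replace divisions. The number `D` of upper levels
-- that are estimated trivially is a free parameter, decreased together with the height in each
-- induction; it becomes an integer logarithm only at the end. The obstacle in the construction is
-- that the cost of a sift depends on the heaps below, which must remain random afterwards. A sift
-- is therefore read backwards: for a fixed resulting heap the list `unsifts` of its origins is
-- explicit, and both the result and the cost are summed over that list. As blocks have `2 ^ s ∸ 1`
-- keys, all heaps are perfect trees. Costs are analysed on trees filled in preorder; it is shown
-- separately that the level order of arrays gives the same sums and that the array program stays
-- within the costs of the trees.

private variable
  K I I′ : Set

-- Finite sums over lists

∑ : List I → (I → ℕ) → ℕ
∑ xs f = sum (map f xs)

infix 6 ∑
syntax ∑ xs (λ x → e) = ∑[ x ∈ xs ] e

∑-cong : ∀ (xs : List I) {f g : I → ℕ} → (∀ x → f x ≡ g x) → ∑ xs f ≡ ∑ xs g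
∑-cong xs f≗g = cong sum (map-cong f≗g xs)

∑-congᴬ : ∀ {xs : List I} {f g : I → ℕ} → All (λ x → f x ≡ g x) xs → ∑ xs f ≡ ∑ xs g
∑-congᴬ []       = refl
∑-congᴬ (p ∷ ps) = cong₂ _+_ p (∑-congᴬ ps)

∑-monoᴬ : ∀ {xs : List I} {f g : I → ℕ} → All (λ x → f x ≤ g x) xs → ∑ xs f ≤ ∑ xs g
∑-monoᴬ []       = z≤n
∑-monoᴬ (p ∷ ps) = +-mono-≤ p (∑-monoᴬ ps)

∑-++ : ∀ (xs ys : List I) (f : I → ℕ) → ∑ (xs ++ ys) f ≡ ∑ xs f + ∑ ys f
∑-++ xs ys f = trans (cong sum (map-++ f xs ys)) (sum-++ (map f xs) (map f ys))

∑-map : ∀ (g : I → I′) (xs : List I) (f : I′ → ℕ) → ∑ (map g xs) f ≡ ∑ xs (f ∘ g)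
∑-map g xs f = cong sum (sym (map-∘ xs))

∑-concatMap : ∀ (g : I → List I′) (xs : List I) (f : I′ → ℕ) →
              ∑ (concatMap g xs) f ≡ ∑[ x ∈ xs ] ∑ (g x) f
∑-concatMap g []       f = refl
∑-concatMap g (x ∷ xs) f =
  trans (∑-++ (g x) (concatMap g xs) f) (cong (∑ (g x) f +_) (∑-concatMap g xs f))

∑-+ : ∀ (xs : List I) (f g : I → ℕ) → ∑[ x ∈ xs ] (f x + g x) ≡ ∑ xs f + ∑ xs g
∑-+ []       f g = refl
∑-+ (x ∷ xs) f g = trans (cong (f x + g x +_) (∑-+ xs f g)) (shuffle (f x) (g x) (∑ xs f) (∑ xs g))
  where
  shuffle : ∀ a b c d → a + b + (c + d) ≡ a + c + (b + d)
  shuffle = solve-∀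

∑-*ˡ : ∀ (xs : List I) c (f : I → ℕ) → ∑[ x ∈ xs ] (c * f x) ≡ c * ∑ xs f
∑-*ˡ []       c f = sym (*-zeroʳ c)
∑-*ˡ (x ∷ xs) c f = trans (cong (c * f x +_) (∑-*ˡ xs c f)) (sym (*-distribˡ-+ c (f x) (∑ xs f)))

∑-*ʳ : ∀ (xs : List I) c (f : I → ℕ) → ∑[ x ∈ xs ] (f x * c) ≡ ∑ xs f * c
∑-*ʳ xs c f = trans (∑-cong xs λ x → *-comm (f x) c) (trans (∑-*ˡ xs c f) (*-comm c (∑ xs f)))

∑-const : ∀ (xs : List I) c → ∑[ x ∈ xs ] c ≡ length xs * c
∑-const []       c = refl
∑-const (x ∷ xs) c = cong (c +_) (∑-const xs c)

∑-zero : ∀ (xs : List I) → ∑[ x ∈ xs ] 0 ≡ 0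
∑-zero xs = trans (∑-const xs 0) (*-zeroʳ (length xs))

∑∑-+ : ∀ (xs : List I) (ys : List I′) (f : I → ℕ) (g : I′ → ℕ) →
       ∑[ x ∈ xs ] ∑[ y ∈ ys ] (f x + g y) ≡ length ys * ∑ xs f + length xs * ∑ ys g
∑∑-+ xs ys f g = begin
  ∑[ x ∈ xs ] ∑[ y ∈ ys ] (f x + g y)        ≡⟨ ∑-cong xs (λ x → trans (∑-+ ys (λ _ → f x) g) (cong (_+ ∑ ys g) (∑-const ys (f x)))) ⟩
  ∑[ x ∈ xs ] (length ys * f x + ∑ ys g)     ≡⟨ ∑-+ xs (λ x → length ys * f x) (λ _ → ∑ ys g) ⟩
  _                                          ≡⟨ cong₂ _+_ (∑-*ˡ xs (length ys) f) (∑-const xs (∑ ys g)) ⟩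
  length ys * ∑ xs f + length xs * ∑ ys g    ∎
  where open ≡-Reasoning

-- Picks and splits

picks : List K → List (K × List K)
picks []       = []
picks (x ∷ xs) = (x , xs) ∷ map (λ (y , r) → y , x ∷ r) (picks xs)

-- Meant for lists of length k + l, which are split into a subsequence of length k
-- and the complementary one.
splits : ℕ → ℕ → List K → List (List K × List K)
splits zero    l       S       = ([] , S) ∷ []
splits (suc k) zero    S       = (S , []) ∷ []
splits (suc k) (suc l) []      = []
splits (suc k) (suc l) (x ∷ S) =
  map (λ (U , V) → x ∷ U , V) (splits k (suc l) S) ++ map (λ (U , V) → U , x ∷ V) (splits (suc k) l S)

-- The binomial coefficient of `k + l` over `k`, indexed by both parts so that Pascal's rule has the
-- same recursion as `splits`.
binom : ℕ → ℕ → ℕ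
binom zero    l       = 1
binom (suc k) zero    = 1
binom (suc k) (suc l) = binom k (suc l) + binom (suc k) l

∑-splits-suc : ∀ k l (x : K) S (f : List K × List K → ℕ) →
  ∑ (splits (suc k) (suc l) (x ∷ S)) f ≡
  (∑[ (U , V) ∈ splits k (suc l) S ] f (x ∷ U , V)) + (∑[ (U , V) ∈ splits (suc k) l S ] f (U , x ∷ V))
∑-splits-suc k l x S f = trans
  (∑-++ (map (λ (U , V) → x ∷ U , V) (splits k (suc l) S)) _ f)
  (cong₂ _+_ (∑-map _ (splits k (suc l) S) f) (∑-map _ (splits (suc k) l S) f))

length-splits : ∀ k l (S : List K) → length S ≡ k + l → length (splits k l S) ≡ binom k l
length-splits k l S eq = trans (sym (trans (∑-const (splits k l S) 1) (*-identityʳ _))) (go k l S eq)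
  where
  go : ∀ k l (S : List K) → length S ≡ k + l → ∑[ _ ∈ splits k l S ] 1 ≡ binom k l
  go zero    l       S       eq = refl
  go (suc k) zero    S       eq = refl
  go (suc k) (suc l) (x ∷ S) eq = trans (∑-splits-suc k l x S (λ _ → 1))
    (cong₂ _+_ (go k (suc l) S (suc-injective eq))
               (go (suc k) l S (trans (suc-injective eq) (+-suc k l))))

length-picks : ∀ (S : List K) → All (λ (_ , r) → suc (length r) ≡ length S) (picks S)
length-picks []      = []
length-picks (x ∷ S) = refl ∷ Allₚ.map⁺ (All.map (cong suc) (length-picks S))

length-splits-parts : ∀ k l (S : List K) → length S ≡ k + l →
  All (λ (U , V) → length U ≡ k × length V ≡ l) (splits k l S)
length-splits-parts zero    l       S       eq = (refl , eq) ∷ []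
length-splits-parts (suc k) zero    S       eq = (trans eq (+-identityʳ _) , refl) ∷ []
length-splits-parts (suc k) (suc l) (x ∷ S) eq = Allₚ.++⁺
  (Allₚ.map⁺ (All.map (λ (p , q) → cong suc p , q) (length-splits-parts k (suc l) S (suc-injective eq))))
  (Allₚ.map⁺ (All.map (λ (p , q) → p , cong suc q)
    (length-splits-parts (suc k) l S (trans (suc-injective eq) (+-suc k l)))))

∑-splits-sym : ∀ k l (S : List K) → length S ≡ k + l → ∀ (f : List K → List K → ℕ) →
  ∑[ (U , V) ∈ splits k l S ] f U V ≡ ∑[ (V , U) ∈ splits l k S ] f U V
∑-splits-sym zero    zero    []      eq f = refl
∑-splits-sym zero    (suc l) S       eq f = refl
∑-splits-sym (suc k) zero    S       eq f = refl
∑-splits-sym (suc k) (suc l) (x ∷ S) eq f = begin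
  _ ≡⟨ ∑-splits-suc k l x S _ ⟩
  _ ≡⟨ cong₂ _+_ (∑-splits-sym k (suc l) S (suc-injective eq) (λ U V → f (x ∷ U) V))
                 (∑-splits-sym (suc k) l S (trans (suc-injective eq) (+-suc k l)) (λ U V → f U (x ∷ V))) ⟩
  _ ≡⟨ +-comm (∑[ (V , U) ∈ splits (suc l) k S ] f (x ∷ U) V) _ ⟩
  _ ≡⟨ ∑-splits-suc l k x S _ ⟨
  _ ∎
  where open ≡-Reasoning

-- Double counting: a part may be chosen before one of its elements, or the element first and then a
-- split of the rest. In `∑-unsifts` this moves the choice of the sifted key inside one of the two
-- subheaps.
∑-splits-picksˡ : ∀ k l (S : List K) → length S ≡ suc k + l → ∀ (f : K → List K → List K → ℕ) →
  ∑[ (U , V) ∈ splits (suc k) l S ] ∑[ (y , U′) ∈ picks U ] f y U′ V ≡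
  ∑[ (y , r) ∈ picks S ] ∑[ (U′ , V) ∈ splits k l r ] f y U′ V
∑-splits-picksˡ zero    zero    (x ∷ [])    eq f = refl
∑-splits-picksˡ (suc k) zero    S           eq f =
  trans (+-identityʳ _) (∑-cong (picks S) λ _ → sym (+-identityʳ _))
∑-splits-picksˡ zero    (suc l) (x ∷ S)     eq f = begin
  _ ≡⟨ ∑-splits-suc 0 l x S _ ⟩
  f x [] S + 0 + 0 + (∑[ (U , V) ∈ splits 1 l S ] ∑[ (y , U′) ∈ picks U ] f y U′ (x ∷ V))
    ≡⟨ cong₂ _+_ (+-identityʳ _) (trans (∑-splits-picksˡ 0 l S (suc-injective eq) (λ y U V → f y U (x ∷ V)))
         (sym (∑-map _ (picks S) _))) ⟩
  _ ∎
  where open ≡-Reasoning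
∑-splits-picksˡ (suc k) (suc l) (x ∷ S)     eq f = begin
  _ ≡⟨ ∑-splits-suc (suc k) l x S _ ⟩
  _ ≡⟨ cong₂ _+_ (trans (∑-cong (splits (suc k) (suc l) S) λ (U , V) → cong (f x U V +_) (∑-map _ (picks U) _))
                        (∑-+ (splits (suc k) (suc l) S) _ _))
                 (∑-splits-picksˡ (suc k) l S (trans (suc-injective eq) (+-suc (suc k) l)) (λ y U V → f y U (x ∷ V))) ⟩
  a + (∑[ (U , V) ∈ splits (suc k) (suc l) S ] ∑[ (y , U′) ∈ picks U ] f y (x ∷ U′) V) + c
    ≡⟨ cong (λ b → a + b + c) (∑-splits-picksˡ k (suc l) S (suc-injective eq) (λ y U V → f y (x ∷ U) V)) ⟩
  a + b + c
    ≡⟨ +-assoc a b c ⟩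
  a + (b + c)
    ≡⟨ cong (a +_) (∑-+ (picks S) _ _) ⟨
  _ ≡⟨ cong (a +_) (∑-cong (picks S) λ (y , r) → ∑-splits-suc k l x r _) ⟨
  _ ≡⟨ cong (a +_) (∑-map _ (picks S) _) ⟨
  _ ∎
  where
  open ≡-Reasoning
  a = ∑[ (U , V) ∈ splits (suc k) (suc l) S ] f x U V
  b = ∑[ (y , r) ∈ picks S ] ∑[ (U , V) ∈ splits k (suc l) r ] f y (x ∷ U) V
  c = ∑[ (y , r) ∈ picks S ] ∑[ (U , V) ∈ splits (suc k) l r ] f y U (x ∷ V)

∑-splits-picksʳ : ∀ k l (S : List K) → length S ≡ k + suc l → ∀ (f : K → List K → List K → ℕ) →
  ∑[ (U , V) ∈ splits k (suc l) S ] ∑[ (y , V′) ∈ picks V ] f y U V′ ≡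
  ∑[ (y , r) ∈ picks S ] ∑[ (U , V′) ∈ splits k l r ] f y U V′
∑-splits-picksʳ k l S eq f = begin
  _ ≡⟨ ∑-splits-sym k (suc l) S eq _ ⟩
  _ ≡⟨ ∑-splits-picksˡ l k S eq′ (λ y V U → f y U V) ⟩
  _ ≡⟨ ∑-congᴬ (All.map (λ {(y , r)} p → ∑-splits-sym l k r (suc-injective (trans p eq′)) (λ V U → f y U V)) (length-picks S)) ⟩
  _ ∎
  where
  open ≡-Reasoning
  eq′ = trans eq (+-comm k (suc l))

-- Sums over permutations

∑-permutations-∷ : ∀ (x : K) xs (f : List K → ℕ) →
  ∑ (permutations (x ∷ xs)) f ≡ ∑[ π ∈ permutations xs ] ∑ (insertions x π) f
∑-permutations-∷ x xs f = ∑-concatMap (insertions x) (permutations xs) f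

∑-permutations-picks : ∀ (x : K) xs (f : List K → ℕ) →
  ∑ (permutations (x ∷ xs)) f ≡
  ∑[ (y , r) ∈ picks (x ∷ xs) ] ∑[ π ∈ permutations r ] f (y ∷ π)
∑-permutations-picks x []       f = cong (_+ 0) (sym (+-identityʳ _))
∑-permutations-picks {K} x (z ∷ zs) f = begin
  _ ≡⟨ ∑-permutations-∷ x (z ∷ zs) f ⟩
  _ ≡⟨ ∑-cong (permutations (z ∷ zs)) head-or-later ⟩
  _ ≡⟨ ∑-+ (permutations (z ∷ zs)) (λ π → f (x ∷ π)) later ⟩
  _ ≡⟨ cong (first +_) (∑-permutations-picks z zs later) ⟩
  _ ≡⟨ cong (first +_) (∑-cong (picks (z ∷ zs)) λ (y , r) → ∑-permutations-∷ x r (λ π → f (y ∷ π))) ⟨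
  _ ≡⟨ cong (first +_) (∑-map (λ (y , r) → y , x ∷ r) (picks (z ∷ zs)) _) ⟨
  _ ∎
  where
  open ≡-Reasoning
  first = ∑[ π ∈ permutations (z ∷ zs) ] f (x ∷ π)
  later : List K → ℕ
  later []      = 0
  later (y ∷ π) = ∑[ ρ ∈ insertions x π ] f (y ∷ ρ)
  head-or-later : ∀ π → ∑ (insertions x π) f ≡ f (x ∷ π) + later π
  head-or-later []      = refl
  head-or-later (y ∷ π) = cong (f (x ∷ y ∷ π) +_) (∑-map (y ∷_) (insertions x π) f)

-- A random permutation is cut after `k` entries: the first part is a uniformly random choice of `k`
-- keys, and given it both parts are independent uniform permutations.
∑-permutations-split : ∀ k l (S : List K) → length S ≡ k + l → ∀ (f : List K → List K → ℕ) →
  ∑[ π ∈ permutations S ] f (take k π) (drop k π) ≡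
  ∑[ (U , V) ∈ splits k l S ] ∑[ π ∈ permutations U ] ∑[ ρ ∈ permutations V ] f π ρ
∑-permutations-split zero    l S       eq f = sym (trans (+-identityʳ _) (+-identityʳ _))
∑-permutations-split (suc k) l (x ∷ S) eq f = begin
  _ ≡⟨ ∑-permutations-picks x S _ ⟩
  _ ≡⟨ ∑-congᴬ (All.map (λ {(y , r)} p → ∑-permutations-split k l r (suc-injective (trans p eq)) (λ π → f (y ∷ π)))
                        (length-picks (x ∷ S))) ⟩
  _ ≡⟨ ∑-splits-picksˡ k l (x ∷ S) eq (λ y U V → ∑[ π ∈ permutations U ] ∑[ ρ ∈ permutations V ] f (y ∷ π) ρ) ⟨
  _ ≡⟨ ∑-congᴬ (All.map (λ {(U , V)} (|U| , _) → pick U V |U|) (length-splits-parts (suc k) l (x ∷ S) eq)) ⟨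
  _ ∎
  where
  open ≡-Reasoning
  pick : ∀ U V → length U ≡ suc k →
    ∑[ π ∈ permutations U ] ∑[ ρ ∈ permutations V ] f π ρ ≡
    ∑[ (y , U′) ∈ picks U ] ∑[ π ∈ permutations U′ ] ∑[ ρ ∈ permutations V ] f (y ∷ π) ρ
  pick (z ∷ U) V _ = ∑-permutations-picks z U (λ π → ∑[ ρ ∈ permutations V ] f π ρ)

length-permutations-split : ∀ k l (S : List K) → length S ≡ k + l →
  binom k l * (k ! * l !) ≡ length S !
length-permutations-split k l S eq = begin
  binom k l * (k ! * l !)                   ≡⟨ cong (_* (k ! * l !)) (length-splits k l S eq) ⟨
  length (splits k l S) * (k ! * l !)       ≡⟨ ∑-const (splits k l S) _ ⟨
  ∑[ _ ∈ splits k l S ] (k ! * l !)         ≡⟨ ∑-congᴬ (All.map (λ {UV} → each {UV}) (length-splits-parts k l S eq)) ⟨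
  _                                         ≡⟨ ∑-permutations-split k l S eq (λ _ _ → 1) ⟨
  ∑[ _ ∈ permutations S ] 1                 ≡⟨ trans (∑-const (permutations S) 1) (*-identityʳ _) ⟩
  length (permutations S)                   ≡⟨ length-permutations S ⟩
  length S !                                ∎
  where
  open ≡-Reasoning
  each : ∀ {UV} → length (proj₁ UV) ≡ k × length (proj₂ UV) ≡ l →
         ∑[ _ ∈ permutations (proj₁ UV) ] ∑[ _ ∈ permutations (proj₂ UV) ] 1 ≡ k ! * l !
  each {U , V} (p , q) = begin
    _ ≡⟨ ∑-cong (permutations U) (λ _ → trans (∑-const (permutations V) 1) (*-identityʳ _)) ⟩
    _ ≡⟨ ∑-const (permutations U) _ ⟩
    _ ≡⟨ cong₂ _*_ (trans (length-permutations U) (cong _! p)) (trans (length-permutations V) (cong _! q)) ⟩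
    _ ∎

insertions-length : ∀ (x : K) π → All (λ ρ → length ρ ≡ suc (length π)) (insertions x π)
insertions-length x []      = refl ∷ []
insertions-length x (y ∷ π) = refl ∷ Allₚ.map⁺ (All.map (cong suc) (insertions-length x π))

permutations-length : ∀ (S : List K) → All (λ π → length π ≡ length S) (permutations S)
permutations-length []      = refl ∷ []
permutations-length (x ∷ S) = Allₚ.concat⁺ (Allₚ.map⁺ (All.map
  (λ {π} |π| → All.map (λ eq → trans eq (cong suc |π|)) (insertions-length x π)) (permutations-length S)))

∑-insertions-comm : ∀ (x y : K) π (f : List K → ℕ) →
  ∑[ ρ ∈ insertions y π ] ∑ (insertions x ρ) f ≡ ∑[ ρ ∈ insertions x π ] ∑ (insertions y ρ) f
∑-insertions-comm x y []      f = exchange (f (x ∷ y ∷ [])) (f (y ∷ x ∷ []))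
  where
  exchange : ∀ a b → a + (b + 0) + 0 ≡ b + (a + 0) + 0
  exchange = solve-∀
∑-insertions-comm {K} x y (z ∷ π) f = begin
  _ ≡⟨ expand x y ⟩
  _ ≡⟨ cong (λ w → f (x ∷ y ∷ z ∷ π) + (f (y ∷ x ∷ z ∷ π) + e x y) + (e y x + w))
            (∑-insertions-comm x y π (λ ρ → f (z ∷ ρ))) ⟩
  _ ≡⟨ exchange (f (x ∷ y ∷ z ∷ π)) (f (y ∷ x ∷ z ∷ π)) (e x y) (e y x) _ ⟩
  _ ≡⟨ expand y x ⟨
  _ ∎
  where
  open ≡-Reasoning
  e : K → K → ℕ
  e x y = ∑[ ρ ∈ insertions x π ] f (y ∷ z ∷ ρ)
  exchange : ∀ a b c d w → a + (b + c) + (d + w) ≡ b + (a + d) + (c + w)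
  exchange = solve-∀
  expand : ∀ x y → ∑[ ρ ∈ insertions y (z ∷ π) ] ∑ (insertions x ρ) f ≡
    f (x ∷ y ∷ z ∷ π) + (f (y ∷ x ∷ z ∷ π) + e x y) +
    (e y x + (∑[ ρ ∈ insertions y π ] ∑[ σ ∈ insertions x ρ ] f (z ∷ σ)))
  expand x y = cong₂ _+_
    (cong (f (x ∷ y ∷ z ∷ π) +_) (trans (∑-map (y ∷_) (insertions x (z ∷ π)) f)
      (cong (f (y ∷ x ∷ z ∷ π) +_) (∑-map (z ∷_) (insertions x π) _))))
    (trans (∑-map (z ∷_) (insertions y π) _) (trans
      (∑-cong (insertions y π) λ ρ → cong (f (x ∷ z ∷ ρ) +_) (∑-map (z ∷_) (insertions x ρ) f))
      (∑-+ (insertions y π) (λ ρ → f (x ∷ z ∷ ρ)) _)))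

-- The enumeration depends on the order of the list, sums over it do not. Hence the keys may be
-- listed in decreasing order, as `heaps` expects.
∑-permutations-↭ : ∀ {S T : List K} → S ↭ T → ∀ f → ∑ (permutations S) f ≡ ∑ (permutations T) f
∑-permutations-↭ Perm.refl            f = refl
∑-permutations-↭ (Perm.prep {S} {T} x S↭T) f = trans (∑-permutations-∷ x S f)
  (trans (∑-permutations-↭ S↭T (λ π → ∑ (insertions x π) f)) (sym (∑-permutations-∷ x T f)))
∑-permutations-↭ {K} (Perm.swap {S} {T} x y S↭T) f = begin
  _ ≡⟨ twice x y S ⟩
  _ ≡⟨ ∑-permutations-↭ S↭T (λ π → ∑[ ρ ∈ insertions y π ] ∑ (insertions x ρ) f) ⟩
  _ ≡⟨ ∑-cong (permutations T) (λ π → ∑-insertions-comm x y π f) ⟩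
  _ ≡⟨ twice y x T ⟨
  _ ∎
  where
  open ≡-Reasoning
  twice : ∀ x y S → ∑ (permutations (x ∷ y ∷ S)) f ≡
          ∑[ π ∈ permutations S ] ∑[ ρ ∈ insertions y π ] ∑ (insertions x ρ) f
  twice x y S = trans (∑-permutations-∷ x (y ∷ S) f) (∑-permutations-∷ y S _)
∑-permutations-↭ (Perm.trans S↭T T↭U) f = trans (∑-permutations-↭ S↭T f) (∑-permutations-↭ T↭U f)

∑-insertions-map : ∀ {B : Set} (g : K → B) x π f →
  ∑ (insertions (g x) (map g π)) f ≡ ∑[ ρ ∈ insertions x π ] f (map g ρ)
∑-insertions-map g x []      f = refl
∑-insertions-map g x (y ∷ π) f = cong (f (g x ∷ g y ∷ map g π) +_) (trans (∑-map (g y ∷_) (insertions (g x) (map g π)) f)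
  (trans (∑-insertions-map g x π (λ ρ → f (g y ∷ ρ))) (sym (∑-map (y ∷_) (insertions x π) _))))

∑-permutations-map : ∀ {B : Set} (g : K → B) S f →
  ∑ (permutations (map g S)) f ≡ ∑[ π ∈ permutations S ] f (map g π)
∑-permutations-map g []      f = refl
∑-permutations-map g (x ∷ S) f = begin
  _ ≡⟨ ∑-permutations-∷ (g x) (map g S) f ⟩
  _ ≡⟨ ∑-permutations-map g S _ ⟩
  _ ≡⟨ ∑-cong (permutations S) (λ π → ∑-insertions-map g x π f) ⟩
  _ ≡⟨ ∑-permutations-∷ x S _ ⟨
  _ ∎
  where open ≡-Reasoning

-- Binomial coefficients and the number of marked pairs

binom-sym : ∀ k l → binom k l ≡ binom l k
binom-sym zero    zero    = refl
binom-sym zero    (suc l) = refl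
binom-sym (suc k) zero    = refl
binom-sym (suc k) (suc l) =
  trans (cong₂ _+_ (binom-sym k (suc l)) (binom-sym (suc k) l)) (+-comm (binom (suc l) k) _)

-- The absorption identity; the two ratio estimates below come from it by cancelling a factor.
binom-absorb : ∀ k l → suc k * binom (suc k) l ≡ (suc k + l) * binom k l
binom-absorb k       zero    = cong₂ _*_ (sym (+-identityʳ (suc k))) (binom-0 k)
  where
  binom-0 : ∀ k → 1 ≡ binom k 0
  binom-0 zero    = refl
  binom-0 (suc k) = refl
binom-absorb zero    (suc l) = begin
  1 * (1 + binom 1 l)     ≡⟨ *-distribˡ-+ 1 1 (binom 1 l) ⟩
  1 + 1 * binom 1 l       ≡⟨ cong suc (binom-absorb 0 l) ⟩
  suc ((1 + l) * 1)       ∎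
  where open ≡-Reasoning
binom-absorb (suc k) (suc l) = begin
  suc (suc k) * (b + binom (suc (suc k)) l)
    ≡⟨ *-distribˡ-+ (suc (suc k)) b _ ⟩
  (b + suc k * b) + suc (suc k) * binom (suc (suc k)) l
    ≡⟨ cong₂ (λ u v → (b + u) + v) (binom-absorb k (suc l)) (binom-absorb (suc k) l) ⟩
  (b + (suc k + suc l) * binom k (suc l)) + (suc (suc k) + l) * binom (suc k) l
    ≡⟨ arith k l (binom k (suc l)) (binom (suc k) l) ⟩
  (suc (suc k) + suc l) * b ∎
  where
  open ≡-Reasoning
  b = binom (suc k) (suc l)
  arith : ∀ k l p q → ((p + q) + (suc k + suc l) * p) + (suc (suc k) + l) * q ≡
                      (suc (suc k) + suc l) * (p + q)
  arith = solve-∀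

-- The ratio is `(2k + 2)(2k + 1) / (k + 1)²` by two absorptions. In terms of random halves: two
-- given keys are separated with probability at least one half.
binom-central : ∀ k → binom (suc k) (suc k) ≤ 4 * binom k k
binom-central k = *-cancelˡ-≤ (suc k) (begin
  suc k * binom (suc k) (suc k)       ≡⟨ binom-absorb k (suc k) ⟩
  (suc k + suc k) * binom k (suc k)   ≡⟨ cong ((suc k + suc k) *_) (binom-sym k (suc k)) ⟩
  (suc k + suc k) * binom (suc k) k   ≡⟨ *-distribʳ-+ (binom (suc k) k) (suc k) (suc k) ⟩
  _                                   ≡⟨ cong₂ _+_ (binom-absorb k k) (binom-absorb k k) ⟩
  _                                   ≤⟨ +-mono-≤ (*-monoˡ-≤ (binom k k) k+k≤) (*-monoˡ-≤ (binom k k) k+k≤) ⟩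
  _                                   ≡⟨ arith k (binom k k) ⟩
  suc k * (4 * binom k k)             ∎)
  where
  open ≤-Reasoning
  k+k≤ : suc k + k ≤ suc k + suc k
  k+k≤ = +-monoʳ-≤ (suc k) (n≤1+n k)
  arith : ∀ k b → (suc k + suc k) * b + (suc k + suc k) * b ≡ suc k * (4 * b)
  arith = solve-∀

-- The ratio is `(l + 1 + k) / (l + 1)`. In terms of random splits: a given key falls into the
-- smaller part with probability at most one half.
binom-half : ∀ k l → suc l ≤ k → 2 * binom l k ≤ binom (suc l) k
binom-half k l l<k = *-cancelˡ-≤ (suc l) (begin
  suc l * (2 * binom l k)        ≡⟨ arith (suc l) (binom l k) ⟩
  (suc l + suc l) * binom l k    ≤⟨ *-monoˡ-≤ (binom l k) (+-monoʳ-≤ (suc l) l<k) ⟩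
  (suc l + k) * binom l k        ≡⟨ binom-absorb l k ⟨
  suc l * binom (suc l) k        ∎)
  where
  open ≤-Reasoning
  arith : ∀ n b → n * (2 * b) ≡ (n + n) * b
  arith = solve-∀

-- The number of ordered pairs of distinct elements among `a`. Under random halving its total
-- decreases geometrically, while the total weight is merely distributed.
φ : ℕ → ℕ
φ a = a * (a ∸ 1)

φ-+ : ∀ a b → φ (a + b) ≡ φ a + φ b + 2 * (a * b)
φ-+ zero    b       = sym (+-identityʳ (φ b))
φ-+ (suc a) zero    = trans (cong φ (+-identityʳ (suc a)))
  (sym (trans (cong (φ (suc a) + 0 +_) (cong (2 *_) (*-zeroʳ (suc a)))) (trans (+-identityʳ _) (+-identityʳ _))))
φ-+ (suc a) (suc b) = trans (cong ((suc a + suc b) *_) (+-suc a b)) (arith a b)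
  where
  arith : ∀ a b → (suc a + suc b) * (suc a + b) ≡ suc a * a + suc b * b + 2 * (suc a * suc b)
  arith = solve-∀

φ-mono : ∀ {a b} → a ≤ b → φ a ≤ φ b
φ-mono a≤b = *-mono-≤ a≤b (∸-monoˡ-≤ 1 a≤b)

φ≡0 : ∀ {a} → a ≤ 1 → φ a ≡ 0
φ≡0 z≤n       = refl
φ≡0 (s≤s z≤n) = refl

module Weights {A : Set} (μ : A → ℕ) (μ≤1 : ∀ u → μ u ≤ 1) where

  weight : List A → ℕ
  weight S = ∑ S μ

  weight-picks : ∀ S → All (λ (y , r) → weight r ≤ weight S) (picks S)
  weight-picks []      = []
  weight-picks (x ∷ S) = m≤n+m _ (μ x) ∷ Allₚ.map⁺ (All.map (+-monoʳ-≤ (μ x)) (weight-picks S))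

  weight-splits : ∀ k l S → length S ≡ k + l →
                  All (λ (U , V) → weight U + weight V ≡ weight S) (splits k l S)
  weight-splits zero    l       S       eq = refl ∷ []
  weight-splits (suc k) zero    S       eq = +-identityʳ (weight S) ∷ []
  weight-splits (suc k) (suc l) (x ∷ S) eq = Allₚ.++⁺
    (Allₚ.map⁺ (All.map (λ {(U , V)} p → trans (+-assoc (μ x) (weight U) (weight V)) (cong (μ x +_) p))
      (weight-splits k (suc l) S (suc-injective eq))))
    (Allₚ.map⁺ (All.map (λ {(U , V)} p → trans (swap (weight U) (μ x) (weight V)) (cong (μ x +_) p))
      (weight-splits (suc k) l S (trans (suc-injective eq) (+-suc k l)))))
    where
    swap : ∀ a b c → a + (b + c) ≡ b + (a + c)
    swap = solve-∀

  -- Each single key lies in `U` for `binom k l` splits, namely those of the remaining keys.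
  ∑-weightˡ : ∀ k l S → length S ≡ suc k + l →
              ∑[ (U , V) ∈ splits (suc k) l S ] weight U ≡ binom k l * weight S
  ∑-weightˡ zero    zero    S       eq = refl
  ∑-weightˡ (suc k) zero    S       eq = refl
  ∑-weightˡ zero    (suc l) (x ∷ S) eq = begin
    _ ≡⟨ ∑-splits-suc 0 l x S _ ⟩
    μ x + 0 + 0 + (∑[ (U , V) ∈ splits 1 l S ] weight U) ≡⟨ cong₂ _+_ (trans (+-identityʳ _) (+-identityʳ _)) (∑-weightˡ 0 l S (suc-injective eq)) ⟩
    μ x + binom 0 l * weight S ≡⟨ cong (μ x +_) (*-identityˡ _) ⟩
    μ x + weight S ≡⟨ *-identityˡ _ ⟨
    _ ∎
    where open ≡-Reasoning
  ∑-weightˡ (suc k) (suc l) (x ∷ S) eq = begin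
    _ ≡⟨ ∑-splits-suc (suc k) l x S _ ⟩
    _ ≡⟨ cong₂ _+_ (∑-+ (splits (suc k) (suc l) S) (λ _ → μ x) (λ (U , V) → weight U))
                   (∑-weightˡ (suc k) l S (trans (suc-injective eq) (+-suc (suc k) l))) ⟩
    _ ≡⟨ cong₂ (λ a b → a + b + binom (suc k) l * weight S)
           (trans (∑-const (splits (suc k) (suc l) S) (μ x))
                  (cong (_* μ x) (length-splits (suc k) (suc l) S (suc-injective eq))))
           (∑-weightˡ k (suc l) S (suc-injective eq)) ⟩
    _ ≡⟨ arith (binom k (suc l)) (binom (suc k) l) (μ x) (weight S) ⟩
    _ ∎
    where
    open ≡-Reasoning
    arith : ∀ p q m w → (p + q) * m + p * w + q * w ≡ (p + q) * (m + w)
    arith = solve-∀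

  ∑-weightʳ : ∀ k l S → length S ≡ k + suc l →
              ∑[ (U , V) ∈ splits k (suc l) S ] weight V ≡ binom k l * weight S
  ∑-weightʳ k l S eq = begin
    _ ≡⟨ ∑-splits-sym k (suc l) S eq (λ U V → weight V) ⟩
    _ ≡⟨ ∑-weightˡ l k S (trans eq (+-comm k (suc l))) ⟩
    _ ≡⟨ cong (_* weight S) (binom-sym l k) ⟩
    _ ∎
    where open ≡-Reasoning

  -- Meant for a block of size `k` and all later blocks together; the dominance of the almost binary
  -- expansion supplies `l ≤ k`.
  ∑-weight-half : ∀ k l S → length S ≡ k + l → l ≤ k →
                  2 * ∑ (splits k l S) (λ (U , V) → weight V) ≤ binom k l * weight S
  ∑-weight-half zero    zero    []      eq l≤k = ≤-refl
  ∑-weight-half (suc k) zero    S       eq l≤k = z≤n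
  ∑-weight-half k       (suc l) S       eq l≤k = begin
    _                             ≡⟨ cong (2 *_) (∑-weightʳ k l S eq) ⟩
    2 * (binom k l * weight S)    ≡⟨ *-assoc 2 (binom k l) (weight S) ⟨
    2 * binom k l * weight S      ≤⟨ *-monoˡ-≤ (weight S) half ⟩
    _                             ∎
    where
    open ≤-Reasoning
    half : 2 * binom k l ≤ binom k (suc l)
    half = subst₂ (λ b c → 2 * b ≤ c) (binom-sym l k) (binom-sym (suc l) k) (binom-half k l l≤k)

  -- Each ordered pair of distinct marked keys is sent to `U` and `V` by the `binom k l` splits of
  -- the other keys. That `φ` counts these pairs rests on `μ x ≤ 1`, which gives `φ (μ x) ≡ 0` in
  -- the inductive step.
  ∑-weight-product : ∀ k l S → length S ≡ suc k + suc l →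
    ∑[ (U , V) ∈ splits (suc k) (suc l) S ] (weight U * weight V) ≡ binom k l * φ (weight S)
  ∑-weight-product k l (x ∷ S) eq = begin
    _ ≡⟨ ∑-splits-suc k l x S _ ⟩
    _ ≡⟨ cong₂ _+_ first second ⟩
    (m * (binom k l * w) + (∑[ (U , V) ∈ splits k (suc l) S ] (weight U * weight V))) +
      (m * (binom k l * w) + (∑[ (U , V) ∈ splits (suc k) l S ] (weight U * weight V)))
      ≡⟨ regroup m (binom k l) w _ _ ⟩
    binom k l * (2 * (m * w)) + ((∑[ (U , V) ∈ splits k (suc l) S ] (weight U * weight V))
                                + (∑[ (U , V) ∈ splits (suc k) l S ] (weight U * weight V)))
      ≡⟨ cong (binom k l * (2 * (m * w)) +_) (both k l (suc-injective eq)) ⟩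
    binom k l * (2 * (m * w)) + binom k l * φ w
      ≡⟨ *-distribˡ-+ (binom k l) _ _ ⟨
    binom k l * (2 * (m * w) + φ w)
      ≡⟨ cong (binom k l *_) (trans (+-comm _ (φ w)) (sym (trans (φ-+ m w) (cong (λ z → z + φ w + 2 * (m * w)) (φ≡0 (μ≤1 x)))))) ⟩
    _ ∎
    where
    open ≡-Reasoning
    m = μ x
    w = weight S
    regroup : ∀ m b w X Y → (m * (b * w) + X) + (m * (b * w) + Y) ≡ b * (2 * (m * w)) + (X + Y)
    regroup = solve-∀
    first : ∑[ (U , V) ∈ splits k (suc l) S ] ((m + weight U) * weight V) ≡
            m * (binom k l * w) + (∑[ (U , V) ∈ splits k (suc l) S ] (weight U * weight V))
    first = begin
      _ ≡⟨ ∑-cong (splits k (suc l) S) (λ (U , V) → *-distribʳ-+ (weight V) m (weight U)) ⟩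
      _ ≡⟨ ∑-+ (splits k (suc l) S) _ _ ⟩
      _ ≡⟨ cong (_+ _) (trans (∑-*ˡ (splits k (suc l) S) m _) (cong (m *_) (∑-weightʳ k l S (suc-injective eq)))) ⟩
      _ ∎
    second : ∑[ (U , V) ∈ splits (suc k) l S ] (weight U * (m + weight V)) ≡
             m * (binom k l * w) + (∑[ (U , V) ∈ splits (suc k) l S ] (weight U * weight V))
    second = begin
      _ ≡⟨ ∑-cong (splits (suc k) l S) (λ (U , V) → trans (*-distribˡ-+ (weight U) m (weight V)) (cong (_+ weight U * weight V) (*-comm (weight U) m))) ⟩
      _ ≡⟨ ∑-+ (splits (suc k) l S) _ _ ⟩
      _ ≡⟨ cong (_+ _) (trans (∑-*ˡ (splits (suc k) l S) m _)
             (cong (m *_) (∑-weightˡ k l S (trans (suc-injective eq) (+-suc k l))))) ⟩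
      _ ∎
    left : ∀ k l → length S ≡ suc k + suc l →
           ∑[ (U , V) ∈ splits (suc k) (suc l) S ] (weight U * weight V) ≡ binom k l * φ w
    left k l eq = ∑-weight-product k l S eq
    right0 : ∀ k → ∑[ (U , V) ∈ splits (suc k) 0 S ] (weight U * weight V) ≡ 0
    right0 k = trans (+-identityʳ _) (*-zeroʳ w)
    -- A part may now be empty, where the induction hypothesis does not apply and the product of
    -- weights vanishes. In the regular case the two counts add up by Pascal's rule.
    both : ∀ k l → length S ≡ k + suc l →
           (∑[ (U , V) ∈ splits k (suc l) S ] (weight U * weight V)) +
           (∑[ (U , V) ∈ splits (suc k) l S ] (weight U * weight V)) ≡ binom k l * φ w
    both zero    zero    eq = trans (right0 0) (sym (trans (*-identityˡ (φ w)) (φ≡0 (singleton S eq))))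
      where
      singleton : ∀ S → length S ≡ 1 → weight S ≤ 1
      singleton (z ∷ []) _ = ≤-trans (≤-reflexive (+-identityʳ _)) (μ≤1 z)
    both zero    (suc l) eq = left 0 l eq
    both (suc k) zero    eq = trans (cong₂ _+_ (left k 0 eq) (right0 (suc k)))
      (trans (+-identityʳ _) (cong (_* φ w) (binom-0 k)))
      where
      binom-0 : ∀ k → binom k 0 ≡ 1
      binom-0 zero    = refl
      binom-0 (suc k) = refl
    both (suc k) (suc l) eq = trans
      (cong₂ _+_ (left k (suc l) eq) (left (suc k) l (trans eq (+-suc (suc k) (suc l)))))
      (sym (*-distribʳ-+ (φ w) (binom k (suc l)) (binom (suc k) l)))

  -- A pair either stays together or is separated, so `X + 2 * Y` counts all pairs over all splits,
  -- and `binom-central` makes the separated ones at least half of them.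
  ∑-φ-halve : ∀ k S → length S ≡ k + k →
    2 * ∑ (splits k k S) (λ (U , V) → φ (weight U) + φ (weight V)) ≤ binom k k * φ (weight S)
  ∑-φ-halve zero    []  eq = ≤-refl
  ∑-φ-halve (suc k) S   eq = +-cancelʳ-≤ (4 * (binom k k * Φ)) _ _ (begin
    2 * X + 4 * (binom k k * Φ)         ≡⟨ cong (λ z → 2 * X + 4 * z) (∑-weight-product k k S eq) ⟨
    2 * X + 4 * Y                       ≡⟨ arith X Y ⟩
    2 * (X + 2 * Y)                     ≡⟨ cong (2 *_) total ⟩
    2 * (B * Φ)                         ≡⟨ cong (B * Φ +_) (+-identityʳ _) ⟩
    B * Φ + B * Φ                       ≤⟨ +-monoʳ-≤ (B * Φ) (*-monoˡ-≤ Φ (binom-central k)) ⟩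
    B * Φ + 4 * binom k k * Φ           ≡⟨ cong (B * Φ +_) (*-assoc 4 (binom k k) Φ) ⟩
    B * Φ + 4 * (binom k k * Φ)         ∎)
    where
    open ≤-Reasoning
    xs = splits (suc k) (suc k) S
    B = binom (suc k) (suc k)
    Φ = φ (weight S)
    X = ∑[ (U , V) ∈ xs ] (φ (weight U) + φ (weight V))
    Y = ∑[ (U , V) ∈ xs ] (weight U * weight V)
    arith : ∀ X Y → 2 * X + 4 * Y ≡ 2 * (X + 2 * Y)
    arith = solve-∀
    total : X + 2 * Y ≡ B * Φ
    total = begin-equality
      X + 2 * Y                     ≡⟨ cong (X +_) (∑-*ˡ xs 2 _) ⟨
      _                             ≡⟨ ∑-+ xs _ _ ⟨
      _                             ≡⟨ ∑-congᴬ (All.map (λ {(U , V)} p → trans (sym (φ-+ (weight U) (weight V))) (cong φ p))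
                                        (weight-splits (suc k) (suc k) S eq)) ⟩
      _                             ≡⟨ ∑-const xs Φ ⟩
      length xs * Φ                 ≡⟨ cong (_* Φ) (length-splits (suc k) (suc k) S eq) ⟩
      B * Φ                         ∎

∑-swap : ∀ {X Y : Set} (xs : List X) (ys : List Y) (f : X → Y → ℕ) →
         ∑[ x ∈ xs ] ∑[ y ∈ ys ] f x y ≡ ∑[ y ∈ ys ] ∑[ x ∈ xs ] f x y
∑-swap []       ys f = sym (∑-zero ys)
∑-swap (x ∷ xs) ys f = trans (cong (∑ ys (f x) +_) (∑-swap xs ys f)) (sym (∑-+ ys (f x) _))

-- Perfect trees and random heaps

size : ℕ → ℕ
size zero    = 0
size (suc h) = suc (size h + size h)

-- Blocks have `blockSize s` keys, so perfect trees suffice. The index gives both subtrees of a node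
-- the same height, and `size` counts the nodes without the subtraction in `blockSize`.
data Tree (A : Set) : ℕ → Set where
  leaf : Tree A 0
  node : ∀ {h} → A → Tree A h → Tree A h → Tree A (suc h)

AllT : ∀ {A : Set} {h} → (A → Set) → Tree A h → Set
AllT P leaf         = ⊤
AllT P (node v l r) = P v × AllT P l × AllT P r

-- The i-th permuted key is put at the i-th position in preorder; d is irrelevant.
fill : ∀ {A : Set} → A → ∀ h → List A → Tree A h
fill d zero    π       = leaf
fill d (suc h) []      = node d (fill d h []) (fill d h [])
fill d (suc h) (y ∷ π) = node y (fill d h (take (size h) π)) (fill d h (drop (size h) π))

-- The heap-ordered trees with the entries of a decreasing list.
heaps : ∀ {A : Set} h → List A → List (Tree A h)
heaps zero    S       = leaf ∷ []
heaps (suc h) []      = []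
heaps (suc h) (v ∷ S) = concatMap
  (λ (U , V) → concatMap (λ l → map (node v l) (heaps h V)) (heaps h U))
  (splits (size h) (size h) S)

numHeaps : ℕ → ℕ
numHeaps zero    = 1
numHeaps (suc h) = binom (size h) (size h) * (numHeaps h * numHeaps h)

-- The triples (y , l , r) from which sifting down y above the heaps l and r
-- produces a given heap; y ends up at an arbitrary position.
unsifts : ∀ {A : Set} {h} → Tree A (suc h) → List (A × Tree A h × Tree A h)
unsifts {h = zero}  (node v l r) = (v , l , r) ∷ []
unsifts {h = suc h} (node v l r) =
  (v , l , r) ∷
  (map (λ (y , l₁ , l₂) → y , node v l₁ l₂ , r) (unsifts l) ++
   map (λ (y , r₁ , r₂) → y , l , node v r₁ r₂) (unsifts r))

module _ {A : Set} where

  ∑-heaps : ∀ h (v : A) S (f : Tree A (suc h) → ℕ) →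
    ∑ (heaps (suc h) (v ∷ S)) f ≡
    ∑[ (U , V) ∈ splits (size h) (size h) S ] ∑[ l ∈ heaps h U ] ∑[ r ∈ heaps h V ] f (node v l r)
  ∑-heaps h v S f = begin
    _ ≡⟨ ∑-concatMap _ (splits (size h) (size h) S) f ⟩
    _ ≡⟨ ∑-cong (splits (size h) (size h) S) (λ (U , V) → trans (∑-concatMap _ (heaps h U) f)
           (∑-cong (heaps h U) λ l → ∑-map (node v l) (heaps h V) f)) ⟩
    _ ∎
    where open ≡-Reasoning

  All-heaps : ∀ h (v : A) S {P : Tree A (suc h) → Set} →
    All (λ (U , V) → All (λ l → All (λ r → P (node v l r)) (heaps h V)) (heaps h U)) (splits (size h) (size h) S) →
    All P (heaps (suc h) (v ∷ S))
  All-heaps h v S ps = Allₚ.concat⁺ (Allₚ.map⁺ (All.map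
    (λ qs → Allₚ.concat⁺ (Allₚ.map⁺ (All.map Allₚ.map⁺ qs))) ps))

  length-heaps : ∀ h (S : List A) → length S ≡ size h → length (heaps h S) ≡ numHeaps h
  length-heaps zero    S       eq = refl
  length-heaps (suc h) (v ∷ S) eq = begin
    _ ≡⟨ trans (∑-const (heaps (suc h) (v ∷ S)) 1) (*-identityʳ _) ⟨
    _ ≡⟨ ∑-heaps h v S (λ _ → 1) ⟩
    _ ≡⟨ ∑-congᴬ (All.map (λ {(U , V)} (p , q) → each U V p q) (length-splits-parts (size h) (size h) S eq′)) ⟩
    _ ≡⟨ ∑-const (splits (size h) (size h) S) _ ⟩
    _ ≡⟨ cong (_* _) (length-splits (size h) (size h) S eq′) ⟩
    _ ∎
    where
    open ≡-Reasoning
    eq′ = suc-injective eq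
    each : ∀ U V → length U ≡ size h → length V ≡ size h →
           ∑[ _ ∈ heaps h U ] ∑[ _ ∈ heaps h V ] 1 ≡ numHeaps h * numHeaps h
    each U V p q = begin
      _ ≡⟨ ∑-cong (heaps h U) (λ _ → trans (∑-const (heaps h V) 1) (*-identityʳ _)) ⟩
      _ ≡⟨ ∑-const (heaps h U) _ ⟩
      _ ≡⟨ cong₂ _*_ (length-heaps h U p) (length-heaps h V q) ⟩
      _ ∎

  splits-All : ∀ {P : A → Set} k l {S} → All P S → All (λ (U , V) → All P U × All P V) (splits k l S)
  splits-All zero    l       ps       = ([] , ps) ∷ []
  splits-All (suc k) zero    ps       = (ps , []) ∷ []
  splits-All (suc k) (suc l) []       = []
  splits-All (suc k) (suc l) (p ∷ ps) = Allₚ.++⁺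
    (Allₚ.map⁺ (All.map (λ (us , vs) → p ∷ us , vs) (splits-All k (suc l) ps)))
    (Allₚ.map⁺ (All.map (λ (us , vs) → us , p ∷ vs) (splits-All (suc k) l ps)))

  splits-AllPairs : ∀ {R : A → A → Set} k l {S} → AllPairs R S →
                    All (λ (U , V) → AllPairs R U × AllPairs R V) (splits k l S)
  splits-AllPairs zero    l       ps       = ([] , ps) ∷ []
  splits-AllPairs (suc k) zero    ps       = (ps , []) ∷ []
  splits-AllPairs (suc k) (suc l) []       = []
  splits-AllPairs (suc k) (suc l) (p ∷ ps) = Allₚ.++⁺
    (Allₚ.map⁺ (All.zipWith (λ ((p′ , _) , (us , vs)) → p′ ∷ us , vs)
      (splits-All k (suc l) p , splits-AllPairs k (suc l) ps)))
    (Allₚ.map⁺ (All.zipWith (λ ((_ , p′) , (us , vs)) → us , p′ ∷ vs)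
      (splits-All (suc k) l p , splits-AllPairs (suc k) l ps)))

  picks-All : ∀ {P : A → Set} {S} → All P S → All (λ (y , r) → P y × All P r) (picks S)
  picks-All []       = []
  picks-All (p ∷ ps) = (p , ps) ∷ Allₚ.map⁺ (All.map (λ (q , qs) → q , p ∷ qs) (picks-All ps))

  picks-AllPairs : ∀ {R : A → A → Set} {S} → AllPairs R S → All (λ (y , r) → AllPairs R r) (picks S)
  picks-AllPairs []       = []
  picks-AllPairs (p ∷ ps) = ps ∷ Allₚ.map⁺ (All.zipWith (λ ((_ , q) , qs) → q ∷ qs)
    (picks-All p , picks-AllPairs ps))

  heaps-AllT : ∀ {P : A → Set} h {S} → length S ≡ size h → All P S → All (AllT P) (heaps h S)
  heaps-AllT zero    eq ps       = tt ∷ []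
  heaps-AllT (suc h) {v ∷ S} eq (p ∷ ps) = All-heaps h v S (All.zipWith
    (λ {(U , V)} ((|U| , |V|) , (us , vs)) →
      All.map (λ l → All.map (λ r → p , l , r) (heaps-AllT h |V| vs)) (heaps-AllT h |U| us))
    (length-splits-parts (size h) (size h) S (suc-injective eq) , splits-All (size h) (size h) ps))

  length-unsifts : ∀ h (t : Tree A (suc h)) → length (unsifts t) ≡ size (suc h)
  length-unsifts zero    (node v l r) = refl
  length-unsifts (suc h) (node v l r) = cong suc (begin
    _ ≡⟨ length-++ (map _ (unsifts l)) ⟩
    _ ≡⟨ cong₂ _+_ (length-map _ (unsifts l)) (length-map _ (unsifts r)) ⟩
    _ ≡⟨ cong₂ _+_ (length-unsifts h l) (length-unsifts h r) ⟩
    _ ∎)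
    where open ≡-Reasoning

  unsifts-AllT : ∀ {P : A → Set} h (t : Tree A (suc h)) → AllT P t → All (λ (y , _) → P y) (unsifts t)
  unsifts-AllT zero    (node v l r) (p , _)       = p ∷ []
  unsifts-AllT (suc h) (node v l r) (p , pl , pr) = p ∷ Allₚ.++⁺
    (Allₚ.map⁺ (unsifts-AllT h l pl)) (Allₚ.map⁺ (unsifts-AllT h r pr))

  ∑-unsifts-suc : ∀ h v (l r : Tree A (suc h)) (f : A × Tree A (suc h) × Tree A (suc h) → ℕ) →
    ∑ (unsifts (node v l r)) f ≡
    f (v , l , r) + ((∑[ (y , l₁ , l₂) ∈ unsifts l ] f (y , node v l₁ l₂ , r)) +
                     (∑[ (y , r₁ , r₂) ∈ unsifts r ] f (y , l , node v r₁ r₂)))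
  ∑-unsifts-suc h v l r f = cong (f (v , l , r) +_) (trans (∑-++ (map _ (unsifts l)) _ f)
    (cong₂ _+_ (∑-map _ (unsifts l) f) (∑-map _ (unsifts r) f)))

  -- Removing the key at a random position of a random heap and undoing the sift
  -- leaves two independent random heaps below a random key.
  ∑-unsifts : ∀ h (S : List A) → length S ≡ size (suc h) →
    ∀ (f : A × Tree A h × Tree A h → ℕ) →
    ∑[ (y , R) ∈ picks S ] ∑[ (U , V) ∈ splits (size h) (size h) R ]
      ∑[ l ∈ heaps h U ] ∑[ r ∈ heaps h V ] f (y , l , r) ≡
    ∑[ H ∈ heaps (suc h) S ] ∑ (unsifts H) f
  ∑-unsifts zero    (v ∷ [])     eq f = trans (+-identityʳ _) (+-identityʳ _)
  ∑-unsifts (suc h) (v ∷ T)      eq f = begin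
    -- If the sifted key is the maximum `v`, it stays at the root. Otherwise `v` is still the head
    -- of the rest, so it becomes the head of `U` or of `V` and thereby the root of one of the two
    -- subheaps.
    root + (∑[ (y , R) ∈ map (λ (y , r) → y , v ∷ r) (picks T) ] ∑[ (U , V) ∈ splits s s R ] E y U V)
      ≡⟨ cong (root +_) (∑-map _ (picks T) _) ⟩
    root + (∑[ (y , R) ∈ picks T ] ∑[ (U , V) ∈ splits s s (v ∷ R) ] E y U V)
      ≡⟨ cong (root +_) (trans (∑-cong (picks T) λ (y , R) → ∑-splits-suc s′ s′ v R _) (∑-+ (picks T) _ _)) ⟩
    root + ((∑[ (y , R) ∈ picks T ] ∑[ (U , V) ∈ splits s′ s R ] E y (v ∷ U) V) +
            (∑[ (y , R) ∈ picks T ] ∑[ (U , V) ∈ splits s s′ R ] E y U (v ∷ V)))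
      ≡⟨ cong (root +_) (cong₂ _+_ (∑-splits-picksˡ s′ s T eq′ (λ y U V → E y (v ∷ U) V))
                                   (∑-splits-picksʳ s s′ T eq′ (λ y U V → E y U (v ∷ V)))) ⟨
    root + ((∑[ (U , V) ∈ splits s s T ] ∑[ (y , U′) ∈ picks U ] E y (v ∷ U′) V) +
            (∑[ (U , V) ∈ splits s s T ] ∑[ (y , V′) ∈ picks V ] E y U (v ∷ V′)))
      ≡⟨ cong (root +_) (cong₂ _+_
           (∑-congᴬ (All.map (λ {(U , V)} (p , q) → intoLeft U V p) parts))
           (∑-congᴬ (All.map (λ {(U , V)} (p , q) → intoRight U V q) parts))) ⟩
    root + ((∑[ (U , V) ∈ splits s s T ] L U V) + (∑[ (U , V) ∈ splits s s T ] R U V))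
      ≡⟨ trans (cong (root +_) (sym (∑-+ (splits s s T) _ _))) (sym (∑-+ (splits s s T) _ _)) ⟩
    _ ≡⟨ ∑-cong (splits s s T) (λ (U , V) →
           trans (cong₂ _+_ refl (trans (sym (∑-+ (heaps (suc h) U) _ _)) (∑-cong (heaps (suc h) U) λ l → sym (∑-+ (heaps (suc h) V) _ _))))
           (trans (sym (∑-+ (heaps (suc h) U) _ _)) (∑-cong (heaps (suc h) U) λ l → sym (∑-+ (heaps (suc h) V) _ _)))) ⟩
    _ ≡⟨ ∑-cong (splits s s T) (λ (U , V) → ∑-cong (heaps (suc h) U) λ l → ∑-cong (heaps (suc h) V) λ r →
           ∑-unsifts-suc h v l r f) ⟨
    _ ≡⟨ ∑-heaps (suc h) v T _ ⟨
    _ ∎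
    where
    open ≡-Reasoning
    s  = size (suc h)
    s′ = size h + size h
    eq′ : length T ≡ s + s
    eq′ = suc-injective eq
    parts = length-splits-parts s s T eq′
    E : A → List A → List A → ℕ
    E y U V = ∑[ l ∈ heaps (suc h) U ] ∑[ r ∈ heaps (suc h) V ] f (y , l , r)
    root = ∑[ (U , V) ∈ splits s s T ] ∑[ l ∈ heaps (suc h) U ] ∑[ r ∈ heaps (suc h) V ] f (v , l , r)
    L R : List A → List A → ℕ
    L U V = ∑[ l ∈ heaps (suc h) U ] ∑[ r ∈ heaps (suc h) V ] ∑[ (y , l₁ , l₂) ∈ unsifts l ] f (y , node v l₁ l₂ , r)
    R U V = ∑[ l ∈ heaps (suc h) U ] ∑[ r ∈ heaps (suc h) V ] ∑[ (y , r₁ , r₂) ∈ unsifts r ] f (y , l , node v r₁ r₂)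
    intoLeft : ∀ U V → length U ≡ s → ∑[ (y , U′) ∈ picks U ] E y (v ∷ U′) V ≡ L U V
    intoLeft U V p = begin
      _ ≡⟨ ∑-cong (picks U) (λ (y , U′) → ∑-heaps h v U′ _) ⟩
      _ ≡⟨ ∑-unsifts h U p (λ (y , l₁ , l₂) → ∑[ r ∈ heaps (suc h) V ] f (y , node v l₁ l₂ , r)) ⟩
      _ ≡⟨ ∑-cong (heaps (suc h) U) (λ l → ∑-swap (unsifts l) (heaps (suc h) V) _) ⟩
      _ ∎
    intoRight : ∀ U V → length V ≡ s → ∑[ (y , V′) ∈ picks V ] E y U (v ∷ V′) ≡ R U V
    intoRight U V q = begin
      _ ≡⟨ ∑-swap (picks V) (heaps (suc h) U) _ ⟩
      _ ≡⟨ ∑-cong (heaps (suc h) U) (λ l → ∑-cong (picks V) λ (y , V′) → ∑-heaps h v V′ _) ⟩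
      _ ≡⟨ ∑-cong (heaps (suc h) U) (λ l → ∑-unsifts h V q (λ (y , r₁ , r₂) → f (y , l , node v r₁ r₂))) ⟩
      _ ∎

-- Costs of sifting on trees

crowded : ℕ → ℕ
crowded zero          = 0
crowded (suc zero)    = 0
crowded (suc (suc _)) = 1

crowded≤1 : ∀ a → crowded a ≤ 1
crowded≤1 zero          = z≤n
crowded≤1 (suc zero)    = z≤n
crowded≤1 (suc (suc _)) = ≤-refl

2crowded≤φ : ∀ a → 2 * crowded a ≤ φ a
2crowded≤φ zero          = z≤n
2crowded≤φ (suc zero)    = z≤n
2crowded≤φ (suc (suc a)) = *-mono-≤ {2} {suc (suc a)} {1} {suc a} (s≤s (s≤s z≤n)) (s≤s z≤n)

-- The hypothesis `p + q ≤ a` expresses that the compared keys are two different keys of a tree of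
-- weight `a`; if the comparison counts, the tree has two marked keys.
crowded-pair : ∀ {p q a} → p ≤ 1 → q ≤ 1 → p + q ≤ a → p * q ≤ crowded a
crowded-pair z≤n       _         _               = z≤n
crowded-pair (s≤s z≤n) z≤n       _               = z≤n
crowded-pair (s≤s z≤n) (s≤s z≤n) (s≤s (s≤s z≤n)) = ≤-refl

module Costs {A : Set} (d : A) (_<ᵉ_ : A → A → Bool) (μ : A → ℕ) (μ≤1 : ∀ u → μ u ≤ 1) where

  open Weights μ μ≤1

  sift : ∀ {h} → A → Tree A h → Tree A h → Tree A (suc h)
  sift y leaf leaf = node y leaf leaf
  sift y l@(node u l₁ l₂) r@(node v r₁ r₂) =
    if u <ᵉ v then (if y <ᵉ v then node v l (sift y r₁ r₂) else node y l r)
              else (if y <ᵉ u then node u (sift y l₁ l₂) r else node y l r)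

  -- A product of two marks is 1 exactly when the comparison of the two keys counts.
  siftCost : ∀ {h} → A → Tree A h → Tree A h → ℕ
  siftCost y leaf leaf = 0
  siftCost y (node u l₁ l₂) (node v r₁ r₂) = μ u * μ v +
    (if u <ᵉ v then μ y * μ v + (if y <ᵉ v then siftCost y r₁ r₂ else 0)
               else μ y * μ u + (if y <ᵉ u then siftCost y l₁ l₂ else 0))

  heapify : ∀ {h} → Tree A h → Tree A h
  heapify leaf         = leaf
  heapify (node y l r) = sift y (heapify l) (heapify r)

  buildCost : ∀ {h} → Tree A h → ℕ
  buildCost leaf         = 0
  buildCost (node y l r) = buildCost l + buildCost r + siftCost y (heapify l) (heapify r)

  weightT : ∀ {h} → Tree A h → ℕ
  weightT leaf         = 0
  weightT (node v l r) = μ v + (weightT l + weightT r)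

  -- `_<ᵉ_` is only a Boolean function here, and a key may stand on either side of a test, so the
  -- answers to both tests are recorded.
  _≻_ : A → A → Set
  u ≻ v = v <ᵉ u ≡ true × u <ᵉ v ≡ false

  Ordered : ∀ {h} → Tree A h → Set
  Ordered leaf         = ⊤
  Ordered (node v l r) = AllT (v ≻_) l × AllT (v ≻_) r × Ordered l × Ordered r

  heaps-ordered : ∀ h {S} → length S ≡ size h → AllPairs _≻_ S → All Ordered (heaps h S)
  heaps-ordered zero    eq ps = tt ∷ []
  heaps-ordered (suc h) {v ∷ S} eq (p ∷ ps) = All-heaps h v S (All.zipWith
    (λ {(U , V)} ((|U| , |V|) , ((us , vs) , (us′ , vs′))) →
      All.zipWith (λ (l , l′) → All.zipWith (λ (r , r′) → l , r , l′ , r′)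
                                  (heaps-AllT h |V| vs , heaps-ordered h |V| vs′))
                  (heaps-AllT h |U| us , heaps-ordered h |U| us′))
    (length-splits-parts (size h) (size h) S (suc-injective eq) ,
     All.zipWith (λ (a , b) → a , b) (splits-All (size h) (size h) p , splits-AllPairs (size h) (size h) ps)))

  heaps-weight : ∀ h {S} → length S ≡ size h → All (λ H → weightT H ≡ weight S) (heaps h S)
  heaps-weight zero    {[]}    eq = refl ∷ []
  heaps-weight (suc h) {v ∷ S} eq = All-heaps h v S (All.zipWith
    (λ {(U , V)} ((|U| , |V|) , p) →
      All.map (λ l → All.map (λ r → cong (μ v +_) (trans (cong₂ _+_ l r) p)) (heaps-weight h |V|)) (heaps-weight h |U|))
    (length-splits-parts (size h) (size h) S (suc-injective eq) ,
     weight-splits (size h) (size h) S (suc-injective eq)))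

  sift-root : ∀ {h} v (l r : Tree A h) → AllT (v ≻_) l → AllT (v ≻_) r → sift v l r ≡ node v l r
  sift-root v leaf leaf _ _ = refl
  sift-root v (node u _ _) (node w _ _) ((_ , u≮) , _) ((_ , w≮) , _) with u <ᵉ w
  ... | true  rewrite w≮ = refl
  ... | false rewrite u≮ = refl

  sift-left : ∀ {h} y v (l₁ l₂ : Tree A h) r → v ≻ y → AllT (v ≻_) r →
              sift y (node v l₁ l₂) r ≡ node v (sift y l₁ l₂) r
  sift-left y v l₁ l₂ (node w _ _) (y<v , _) ((_ , v≮w) , _) rewrite v≮w | y<v = refl

  sift-right : ∀ {h} y v l (r₁ r₂ : Tree A h) → v ≻ y → AllT (v ≻_) l →
               sift y l (node v r₁ r₂) ≡ node v l (sift y r₁ r₂)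
  sift-right y v (node u _ _) r₁ r₂ (y<v , _) ((u<v , _) , _) rewrite u<v | y<v = refl

  -- The root `v` exceeds every key of the other subtree and the sifted key, so the sifted key
  -- descends to the side from which it was taken.
  sift-unsifts : ∀ h (H : Tree A (suc h)) → Ordered H → All (λ (y , l , r) → sift y l r ≡ H) (unsifts H)
  sift-unsifts zero    (node v leaf leaf) _ = refl ∷ []
  sift-unsifts (suc h) (node v l r) (pl , pr , ol , or) = sift-root v l r pl pr ∷ Allₚ.++⁺
    (Allₚ.map⁺ (All.zipWith (λ {(y , l₁ , l₂)} (v≻y , eq) →
        trans (sift-left y v l₁ l₂ r v≻y pr) (cong (λ t → node v t r) eq))
      (unsifts-AllT h l pl , sift-unsifts h l ol)))
    (Allₚ.map⁺ (All.zipWith (λ {(y , r₁ , r₂)} (v≻y , eq) →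
        trans (sift-right y v l r₁ r₂ v≻y pl) (cong (λ t → node v l t) eq))
      (unsifts-AllT h r pr , sift-unsifts h r or)))

  -- A bound for the cost of sifting, summed over all ways to obtain a given heap:
  -- the two comparisons made at a node b count only if b is an ancestor of the final
  -- position of the sifted key and the final subtree of b contains two marked keys.
  pathCost : ∀ {h} → Tree A h → ℕ
  pathCost leaf                     = 0
  pathCost {suc h} t@(node v l r) = size (suc h) * crowded (weightT t) + (pathCost l + pathCost r)

  AllT-μ : ∀ {h} (t : Tree A h) → AllT (λ y → μ y ≤ weightT t) t
  AllT-μ t = go t ≤-refl
    where
    go : ∀ {h n} (t : Tree A h) → weightT t ≤ n → AllT (λ y → μ y ≤ n) t
    go leaf         _ = tt
    go (node v l r) p = ≤-trans (m≤m+n _ _) p ,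
      go l (≤-trans (≤-trans (m≤m+n _ _) (m≤n+m _ (μ v))) p) ,
      go r (≤-trans (≤-trans (m≤n+m _ (weightT l)) (m≤n+m _ (μ v))) p)

  siftCost-root : ∀ {h} v (l r : Tree A h) → AllT (v ≻_) l → AllT (v ≻_) r →
                  siftCost v l r ≤ 2 * crowded (weightT (node v l r))
  siftCost-root v leaf leaf _ _ = z≤n
  siftCost-root v l@(node u l₁ l₂) r@(node w r₁ r₂) ((_ , v≮u) , _) ((_ , v≮w) , _) = +-mono-≤ children (rest (u <ᵉ w))
    where
    children : μ u * μ w ≤ crowded (weightT (node v l r))
    children = crowded-pair (μ≤1 u) (μ≤1 w)
      (≤-trans (+-mono-≤ (m≤m+n (μ u) _) (m≤m+n (μ w) _)) (m≤n+m _ (μ v)))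
    rest : ∀ b → (if b then μ v * μ w + (if v <ᵉ w then siftCost v r₁ r₂ else 0)
                       else μ v * μ u + (if v <ᵉ u then siftCost v l₁ l₂ else 0)) ≤
                 crowded (weightT (node v l r)) + 0
    rest true  rewrite v≮w = +-monoˡ-≤ 0 (crowded-pair (μ≤1 v) (μ≤1 w)
      (+-monoʳ-≤ (μ v) (≤-trans (m≤m+n _ _) (m≤n+m _ (weightT l)))))
    rest false rewrite v≮u = +-monoˡ-≤ 0 (crowded-pair (μ≤1 v) (μ≤1 u)
      (+-monoʳ-≤ (μ v) (≤-trans (m≤m+n _ _) (m≤m+n _ (weightT r)))))

  -- In the application `t` is the left subtree after the sift. It contains `y`, whence
  -- `μ y ≤ weightT t`, so the two comparisons at this node concern keys of the final tree.
  siftCost-left : ∀ {h} y v (l₁ l₂ : Tree A h) (t r : Tree A (suc h)) → v ≻ y → AllT (v ≻_) r → μ y ≤ weightT t →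
    siftCost y (node v l₁ l₂) r ≤ 2 * crowded (weightT (node v t r)) + siftCost y l₁ l₂
  siftCost-left y v l₁ l₂ t r@(node w r₁ r₂) (y<v , _) ((_ , v≮w) , _) μy≤ rewrite v≮w | y<v = begin
    μ v * μ w + (μ y * μ v + siftCost y l₁ l₂)  ≡⟨ +-assoc (μ v * μ w) _ _ ⟨
    μ v * μ w + μ y * μ v + siftCost y l₁ l₂    ≤⟨ +-monoˡ-≤ _ (+-mono-≤
        (crowded-pair (μ≤1 v) (μ≤1 w) (+-monoʳ-≤ (μ v) (≤-trans (m≤m+n _ _) (m≤n+m _ (weightT t)))))
        (crowded-pair (μ≤1 y) (μ≤1 v) (≤-trans (≤-reflexive (+-comm (μ y) (μ v)))
          (+-monoʳ-≤ (μ v) (≤-trans μy≤ (m≤m+n _ (weightT r))))))) ⟩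
    c + c + siftCost y l₁ l₂                    ≡⟨ cong (λ z → c + z + siftCost y l₁ l₂) (+-identityʳ c) ⟨
    2 * c + siftCost y l₁ l₂                    ∎
    where
    open ≤-Reasoning
    c = crowded (weightT (node v t r))

  siftCost-right : ∀ {h} y v (r₁ r₂ : Tree A h) (l t : Tree A (suc h)) → v ≻ y → AllT (v ≻_) l → μ y ≤ weightT t →
    siftCost y l (node v r₁ r₂) ≤ 2 * crowded (weightT (node v l t)) + siftCost y r₁ r₂
  siftCost-right y v r₁ r₂ l@(node u l₁ l₂) t (y<v , _) ((u<v , _) , _) μy≤ rewrite u<v | y<v = begin
    μ u * μ v + (μ y * μ v + siftCost y r₁ r₂)  ≡⟨ +-assoc (μ u * μ v) _ _ ⟨
    μ u * μ v + μ y * μ v + siftCost y r₁ r₂    ≤⟨ +-monoˡ-≤ _ (+-mono-≤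
        (crowded-pair (μ≤1 u) (μ≤1 v) (≤-trans (≤-reflexive (+-comm (μ u) (μ v)))
          (+-monoʳ-≤ (μ v) (≤-trans (m≤m+n _ _) (m≤m+n _ (weightT t))))))
        (crowded-pair (μ≤1 y) (μ≤1 v) (≤-trans (≤-reflexive (+-comm (μ y) (μ v)))
          (+-monoʳ-≤ (μ v) (≤-trans μy≤ (m≤n+m _ (weightT l))))))) ⟩
    c + c + siftCost y r₁ r₂                    ≡⟨ cong (λ z → c + z + siftCost y r₁ r₂) (+-identityʳ c) ⟨
    2 * c + siftCost y r₁ r₂                    ∎
    where
    open ≤-Reasoning
    c = crowded (weightT (node v l t))

  -- A node is passed by those unsifts whose final position lies in its subtree. This is the origin
  -- of the factor `size (suc h)` in `pathCost`; the factor 2 stands for the two comparisons at each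
  -- node.
  ∑-siftCost-unsifts : ∀ h (H : Tree A (suc h)) → Ordered H →
                       ∑[ (y , l , r) ∈ unsifts H ] siftCost y l r ≤ 2 * pathCost H
  ∑-siftCost-unsifts zero    (node v leaf leaf) _ = z≤n
  ∑-siftCost-unsifts (suc h) H@(node v l r) (pl , pr , ol , or) = begin
    _ ≡⟨ ∑-unsifts-suc h v l r _ ⟩
    _ ≤⟨ +-mono-≤ (siftCost-root v l r pl pr) (+-mono-≤
           (∑-monoᴬ (All.zipWith (λ {(y , l₁ , l₂)} (v≻y , μy≤) → siftCost-left y v l₁ l₂ l r v≻y pr μy≤)
             (unsifts-AllT h l pl , unsifts-AllT h l (AllT-μ l))))
           (∑-monoᴬ (All.zipWith (λ {(y , r₁ , r₂)} (v≻y , μy≤) → siftCost-right y v r₁ r₂ l r v≻y pl μy≤)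
             (unsifts-AllT h r pr , unsifts-AllT h r (AllT-μ r))))) ⟩
    _ ≡⟨ cong (2 * c +_) (cong₂ _+_ (constant l) (constant r)) ⟩
    2 * c + ((n * (2 * c) + ∑ (unsifts l) (λ (y , l₁ , l₂) → siftCost y l₁ l₂)) +
             (n * (2 * c) + ∑ (unsifts r) (λ (y , r₁ , r₂) → siftCost y r₁ r₂)))
      ≤⟨ +-monoʳ-≤ (2 * c) (+-mono-≤ (+-monoʳ-≤ (n * (2 * c)) (∑-siftCost-unsifts h l ol))
                                     (+-monoʳ-≤ (n * (2 * c)) (∑-siftCost-unsifts h r or))) ⟩
    2 * c + ((n * (2 * c) + 2 * pathCost l) + (n * (2 * c) + 2 * pathCost r))
      ≡⟨ arith n c (pathCost l) (pathCost r) ⟩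
    2 * pathCost H ∎
    where
    open ≤-Reasoning
    c = crowded (weightT H)
    n = size (suc h)
    constant : ∀ (t : Tree A (suc h)) →
      ∑ (unsifts t) (λ (y , l₁ , l₂) → 2 * c + siftCost y l₁ l₂) ≡
      n * (2 * c) + ∑ (unsifts t) (λ (y , l₁ , l₂) → siftCost y l₁ l₂)
    constant t = trans (∑-+ (unsifts t) (λ _ → 2 * c) _) (cong (_+ _)
      (trans (∑-const (unsifts t) (2 * c)) (cong (_* (2 * c)) (length-unsifts h t))))
    arith : ∀ n c p q → 2 * c + ((n * (2 * c) + 2 * p) + (n * (2 * c) + 2 * q)) ≡
                        2 * ((1 + (n + n)) * c + (p + q))
    arith = solve-∀

  -- Uniformity of the constructed heap

  -- In preorder the root is the first entry and each subtree is a consecutive slice, so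
  -- conditioning on the first entry and cutting the rest gives two independent random subtrees.
  ∑-fill : ∀ h S → length S ≡ size (suc h) → (f : Tree A (suc h) → ℕ) →
    ∑[ π ∈ permutations S ] f (fill d (suc h) π) ≡
    ∑[ (y , R) ∈ picks S ] ∑[ (U , V) ∈ splits (size h) (size h) R ]
      ∑[ π ∈ permutations U ] ∑[ ρ ∈ permutations V ] f (node y (fill d h π) (fill d h ρ))
  ∑-fill h (x ∷ S) eq f = begin
    _ ≡⟨ ∑-permutations-picks x S _ ⟩
    _ ≡⟨ ∑-congᴬ (All.map (λ {(y , R)} p → ∑-permutations-split (size h) (size h) R (suc-injective (trans p eq)) 
           (λ π ρ → f (node y (fill d h π) (fill d h ρ)))) (length-picks (x ∷ S))) ⟩
    _ ∎
    where open ≡-Reasoning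

  -- The number of arrangements from which one given heap is built; the factor `size (suc h)` counts
  -- the final positions of the key sifted from the root.
  multiplicity : ℕ → ℕ
  multiplicity zero    = 1
  multiplicity (suc h) = multiplicity h * (multiplicity h * size (suc h))

  -- Uniformity is stated for every test function `g`, so that no decidable equality of heaps is
  -- required and any cost can be inserted later.
  Uniform : ℕ → Set
  Uniform h = ∀ S → length S ≡ size h → AllPairs _≻_ S → (g : Tree A h → ℕ) →
    ∑[ π ∈ permutations S ] g (heapify (fill d h π)) ≡ multiplicity h * ∑ (heaps h S) g

  -- Here `g` sees the sifted key and both heaps below it: applied to the result of the sift it
  -- gives uniformity, applied to `siftCost` the expected cost.
  ∑-picks-heapify : ∀ h → Uniform h → ∀ S → length S ≡ size (suc h) → AllPairs _≻_ S →
    (g : A → Tree A h → Tree A h → ℕ) →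
    ∑[ (y , R) ∈ picks S ] ∑[ (U , V) ∈ splits (size h) (size h) R ]
      ∑[ π ∈ permutations U ] ∑[ ρ ∈ permutations V ] g y (heapify (fill d h π)) (heapify (fill d h ρ)) ≡
    multiplicity h * (multiplicity h *
      ∑ (heaps (suc h) S) (λ H → ∑[ (y , l , r) ∈ unsifts H ] g y l r))
  ∑-picks-heapify h uniform S eq desc g = begin
    _ ≡⟨ ∑-congᴬ (All.zipWith (λ {(y , R)} (p , descR) →
           ∑-congᴬ (All.zipWith (λ {(U , V)} ((|U| , |V|) , (descU , descV)) → each y U V |U| |V| descU descV)
             (length-splits-parts s s R (suc-injective (trans p eq)) , splits-AllPairs s s descR)))
           (length-picks S , picks-AllPairs desc)) ⟩
    _ ≡⟨ ∑-cong (picks S) (λ (y , R) → ∑-*ˡ (splits s s R) k _) ⟩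
    _ ≡⟨ ∑-*ˡ (picks S) k _ ⟩
    _ ≡⟨ cong (k *_) (∑-cong (picks S) (λ (y , R) → ∑-*ˡ (splits s s R) k _)) ⟩
    _ ≡⟨ cong (k *_) (∑-*ˡ (picks S) k _) ⟩
    _ ≡⟨ cong (λ z → k * (k * z)) (∑-unsifts h S eq (λ (y , l , r) → g y l r)) ⟩
    _ ∎
    where
    open ≡-Reasoning
    s = size h
    k = multiplicity h
    each : ∀ y U V → length U ≡ s → length V ≡ s → AllPairs _≻_ U → AllPairs _≻_ V →
      ∑[ π ∈ permutations U ] ∑[ ρ ∈ permutations V ] g y (heapify (fill d h π)) (heapify (fill d h ρ)) ≡
      k * (k * (∑[ l ∈ heaps h U ] ∑[ r ∈ heaps h V ] g y l r))
    each y U V |U| |V| descU descV = begin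
      _ ≡⟨ uniform U |U| descU (λ l → ∑[ ρ ∈ permutations V ] g y l (heapify (fill d h ρ))) ⟩
      _ ≡⟨ cong (k *_) (∑-cong (heaps h U) λ l → uniform V |V| descV (g y l)) ⟩
      _ ≡⟨ cong (k *_) (∑-*ˡ (heaps h U) k _) ⟩
      _ ∎

  uniform : ∀ h → Uniform h
  uniform zero    []      eq desc g = sym (+-identityʳ _)
  uniform (suc h) S       eq desc g = begin
    _ ≡⟨ ∑-fill h S eq (g ∘ heapify) ⟩
    _ ≡⟨ ∑-picks-heapify h (uniform h) S eq desc (λ y l r → g (sift y l r)) ⟩
    k * (k * ∑ (heaps (suc h) S) (λ H → ∑[ (y , l , r) ∈ unsifts H ] g (sift y l r)))
      ≡⟨ cong (λ z → k * (k * z)) (∑-congᴬ (All.map (λ {H} → each H) (heaps-ordered (suc h) eq desc))) ⟩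
    k * (k * ∑ (heaps (suc h) S) (λ H → size (suc h) * g H))
      ≡⟨ cong (λ z → k * (k * z)) (∑-*ˡ (heaps (suc h) S) (size (suc h)) g) ⟩
    k * (k * (size (suc h) * ∑ (heaps (suc h) S) g))
      ≡⟨ arith k (size (suc h)) (∑ (heaps (suc h) S) g) ⟩
    _ ∎
    where
    open ≡-Reasoning
    k = multiplicity h
    arith : ∀ k n x → k * (k * (n * x)) ≡ k * (k * n) * x
    arith = solve-∀
    each : ∀ H → Ordered H → ∑[ (y , l , r) ∈ unsifts H ] g (sift y l r) ≡ size (suc h) * g H
    each H ordered = begin
      _ ≡⟨ ∑-congᴬ (All.map (cong g) (sift-unsifts h H ordered)) ⟩
      _ ≡⟨ ∑-const (unsifts H) (g H) ⟩
      _ ≡⟨ cong (_* g H) (length-unsifts h H) ⟩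
      _ ∎

  -- This is `uniform` for the constant function 1. It turns averages over heaps back into averages
  -- over permutations.
  multiplicity-numHeaps : ∀ h S → length S ≡ size h → AllPairs _≻_ S →
                          multiplicity h * numHeaps h ≡ size h !
  multiplicity-numHeaps h S eq desc = begin
    _ ≡⟨ cong (multiplicity h *_) (trans (sym (length-heaps h S eq)) (sym (trans (∑-const (heaps h S) 1) (*-identityʳ _)))) ⟩
    _ ≡⟨ uniform h S eq desc (λ _ → 1) ⟨
    _ ≡⟨ trans (∑-const (permutations S) 1) (*-identityʳ _) ⟩
    _ ≡⟨ length-permutations S ⟩
    _ ≡⟨ cong _! eq ⟩
    _ ∎
    where open ≡-Reasoning

-- If one of the lists has no marked keys, then no comparison counts.
mergeCost : ℕ → ℕ → ℕ
mergeCost zero    b       = 0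
mergeCost (suc a) zero    = 0
mergeCost (suc a) (suc b) = suc a + suc b

mergeCost≤+ : ∀ a b → mergeCost a b ≤ a + b
mergeCost≤+ zero    b       = z≤n
mergeCost≤+ (suc a) zero    = z≤n
mergeCost≤+ (suc a) (suc b) = ≤-refl

mergeCost≤φ : ∀ a b → mergeCost a b ≤ φ (a + b)
mergeCost≤φ zero    b       = z≤n
mergeCost≤φ (suc a) zero    = z≤n
mergeCost≤φ (suc a) (suc b) = subst (_≤ φ (suc a + suc b)) (*-identityʳ _)
  (*-monoʳ-≤ (suc a + suc b) (≤-trans (s≤s z≤n) (≤-reflexive (sym (+-suc a b)))))

-- The constant part of the construction bound when `E` levels are estimated trivially: that of two
-- subtrees, plus `suc E` for the levels on the path of the sift. In closed form it is
-- `2 ^ (E + 1) - E - 2`.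
buildFactor : ℕ → ℕ
buildFactor zero    = 0
buildFactor (suc E) = 2 * buildFactor E + suc E

-- The pair term of the construction bound is `2 * pairFactor E * φ w / 4 ^ E`. The initial
-- coefficient 4 solves `x = x / 2 + 2`, and the closed form is `3 * 2 ^ E - 1`.
pairFactor : ℕ → ℕ
pairFactor zero    = 2
pairFactor (suc E) = suc (2 * pairFactor E)

buildFactor-bound : ∀ E → buildFactor E ≤ 2 * 2 ^ E
buildFactor-bound E = ≤-trans (m≤m+n _ (E + 2)) (≤-reflexive (go E))
  where
  arith : ∀ f E → 2 * f + suc E + (suc E + 2) ≡ 2 * (f + (E + 2))
  arith = solve-∀
  go : ∀ E → buildFactor E + (E + 2) ≡ 2 * 2 ^ E
  go zero    = refl
  go (suc E) = trans (arith (buildFactor E) E) (cong (2 *_) (go E))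

pairFactor-bound : ∀ E → pairFactor E ≤ 3 * 2 ^ E
pairFactor-bound E = ≤-trans (n≤1+n _) (≤-reflexive (go E))
  where
  arith : ∀ g → suc (suc (2 * g)) ≡ 2 * suc g
  arith = solve-∀
  arith₂ : ∀ p → 2 * (3 * p) ≡ 3 * (2 * p)
  arith₂ = solve-∀
  go : ∀ E → suc (pairFactor E) ≡ 3 * 2 ^ E
  go zero    = refl
  go (suc E) = trans (arith (pairFactor E)) (trans (cong (2 *_) (go E)) (arith₂ (2 ^ E)))

-- Expected costs of construction and sorting on random heaps

module Bounds {A : Set} (d : A) (_<ᵉ_ : A → A → Bool) (μ : A → ℕ) (μ≤1 : ∀ u → μ u ≤ 1) where

  open Weights μ μ≤1
  open Costs d _<ᵉ_ μ μ≤1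

  -- Averaging over random halves doubles the constant `α`, preserves the linear term and at least
  -- halves the pair term. `q` and `N` are cleared denominators; the leading factor 2 clears that of
  -- the halving.
  ∑-split-bound : ∀ s (e : List A → ℕ) q N α γ β S → length S ≡ s + s →
    All (λ (U , V) → (q * e U ≤ N * (α + γ * weight U + β * φ (weight U))) ×
                     (q * e V ≤ N * (α + γ * weight V + β * φ (weight V)))) (splits s s S) →
    2 * (q * ∑ (splits s s S) (λ (U , V) → e U + e V)) ≤
    binom s s * (N * (4 * α + 2 * (γ * weight S) + β * φ (weight S)))
  ∑-split-bound s e q N α γ β S eq bounds = begin
    2 * (q * ∑ (splits s s S) (λ (U , V) → e U + e V))
      ≡⟨ trans (cong (2 *_) (sym (∑-*ˡ (splits s s S) q _))) (sym (∑-*ˡ (splits s s S) 2 _)) ⟩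
    ∑ (splits s s S) (λ (U , V) → 2 * (q * (e U + e V)))
      ≤⟨ ∑-monoᴬ (All.zipWith (λ {(U , V)} ((bU , bV) , eqw) → pointwise U V bU bV eqw)
                  (bounds , weight-splits s s S eq)) ⟩
    ∑ (splits s s S) (λ (U , V) → c + N * β * (2 * (φ (weight U) + φ (weight V))))
      ≡⟨ ∑-+ (splits s s S) _ _ ⟩
    _ ≡⟨ cong₂ _+_ (trans (∑-const (splits s s S) c) (cong (_* c) (length-splits s s S eq)))
                   (trans (∑-*ˡ (splits s s S) (N * β) _) (cong (N * β *_) (∑-*ˡ (splits s s S) 2 _))) ⟩
    B * c + N * β * (2 * ∑ (splits s s S) (λ (U , V) → φ (weight U) + φ (weight V)))
      ≤⟨ +-monoʳ-≤ (B * c) (*-monoʳ-≤ (N * β) (∑-φ-halve s S eq)) ⟩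
    B * c + N * β * (B * φ w)
      ≡⟨ arith B N α (γ * w) β (φ w) ⟩
    _ ∎
    where
    open ≤-Reasoning
    w = weight S
    B = binom s s
    c = N * (4 * α + 2 * (γ * w))
    arith : ∀ B N α x β p → B * (N * (4 * α + 2 * x)) + N * β * (B * p) ≡ B * (N * (4 * α + 2 * x + β * p))
    arith = solve-∀
    arith₁ : ∀ q a b → 2 * (q * (a + b)) ≡ 2 * (q * a) + 2 * (q * b)
    arith₁ = solve-∀
    arith₂ : ∀ N α γ β a b p r → 2 * (N * (α + γ * a + β * p)) + 2 * (N * (α + γ * b + β * r)) ≡
                                 N * (4 * α + 2 * (γ * (a + b))) + N * β * (2 * (p + r))
    arith₂ = solve-∀
    pointwise : ∀ U V → q * e U ≤ N * (α + γ * weight U + β * φ (weight U)) →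
                q * e V ≤ N * (α + γ * weight V + β * φ (weight V)) → weight U + weight V ≡ w →
                2 * (q * (e U + e V)) ≤ c + N * β * (2 * (φ (weight U) + φ (weight V)))
    pointwise U V bU bV eqw = begin
      _ ≡⟨ arith₁ q (e U) (e V) ⟩
      _ ≤⟨ +-mono-≤ (*-monoʳ-≤ 2 bU) (*-monoʳ-≤ 2 bV) ⟩
      _ ≡⟨ arith₂ N α γ β (weight U) (weight V) (φ (weight U)) (φ (weight V)) ⟩
      _ ≡⟨ cong (λ z → N * (4 * α + 2 * (γ * z)) + N * β * (2 * (φ (weight U) + φ (weight V)))) eqw ⟩
      _ ∎

  -- `X` is a cost with contribution at most `c` at the root, and `Y` is the same cost one level
  -- lower. A sum over heaps factors into splits and independent subheaps, to which `∑-split-bound`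
  -- applies.
  ∑-heaps-bound : ∀ h v S (X : Tree A (suc h) → ℕ) (Y : Tree A h → ℕ) c q α γ β →
    length S ≡ size h + size h →
    (∀ l r → weightT l + weightT r ≡ weight S → X (node v l r) ≤ c + (Y l + Y r)) →
    (∀ U → length U ≡ size h → q * ∑ (heaps h U) Y ≤ numHeaps h * (α + γ * weight U + β * φ (weight U))) →
    2 * (q * ∑ (heaps (suc h) (v ∷ S)) X) ≤
    numHeaps (suc h) * (2 * (q * c) + (4 * α + 2 * (γ * weight S) + β * φ (weight S)))
  ∑-heaps-bound h v S X Y c q α γ β eq node≤ rec = begin
    2 * (q * ∑ (heaps (suc h) (v ∷ S)) X)
      ≡⟨ cong (λ z → 2 * (q * z)) (∑-heaps h v S X) ⟩
    _ ≤⟨ *-monoʳ-≤ 2 (*-monoʳ-≤ q (∑-monoᴬ (All.zipWith (λ {(U , V)} ((|U| , |V|) , eqw) → step U V |U| |V| eqw)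
           (length-splits-parts s s S eq , weight-splits s s S eq)))) ⟩
    2 * (q * ∑ (splits s s S) (λ (U , V) → N * N * c + (e U + e V)))
      ≡⟨ cong (λ z → 2 * (q * z)) (trans (∑-+ (splits s s S) _ _)
           (cong (_+ ∑ (splits s s S) (λ (U , V) → e U + e V)) (trans (∑-const (splits s s S) (N * N * c)) (cong (_* (N * N * c)) (length-splits s s S eq))))) ⟩
    2 * (q * (B * (N * N * c) + ∑ (splits s s S) (λ (U , V) → e U + e V)))
      ≡⟨ arith₁ q (B * (N * N * c)) _ ⟩
    2 * (q * (B * (N * N * c))) + 2 * (q * ∑ (splits s s S) (λ (U , V) → e U + e V))
      ≤⟨ +-monoʳ-≤ (2 * (q * (B * (N * N * c)))) (∑-split-bound s e q (N * N) α γ β S eq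
           (All.map (λ {(U , V)} (|U| , |V|) → scale U |U| , scale V |V|) (length-splits-parts s s S eq))) ⟩
    _ ≡⟨ arith₂ q B (N * N) c _ ⟩
    _ ∎
    where
    open ≤-Reasoning
    s = size h
    N = numHeaps h
    B = binom s s
    e : List A → ℕ
    e U = N * ∑ (heaps h U) Y
    arith₁ : ∀ q a b → 2 * (q * (a + b)) ≡ 2 * (q * a) + 2 * (q * b)
    arith₁ = solve-∀
    arith₂ : ∀ q B M c z → 2 * (q * (B * (M * c))) + B * (M * z) ≡ B * M * (2 * (q * c) + z)
    arith₂ = solve-∀
    arith₃ : ∀ q N x → q * (N * x) ≡ N * (q * x)
    arith₃ = solve-∀
    scale : ∀ U → length U ≡ s → q * e U ≤ N * N * (α + γ * weight U + β * φ (weight U))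
    scale U |U| = begin
      _ ≡⟨ arith₃ q N _ ⟩
      _ ≤⟨ *-monoʳ-≤ N (rec U |U|) ⟩
      _ ≡⟨ *-assoc N N _ ⟨
      _ ∎
    step : ∀ U V → length U ≡ s → length V ≡ s → weight U + weight V ≡ weight S →
           ∑[ l ∈ heaps h U ] ∑[ r ∈ heaps h V ] X (node v l r) ≤ N * N * c + (e U + e V)
    step U V |U| |V| eqw = begin
      _ ≤⟨ ∑-monoᴬ (All.map (λ {l} pl → ∑-monoᴬ (All.map (λ {r} pr → node≤ l r (trans (cong₂ _+_ pl pr) eqw))
             (heaps-weight h |V|))) (heaps-weight h |U|)) ⟩
      ∑[ l ∈ heaps h U ] ∑[ r ∈ heaps h V ] (c + (Y l + Y r))
        ≡⟨ trans (∑-cong (heaps h U) λ l → ∑-+ (heaps h V) (λ _ → c) _) (∑-+ (heaps h U) _ _) ⟩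
      _ ≡⟨ cong₂ _+_ (trans (∑-const (heaps h U) _) (cong (length (heaps h U) *_) (∑-const (heaps h V) c)))
                     (∑∑-+ (heaps h U) (heaps h V) Y Y) ⟩
      _ ≡⟨ cong₂ (λ a b → a * (b * c) + (b * ∑ (heaps h U) Y + a * ∑ (heaps h V) Y))
             (length-heaps h U |U|) (length-heaps h V |V|) ⟩
      _ ≡⟨ cong (_+ (e U + e V)) (sym (*-assoc N N c)) ⟩
      _ ∎

  weight-tail : ∀ v S → φ (weight S) ≤ φ (weight (v ∷ S))
  weight-tail v S = φ-mono (m≤n+m (weight S) (μ v))

  -- In expectation the cost is at most `size h * (D + φ w / 4 ^ D)`. Each of the top `D` levels
  -- contributes at most `size h`, its subtrees being disjoint. One level further down the subtree
  -- sizes and the expected number of pairs are both halved, hence the base 4.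
  pathCost-bound : ∀ D h S → length S ≡ size h →
    4 ^ D * ∑ (heaps h S) pathCost ≤ numHeaps h * (size h * (D * 4 ^ D + φ (weight S)))
  pathCost-bound D       zero    S       eq = ≤-trans (≤-reflexive (*-zeroʳ (4 ^ D))) z≤n
  pathCost-bound zero    (suc h) (v ∷ S) eq = *-cancelˡ-≤ 2 (begin
    2 * (1 * ∑ (heaps (suc h) (v ∷ S)) pathCost)
      ≤⟨ ∑-heaps-bound h v S pathCost pathCost (n * crowded w) 1 0 0 s (suc-injective eq)
           (λ l r eqw → ≤-reflexive (cong (λ z → n * crowded (μ v + z) + _) eqw))
           (λ U |U| → pathCost-bound 0 h U |U|) ⟩
    N * (2 * (1 * (n * crowded w)) + s * φ (weight S))
      ≤⟨ *-monoʳ-≤ N (+-mono-≤ crowded-part (*-mono-≤ s≤n (weight-tail v S))) ⟩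
    N * (n * φ w + n * φ w)
      ≡⟨ arith N (n * φ w) ⟩
    2 * (N * (n * φ w)) ∎)
    where
    open ≤-Reasoning
    s = size h
    n = size (suc h)
    N = numHeaps (suc h)
    w = weight (v ∷ S)
    arith : ∀ N x → N * (x + x) ≡ 2 * (N * x)
    arith = solve-∀
    arith₂ : ∀ n c → 2 * (1 * (n * c)) ≡ n * (2 * c)
    arith₂ = solve-∀
    crowded-part : 2 * (1 * (n * crowded w)) ≤ n * φ w
    crowded-part = ≤-trans (≤-reflexive (arith₂ n (crowded w))) (*-monoʳ-≤ n (2crowded≤φ w))
    s≤n : s ≤ n
    s≤n = m≤n⇒m≤1+n (m≤m+n s s)
  pathCost-bound (suc D) (suc h) (v ∷ S) eq = begin
    4 * 4 ^ D * ∑ (heaps (suc h) (v ∷ S)) pathCost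
      ≡⟨ arith₁ (4 ^ D) _ ⟩
    2 * (2 * (4 ^ D * ∑ (heaps (suc h) (v ∷ S)) pathCost))
      ≤⟨ *-monoʳ-≤ 2 (∑-heaps-bound h v S pathCost pathCost n (4 ^ D) (s * (D * 4 ^ D)) 0 s (suc-injective eq)
           (λ l r _ → +-monoˡ-≤ _ (≤-trans (*-monoʳ-≤ n (crowded≤1 (μ v + (weightT l + weightT r)))) (≤-reflexive (*-identityʳ n))))
           (λ U |U| → ≤-trans (pathCost-bound D h U |U|) (≤-reflexive (cong (numHeaps h *_) (arith₂ s (D * 4 ^ D) (φ (weight U))))))) ⟩
    2 * (N * (2 * (4 ^ D * n) + (4 * (s * (D * 4 ^ D)) + 0 + s * φ (weight S))))
      ≡⟨ arith₃ N (4 ^ D) n s D (φ (weight S)) ⟩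
    N * (n * (4 * 4 ^ D) + (s + s) * (D * (4 * 4 ^ D)) + (s + s) * φ (weight S))
      ≤⟨ *-monoʳ-≤ N (+-mono-≤ (+-monoʳ-≤ (n * (4 * 4 ^ D)) (*-monoˡ-≤ (D * (4 * 4 ^ D)) (n≤1+n (s + s))))
                               (*-mono-≤ (n≤1+n (s + s)) (weight-tail v S))) ⟩
    N * (n * (4 * 4 ^ D) + n * (D * (4 * 4 ^ D)) + n * φ (weight (v ∷ S)))
      ≡⟨ arith₄ N n D (4 * 4 ^ D) (φ (weight (v ∷ S))) ⟩
    _ ∎
    where
    open ≤-Reasoning
    s = size h
    n = size (suc h)
    N = numHeaps (suc h)
    arith₁ : ∀ q x → 4 * q * x ≡ 2 * (2 * (q * x))
    arith₁ = solve-∀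
    arith₂ : ∀ s x p → s * (x + p) ≡ s * x + 0 + s * p
    arith₂ = solve-∀
    arith₃ : ∀ N q n s D p → 2 * (N * (2 * (q * n) + (4 * (s * (D * q)) + 0 + s * p))) ≡
                             N * (n * (4 * q) + (s + s) * (D * (4 * q)) + (s + s) * p)
    arith₃ = solve-∀
    arith₄ : ∀ N n D q p → N * (n * q + n * (D * q) + n * p) ≡ N * (n * (suc D * q + p))
    arith₄ = solve-∀

  outputCost : ∀ {h} → Tree A h → ℕ
  outputCost leaf         = 0
  outputCost (node v l r) = mergeCost (weightT l) (weightT r) + (outputCost l + outputCost r)

  -- Each of the top `D` levels costs at most the weight. Below them a node costs at most its number
  -- of pairs, which is halved in expectation from level to level; the coefficient 2 is the sum of
  -- the geometric series.
  outputCost-bound : ∀ D h S → length S ≡ size h →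
    2 ^ D * ∑ (heaps h S) outputCost ≤ numHeaps h * (D * 2 ^ D * weight S + 2 * φ (weight S))
  outputCost-bound D       zero    S       eq = ≤-trans (≤-reflexive (*-zeroʳ (2 ^ D))) z≤n
  outputCost-bound zero    (suc h) (v ∷ S) eq = *-cancelˡ-≤ 2 (begin
    2 * (1 * ∑ (heaps (suc h) (v ∷ S)) outputCost)
      ≤⟨ ∑-heaps-bound h v S outputCost outputCost (φ (weight S)) 1 0 0 2 (suc-injective eq)
           (λ l r eqw → +-monoˡ-≤ _ (≤-trans (mergeCost≤φ (weightT l) (weightT r)) (≤-reflexive (cong φ eqw))))
           (λ U |U| → outputCost-bound 0 h U |U|) ⟩
    N * (2 * (1 * φ (weight S)) + 2 * φ (weight S))
      ≡⟨ arith N (φ (weight S)) ⟩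
    2 * (N * (2 * φ (weight S)))
      ≤⟨ *-monoʳ-≤ 2 (*-monoʳ-≤ N (*-monoʳ-≤ 2 (weight-tail v S))) ⟩
    2 * (N * (2 * φ (weight (v ∷ S)))) ∎)
    where
    open ≤-Reasoning
    N = numHeaps (suc h)
    arith : ∀ N p → N * (2 * (1 * p) + 2 * p) ≡ 2 * (N * (2 * p))
    arith = solve-∀
  outputCost-bound (suc D) (suc h) (v ∷ S) eq = begin
    2 * 2 ^ D * ∑ (heaps (suc h) (v ∷ S)) outputCost
      ≡⟨ *-assoc 2 (2 ^ D) _ ⟩
    2 * (2 ^ D * ∑ (heaps (suc h) (v ∷ S)) outputCost)
      ≤⟨ ∑-heaps-bound h v S outputCost outputCost (weight S) (2 ^ D) 0 (D * 2 ^ D) 2 (suc-injective eq)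
           (λ l r eqw → +-monoˡ-≤ _ (≤-trans (mergeCost≤+ (weightT l) (weightT r)) (≤-reflexive eqw)))
           (λ U |U| → outputCost-bound D h U |U|) ⟩
    N * (2 * (2 ^ D * weight S) + (0 + 2 * (D * 2 ^ D * weight S) + 2 * φ (weight S)))
      ≡⟨ arith N (2 ^ D) D (weight S) (φ (weight S)) ⟩
    N * (suc D * (2 * 2 ^ D) * weight S + 2 * φ (weight S))
      ≤⟨ *-monoʳ-≤ N (+-mono-≤ (*-monoʳ-≤ (suc D * (2 * 2 ^ D)) (m≤n+m (weight S) (μ v)))
                               (*-monoʳ-≤ 2 (weight-tail v S))) ⟩
    _ ∎
    where
    open ≤-Reasoning
    N = numHeaps (suc h)
    arith : ∀ N q D w p → N * (2 * (q * w) + (0 + 2 * (D * q * w) + 2 * p)) ≡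
                          N * (suc D * (2 * q) * w + 2 * p)
    arith = solve-∀

  -- Cost of the construction

  Built : ℕ → List A → ℕ
  Built h S = ∑[ π ∈ permutations S ] buildCost (fill d h π)

  -- The two sources of cost at a node: the work inside its subtrees, where `size h !` counts the
  -- arrangements of the other subtree, and the sift of its own key, bounded through `pathCost`.
  subtrees siftings : ℕ → List A → ℕ
  subtrees h S = ∑[ (y , R) ∈ picks S ] ∑[ (U , V) ∈ splits (size h) (size h) R ]
                   (size h ! * Built h U + size h ! * Built h V)
  siftings h S = multiplicity h * (multiplicity h * (2 * ∑ (heaps (suc h) S) pathCost))

  -- By uniformity the random heaps below a random key may be replaced by the unsifts of one random
  -- heap, over which the cost of the sift has been bounded.
  Built-suc : ∀ h S → length S ≡ size (suc h) → AllPairs _≻_ S →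
    Built (suc h) S ≤
    subtrees h S + siftings h S
  Built-suc h S eq desc = begin
    _ ≡⟨ ∑-fill h S eq buildCost ⟩
    _ ≡⟨ trans (∑-cong (picks S) λ (y , R) → trans (∑-cong (splits s s R) λ (U , V) →
           trans (∑-cong (permutations U) λ π → ∑-+ (permutations V) _ _) (∑-+ (permutations U) _ _)) (∑-+ (splits s s R) _ _))
           (∑-+ (picks S) _ _) ⟩
    _ ≡⟨ cong₂ _+_ (∑-congᴬ (All.map (λ {(y , R)} p → ∑-congᴬ (All.map (λ {(U , V)} (|U| , |V|) → each U V |U| |V|)
                       (length-splits-parts s s R (suc-injective (trans p eq))))) (length-picks S)))
                   (∑-picks-heapify h (uniform h) S eq desc siftCost) ⟩
    _ ≤⟨ +-monoʳ-≤ (subtrees h S) (*-monoʳ-≤ k (*-monoʳ-≤ k (∑-monoᴬ (All.map (λ {H} → ∑-siftCost-unsifts h H) (heaps-ordered (suc h) eq desc))))) ⟩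
    _ ≡⟨ cong (λ z → subtrees h S + k * (k * z)) (∑-*ˡ (heaps (suc h) S) 2 pathCost) ⟩
    _ ∎
    where
    open ≤-Reasoning
    s = size h
    k = multiplicity h
    each : ∀ U V → length U ≡ s → length V ≡ s →
      ∑[ π ∈ permutations U ] ∑[ ρ ∈ permutations V ] (buildCost (fill d h π) + buildCost (fill d h ρ)) ≡
      s ! * Built h U + s ! * Built h V
    each U V |U| |V| = trans (∑∑-+ (permutations U) (permutations V) _ _)
      (cong₂ (λ a b → a * Built h U + b * Built h V)
        (trans (length-permutations V) (cong _! |V|)) (trans (length-permutations U) (cong _! |U|)))

  Built-step : ∀ h S → length S ≡ size (suc h) → AllPairs _≻_ S → ∀ q α β →
    (∀ U → length U ≡ size h → AllPairs _≻_ U → q * Built h U ≤ size h ! * (α + β * φ (weight U))) →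
    2 * (q * subtrees h S)
    ≤ size (suc h) ! * (4 * α + β * φ (weight S))
  Built-step h S eq desc q α β rec = begin
    _ ≡⟨ trans (cong (2 *_) (sym (∑-*ˡ (picks S) q _))) (sym (∑-*ˡ (picks S) 2 _)) ⟩
    _ ≤⟨ ∑-monoᴬ (All.zipWith (λ {(y , R)} (w≤ , (p , descR)) → each R w≤ (suc-injective (trans p eq)) descR)
           (weight-picks S , All.zipWith (λ x → x) (length-picks S , picks-AllPairs desc))) ⟩
    _ ≡⟨ ∑-const (picks S) _ ⟩
    _ ≡⟨ cong (_* ((s + s) ! * (4 * α + β * φ (weight S)))) (trans (length-picks-list S) eq) ⟩
    _ ≡⟨ *-assoc (size (suc h)) ((s + s) !) _ ⟨
    _ ∎
    where
    open ≤-Reasoning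
    s = size h
    length-picks-list : ∀ (S : List A) → length (picks S) ≡ length S
    length-picks-list []      = refl
    length-picks-list (x ∷ S) = cong suc (trans (length-map _ (picks S)) (length-picks-list S))
    arith₁ : ∀ q N x → q * (N * x) ≡ N * (q * x)
    arith₁ = solve-∀
    arith₂ : ∀ N α x β p → N * (N * (α + β * p)) ≡ N * N * (α + 0 * x + β * p)
    arith₂ = solve-∀
    scale : ∀ U → length U ≡ s → AllPairs _≻_ U →
            q * (s ! * Built h U) ≤ s ! * s ! * (α + 0 * weight U + β * φ (weight U))
    scale U |U| descU = begin
      _ ≡⟨ arith₁ q (s !) (Built h U) ⟩
      _ ≤⟨ *-monoʳ-≤ (s !) (rec U |U| descU) ⟩
      _ ≡⟨ arith₂ (s !) α (weight U) β (φ (weight U)) ⟩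
      _ ∎
    each : ∀ R → weight R ≤ weight S → length R ≡ s + s → AllPairs _≻_ R →
      2 * (q * ∑ (splits s s R) (λ (U , V) → s ! * Built h U + s ! * Built h V)) ≤
      (s + s) ! * (4 * α + β * φ (weight S))
    each R w≤ |R| descR = begin
      _ ≤⟨ ∑-split-bound s (λ U → s ! * Built h U) q (s ! * s !) α 0 β R |R|
             (All.zipWith (λ {(U , V)} ((|U| , |V|) , (descU , descV)) → scale U |U| descU , scale V |V| descV)
               (length-splits-parts s s R |R| , splits-AllPairs s s descR)) ⟩
      binom s s * (s ! * s ! * (4 * α + 0 + β * φ (weight R)))
        ≡⟨ *-assoc (binom s s) (s ! * s !) _ ⟨
      binom s s * (s ! * s !) * (4 * α + 0 + β * φ (weight R))
        ≡⟨ cong₂ _*_ (trans (length-permutations-split s s R |R|) (cong _! |R|)) (cong (_+ β * φ (weight R)) (+-identityʳ (4 * α))) ⟩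
      (s + s) ! * (4 * α + β * φ (weight R))
        ≤⟨ *-monoʳ-≤ ((s + s) !) (+-monoʳ-≤ (4 * α) (*-monoʳ-≤ β (φ-mono w≤))) ⟩
      _ ∎

  Built-sift : ∀ D h S → length S ≡ size (suc h) → AllPairs _≻_ S →
    4 ^ D * siftings h S ≤
    size (suc h) ! * (2 * (D * 4 ^ D + φ (weight S)))
  Built-sift D h S eq desc = begin
    _ ≡⟨ arith₁ (4 ^ D) k _ ⟩
    2 * (k * k) * (4 ^ D * ∑ (heaps (suc h) S) pathCost)
      ≤⟨ *-monoʳ-≤ (2 * (k * k)) (pathCost-bound D (suc h) S eq) ⟩
    2 * (k * k) * (N * (size (suc h) * (D * 4 ^ D + φ (weight S))))
      ≡⟨ arith₂ k N (size (suc h)) _ ⟩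
    k * (k * size (suc h)) * N * (2 * (D * 4 ^ D + φ (weight S)))
      ≡⟨ cong (_* (2 * (D * 4 ^ D + φ (weight S)))) (multiplicity-numHeaps (suc h) S eq desc) ⟩
    _ ∎
    where
    open ≤-Reasoning
    k = multiplicity h
    N = numHeaps (suc h)
    arith₁ : ∀ q k x → q * (k * (k * (2 * x))) ≡ 2 * (k * k) * (q * x)
    arith₁ = solve-∀
    arith₂ : ∀ k N n z → 2 * (k * k) * (N * (n * z)) ≡ k * (k * n) * N * (2 * z)
    arith₂ = solve-∀

  -- Divided by `size h !`, the expected cost is at most `2 * buildFactor E + 2 * pairFactor E * φ w
  -- / 4 ^ E`. One level up, the two subtrees double the constant and halve the number of pairs, and
  -- the sift adds `2 * suc E` and `2 * φ w / 4 ^ suc E`; this yields both recursions.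
  Built-bound : ∀ E h S → length S ≡ size h → AllPairs _≻_ S →
    4 ^ E * Built h S ≤ size h ! * (2 * (buildFactor E * 4 ^ E) + 2 * pairFactor E * φ (weight S))
  Built-bound E       zero    []      eq desc = ≤-trans (≤-reflexive (*-zeroʳ (4 ^ E))) z≤n
  Built-bound zero    (suc h) S       eq desc = *-cancelˡ-≤ 2 (begin
    2 * (1 * Built (suc h) S)
      ≤⟨ *-monoʳ-≤ 2 (*-monoʳ-≤ 1 (Built-suc h S eq desc)) ⟩
    2 * (1 * (subtrees h S + siftings h S))
      ≡⟨ arith₁ (subtrees h S) (siftings h S) ⟩
    2 * (1 * subtrees h S) + 2 * (1 * siftings h S)
      ≤⟨ +-mono-≤ (Built-step h S eq desc 1 0 4 (λ U |U| descU → Built-bound 0 h U |U| descU))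
                  (*-monoʳ-≤ 2 (Built-sift 0 h S eq desc)) ⟩
    N * (4 * p) + 2 * (N * (2 * p))
      ≡⟨ arith₂ N p ⟩
    2 * (N * (4 * p)) ∎)
    where
    open ≤-Reasoning
    N = size (suc h) !
    p = φ (weight S)
    arith₁ : ∀ a b → 2 * (1 * (a + b)) ≡ 2 * (1 * a) + 2 * (1 * b)
    arith₁ = solve-∀
    arith₂ : ∀ N p → N * (4 * p) + 2 * (N * (2 * p)) ≡ 2 * (N * (4 * p))
    arith₂ = solve-∀
  Built-bound (suc E) (suc h) S       eq desc = begin
    4 * 4 ^ E * Built (suc h) S
      ≤⟨ *-monoʳ-≤ (4 * 4 ^ E) (Built-suc h S eq desc) ⟩
    4 * 4 ^ E * (subtrees h S + siftings h S)
      ≡⟨ arith₁ (4 ^ E) (subtrees h S) (siftings h S) ⟩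
    2 * (2 * (4 ^ E * subtrees h S)) + 4 * 4 ^ E * siftings h S
      ≤⟨ +-mono-≤ (*-monoʳ-≤ 2 (Built-step h S eq desc (4 ^ E) (2 * (f * 4 ^ E)) (2 * g) (Built-bound E h)))
                  (Built-sift (suc E) h S eq desc) ⟩
    2 * (N * (4 * (2 * (f * 4 ^ E)) + 2 * g * p)) + N * (2 * (suc E * (4 * 4 ^ E) + p))
      ≡⟨ arith₂ N f (4 ^ E) g p E ⟩
    _ ∎
    where
    open ≤-Reasoning
    N = size (suc h) !
    p = φ (weight S)
    f = buildFactor E
    g = pairFactor E
    arith₁ : ∀ q a b → 4 * q * (a + b) ≡ 2 * (2 * (q * a)) + 4 * q * b
    arith₁ = solve-∀
    arith₂ : ∀ N f q g p E → 2 * (N * (4 * (2 * (f * q)) + 2 * g * p)) + N * (2 * (suc E * (4 * q) + p)) ≡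
                             N * (2 * ((2 * f + suc E) * (4 * q)) + 2 * suc (2 * g) * p)
    arith₂ = solve-∀

-- Choice of the truncation depth and the total cost

floorLog : ∀ n → 1 ≤ n → ∃[ E ] (2 ^ E ≤ n × n < 2 ^ suc E)
floorLog (suc zero)    _ = 0 , ≤-refl , ≤-refl
floorLog (suc (suc n)) _ with floorLog (suc n) (s≤s z≤n)
... | E , lo , hi with suc (suc n) <? 2 ^ suc E
...   | yes hi′ = E , m≤n⇒m≤1+n lo , hi′
...   | no ¬hi  = suc E , ≮⇒≥ ¬hi , <-≤-trans (s≤s hi) (+-mono-≤ {1} (m^n>0 2 (suc E)) (≤-reflexive (sym (+-identityʳ _))))

4^≡2^*2^ : ∀ E → 4 ^ E ≡ 2 ^ E * 2 ^ E
4^≡2^*2^ zero    = refl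
4^≡2^*2^ (suc E) = trans (cong (4 *_) (4^≡2^*2^ E)) (arith (2 ^ E))
  where
  arith : ∀ p → 4 * (p * p) ≡ 2 * p * (2 * p)
  arith = solve-∀

φ≤ : ∀ {w L} → w < 2 ^ suc L → φ w ≤ w * (2 * 2 ^ L)
φ≤ {w} w< = *-monoʳ-≤ w (≤-trans (m∸n≤m w 1) (<⇒≤ w<))

module Total {A : Set} (d : A) (_<ᵉ_ : A → A → Bool) (μ : A → ℕ) (μ≤1 : ∀ u → μ u ≤ 1) where

  open Weights μ μ≤1
  open Costs d _<ᵉ_ μ μ≤1
  open Bounds d _<ᵉ_ μ μ≤1

  blockCost : ∀ {h} → Tree A h → ℕ
  blockCost t = buildCost t + outputCost (heapify t)

  -- For the integer logarithm `E` of the weight `w`, the constant part is at most `4 * 2 ^ E`,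
  -- hence `4 * w`, and the pair part at most `12 * w`, since `φ w` is at most `w * (2 * 2 ^ E)`.
  Built-linear : ∀ h S → length S ≡ size h → AllPairs _≻_ S → Built h S ≤ size h ! * (weight S * 16)
  Built-linear h S eq desc with weight S in weq
  -- Without marked keys there is no logarithm to take, but `E = 0` suffices because `φ 0` vanishes.
  ... | zero  = ≤-trans (≤-reflexive (sym (*-identityˡ _)))
    (subst (λ w → 1 * Built h S ≤ size h ! * (4 * φ w)) weq (Built-bound 0 h S eq desc))
  ... | suc w = let E , lo , hi = floorLog (suc w) (s≤s z≤n) in go E lo hi
    where
    open ≤-Reasoning
    arith : ∀ N p w → N * (2 * (2 * p * (p * p)) + 2 * (3 * p) * (w * (2 * p))) ≡
                      p * p * (N * (4 * p + 12 * w))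
    arith = solve-∀
    arith₂ : ∀ w → 4 * w + 12 * w ≡ w * 16
    arith₂ = solve-∀
    go : ∀ E → 2 ^ E ≤ suc w → suc w < 2 ^ suc E → Built h S ≤ size h ! * (suc w * 16)
    go E lo hi = *-cancelˡ-≤ (4 ^ E) {{m^n≢0 4 E}} (begin
      4 ^ E * Built h S
        ≤⟨ Built-bound E h S eq desc ⟩
      size h ! * (2 * (buildFactor E * 4 ^ E) + 2 * pairFactor E * φ (weight S))
        ≡⟨ cong (λ w → size h ! * (2 * (buildFactor E * 4 ^ E) + 2 * pairFactor E * φ w)) weq ⟩
      size h ! * (2 * (buildFactor E * 4 ^ E) + 2 * pairFactor E * φ (suc w))
        ≤⟨ *-monoʳ-≤ (size h !) (+-mono-≤ (*-monoʳ-≤ 2 (*-monoˡ-≤ (4 ^ E) (buildFactor-bound E)))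
             (*-mono-≤ (*-monoʳ-≤ 2 (pairFactor-bound E)) (φ≤ {suc w} {E} hi))) ⟩
      size h ! * (2 * (2 * 2 ^ E * 4 ^ E) + 2 * (3 * 2 ^ E) * (suc w * (2 * 2 ^ E)))
        ≡⟨ cong (λ q → size h ! * (2 * (2 * 2 ^ E * q) + 2 * (3 * 2 ^ E) * (suc w * (2 * 2 ^ E)))) (4^≡2^*2^ E) ⟩
      size h ! * (2 * (2 * 2 ^ E * (2 ^ E * 2 ^ E)) + 2 * (3 * 2 ^ E) * (suc w * (2 * 2 ^ E)))
        ≡⟨ arith (size h !) (2 ^ E) (suc w) ⟩
      2 ^ E * 2 ^ E * (size h ! * (4 * 2 ^ E + 12 * suc w))
        ≤⟨ *-monoʳ-≤ (2 ^ E * 2 ^ E) (*-monoʳ-≤ (size h !) (+-monoˡ-≤ (12 * suc w) (*-monoʳ-≤ 4 lo))) ⟩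
      2 ^ E * 2 ^ E * (size h ! * (4 * suc w + 12 * suc w))
        ≡⟨ cong₂ (λ q z → q * (size h ! * z)) (sym (4^≡2^*2^ E)) (arith₂ (suc w)) ⟩
      4 ^ E * (size h ! * (suc w * 16)) ∎)

  -- With `D = L` the upper levels contribute `L` per marked key and the remaining pairs,
  -- `2 * φ w / 2 ^ L`, at most 4. As `w` is only bounded from above, one `L` chosen from `r` serves
  -- every block.
  output-bound : ∀ L h S → length S ≡ size h → AllPairs _≻_ S → weight S < 2 ^ suc L →
    ∑[ π ∈ permutations S ] outputCost (heapify (fill d h π)) ≤ size h ! * (weight S * (L + 4))
  output-bound L h S eq desc w< = *-cancelˡ-≤ (2 ^ L) {{m^n≢0 2 L}} (begin
    2 ^ L * (∑[ π ∈ permutations S ] outputCost (heapify (fill d h π)))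
      ≡⟨ cong (2 ^ L *_) (uniform h S eq desc outputCost) ⟩
    2 ^ L * (k * ∑ (heaps h S) outputCost)
      ≡⟨ arith₁ (2 ^ L) k _ ⟩
    k * (2 ^ L * ∑ (heaps h S) outputCost)
      ≤⟨ *-monoʳ-≤ k (outputCost-bound L h S eq) ⟩
    k * (N * (L * 2 ^ L * w + 2 * φ w))
      ≡⟨ *-assoc k N _ ⟨
    k * N * (L * 2 ^ L * w + 2 * φ w)
      ≤⟨ *-mono-≤ (≤-reflexive (multiplicity-numHeaps h S eq desc)) (+-monoʳ-≤ (L * 2 ^ L * w) (*-monoʳ-≤ 2 (φ≤ {w} {L} w<))) ⟩
    size h ! * (L * 2 ^ L * w + 2 * (w * (2 * 2 ^ L)))
      ≡⟨ arith₂ (size h !) L (2 ^ L) w ⟩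
    2 ^ L * (size h ! * (w * (L + 4))) ∎)
    where
    open ≤-Reasoning
    k = multiplicity h
    N = numHeaps h
    w = weight S
    arith₁ : ∀ q k x → q * (k * x) ≡ k * (q * x)
    arith₁ = solve-∀
    arith₂ : ∀ M L q w → M * (L * q * w + 2 * (w * (2 * q))) ≡ q * (M * (w * (L + 4)))
    arith₂ = solve-∀

  block-bound : ∀ L h S → length S ≡ size h → AllPairs _≻_ S → weight S < 2 ^ suc L →
    ∑[ π ∈ permutations S ] blockCost (fill d h π) ≤ size h ! * (weight S * (L + 20))
  block-bound L h S eq desc w< = begin
    _ ≡⟨ ∑-+ (permutations S) _ _ ⟩
    _ ≤⟨ +-mono-≤ (Built-linear h S eq desc) (output-bound L h S eq desc w<) ⟩
    size h ! * (weight S * 16) + size h ! * (weight S * (L + 4))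
      ≡⟨ arith (size h !) (weight S) L ⟩
    size h ! * (weight S * (L + 20)) ∎
    where
    open ≤-Reasoning
    arith : ∀ M w L → M * (w * 16) + M * (w * (L + 4)) ≡ M * (w * (L + 20))
    arith = solve-∀

  weight-insertions : ∀ x S → All (λ π → weight π ≡ μ x + weight S) (insertions x S)
  weight-insertions x []      = refl ∷ []
  weight-insertions x (y ∷ S) = refl ∷ Allₚ.map⁺ (All.map (λ {π} eq → trans (cong (μ y +_) eq) (swap (μ y) (μ x) (weight S)))
    (weight-insertions x S))
    where
    swap : ∀ a b c → a + (b + c) ≡ b + (a + c)
    swap = solve-∀

  weight-permutations : ∀ S → All (λ π → weight π ≡ weight S) (permutations S)
  weight-permutations []      = refl ∷ []
  weight-permutations (x ∷ S) = Allₚ.concat⁺ (Allₚ.map⁺ (All.map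
    (λ {π} eq → All.map (λ eq′ → trans eq′ (cong (μ x +_) eq)) (weight-insertions x π)) (weight-permutations S)))

  weight-++ : ∀ S T → weight (S ++ T) ≡ weight S + weight T
  weight-++ S T = ∑-++ S T μ

  -- Each merge costs at most the number of marked keys in the merged blocks.
  totalCost : (ℕ → List A → ℕ) → List ℕ → List A → ℕ
  totalCost c []       π = 0
  totalCost c (s ∷ ss) π = c s (take (size s) π) + weight π + totalCost c ss (drop (size s) π)

  -- Besides `L + 20` per marked key for the blocks there is some `x` for the merges. The final
  -- merge costs 1 per key and the later blocks carry at most half of the weight on average, so
  -- `x = 1 + x / 2`, that is `x = 2`.
  totalCost-bound : ∀ c L →
    (∀ s S → length S ≡ size s → AllPairs _≻_ S → weight S < 2 ^ suc L →
       ∑[ π ∈ permutations S ] c s π ≤ size s ! * (weight S * (L + 20))) →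
    ∀ ss → DominatesTails (map size ss) → ∀ S → length S ≡ sum (map size ss) →
    AllPairs _≻_ S → weight S < 2 ^ suc L →
    ∑[ π ∈ permutations S ] totalCost c ss π ≤ length S ! * (weight S * (L + 22))
  totalCost-bound c L block []       _           S eq desc w< = ≤-trans (≤-reflexive (∑-zero (permutations S))) z≤n
  totalCost-bound c L block (s ∷ ss) (dom , doms) S eq desc w< = begin
    _ ≡⟨ ∑-cong (permutations S) (λ π → cong (λ z → c s (take k π) + z + totalCost c ss (drop k π))
           (trans (cong weight (sym (take++drop≡id k π))) (weight-++ (take k π) (drop k π)))) ⟩
    _ ≡⟨ ∑-permutations-split k l S eq (λ π ρ → c s π + (weight π + weight ρ) + totalCost c ss ρ) ⟩
    _ ≤⟨ ∑-monoᴬ (All.zipWith (λ {(U , V)} ((|U| , |V|) , ((descU , descV) , eqw)) → each U V |U| |V| descU descV eqw)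
           (length-splits-parts k l S eq , All.zipWith (λ x → x) (splits-AllPairs k l desc , weight-splits k l S eq))) ⟩
    -- The surplus of 2 per marked key of `V` is kept apart, since it alone has to be averaged over
    -- the splits.
    ∑ (splits k l S) (λ (U , V) → M * (w * (L + 21)) + M * (2 * weight V))
      ≡⟨ trans (∑-+ (splits k l S) _ _) (cong₂ _+_ (trans (∑-const (splits k l S) _) (cong (_* (M * (w * (L + 21)))) (length-splits k l S eq)))
           (trans (∑-*ˡ (splits k l S) M _) (cong (M *_) (∑-*ˡ (splits k l S) 2 _)))) ⟩
    B * (M * (w * (L + 21))) + M * (2 * W)
      ≤⟨ +-monoʳ-≤ (B * (M * (w * (L + 21)))) (*-monoʳ-≤ M (∑-weight-half k l S eq dom)) ⟩
    B * (M * (w * (L + 21))) + M * (B * w)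
      ≡⟨ arith B M w L ⟩
    B * M * (w * (L + 22))
      ≡⟨ cong (_* (w * (L + 22))) (length-permutations-split k l S eq) ⟩
    length S ! * (w * (L + 22)) ∎
    where
    open ≤-Reasoning
    k = size s
    l = sum (map size ss)
    w = weight S
    M = k ! * l !
    B = binom k l
    W = ∑ (splits k l S) (λ (U , V) → weight V)
    arith : ∀ B M w L → B * (M * (w * (L + 21))) + M * (B * w) ≡ B * M * (w * (L + 22))
    arith = solve-∀
    arith₂ : ∀ K N a b L → N * (K * (a * (L + 20)) + K * (a + b)) + K * (N * (b * (L + 22))) ≡
                           K * N * ((a + b) * (L + 21)) + K * N * (2 * b)
    arith₂ = solve-∀
    each : ∀ U V → length U ≡ k → length V ≡ l → AllPairs _≻_ U → AllPairs _≻_ V → weight U + weight V ≡ w →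
      ∑[ π ∈ permutations U ] ∑[ ρ ∈ permutations V ] (c s π + (weight π + weight ρ) + totalCost c ss ρ) ≤
      M * (w * (L + 21)) + M * (2 * weight V)
    each U V |U| |V| descU descV eqw = begin
      _ ≡⟨ trans (∑-congᴬ (All.map (λ {π} eqπ → ∑-congᴬ (All.map (λ {ρ} eqρ → cong (λ z → c s π + z + totalCost c ss ρ) (trans (cong₂ _+_ eqπ eqρ) eqw))
             (weight-permutations V))) (weight-permutations U)))
             (∑∑-+ (permutations U) (permutations V) (λ π → c s π + w) (totalCost c ss)) ⟩
      length (permutations V) * (∑[ π ∈ permutations U ] (c s π + w)) +
        length (permutations U) * (∑[ ρ ∈ permutations V ] totalCost c ss ρ)
        ≡⟨ cong (λ z → length (permutations V) * z + length (permutations U) * (∑[ ρ ∈ permutations V ] totalCost c ss ρ))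
             (trans (∑-+ (permutations U) (c s) (λ _ → w)) (cong (∑ (permutations U) (c s) +_) (∑-const (permutations U) w))) ⟩
      length (permutations V) * (∑ (permutations U) (c s) + length (permutations U) * w) +
        length (permutations U) * (∑[ ρ ∈ permutations V ] totalCost c ss ρ)
        ≡⟨ cong₂ (λ m n → m * (∑ (permutations U) (c s) + n * w) + n * (∑[ ρ ∈ permutations V ] totalCost c ss ρ))
             (trans (length-permutations V) (cong _! |V|)) (trans (length-permutations U) (cong _! |U|)) ⟩
      l ! * (∑ (permutations U) (c s) + k ! * w) + k ! * (∑[ ρ ∈ permutations V ] totalCost c ss ρ)
        ≤⟨ +-mono-≤ (*-monoʳ-≤ (l !) (+-monoˡ-≤ (k ! * w) (block s U |U| descU
               (≤-<-trans (≤-trans (m≤m+n (weight U) (weight V)) (≤-reflexive eqw)) w<))))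
             (*-monoʳ-≤ (k !) (≤-trans (totalCost-bound c L block ss doms V |V| descV
               (≤-<-trans (≤-trans (m≤n+m (weight V) (weight U)) (≤-reflexive eqw)) w<))
               (≤-reflexive (cong (λ n → n ! * (weight V * (L + 22))) |V|)))) ⟩
      l ! * (k ! * (weight U * (L + 20)) + k ! * w) + k ! * (l ! * (weight V * (L + 22)))
        ≡⟨ cong (λ z → l ! * (k ! * (weight U * (L + 20)) + k ! * z) + k ! * (l ! * (weight V * (L + 22)))) eqw ⟨
      l ! * (k ! * (weight U * (L + 20)) + k ! * (weight U + weight V)) + k ! * (l ! * (weight V * (L + 22)))
        ≡⟨ arith₂ (k !) (l !) (weight U) (weight V) L ⟩
      M * ((weight U + weight V) * (L + 21)) + M * (2 * weight V)
        ≡⟨ cong (λ z → M * (z * (L + 21)) + M * (2 * weight V)) eqw ⟩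
      _ ∎

-- Positions in a heap

⌊2*p/2⌋ : ∀ p → ⌊ 2 * p /2⌋ ≡ p
⌊2*p/2⌋ p = trans (cong ⌊_/2⌋ (cong (p +_) (+-identityʳ p))) (sym (n≡⌊n+n/2⌋ p))

⌊1+2*p/2⌋ : ∀ p → ⌊ suc (2 * p) /2⌋ ≡ p
⌊1+2*p/2⌋ p = trans (cong (⌊_/2⌋ ∘ suc) (cong (p +_) (+-identityʳ p))) (sym (n≡⌈n+n/2⌉ p))

2*suc : ∀ p → 2 * suc p ≡ suc (suc (2 * p))
2*suc = solve-∀

p<2*p : ∀ {p} → 1 ≤ p → p < 2 * p
p<2*p {p} 1≤p = ≤-trans (+-monoˡ-≤ p 1≤p) (+-monoʳ-≤ p (m≤m+n p 0))

-- Under p q: the position q is p or a descendant of p.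
data Under (p : ℕ) : ℕ → Set where
  here  : Under p p
  below : ∀ {q} → Under p ⌊ q /2⌋ → Under p q

Under-≤ : ∀ {p q} → Under p q → p ≤ q
Under-≤ here          = ≤-refl
Under-≤ (below {q} u) = ≤-trans (Under-≤ u) (⌊n/2⌋≤n q)

Under-2* : ∀ {p q} → Under (2 * p) q → Under p q
Under-2* {p} here      = below (subst (Under p) (sym (⌊2*p/2⌋ p)) here)
Under-2* {p} (below u) = below (Under-2* u)

Under-1+2* : ∀ {p q} → Under (suc (2 * p)) q → Under p q
Under-1+2* {p} here      = below (subst (Under p) (sym (⌊1+2*p/2⌋ p)) here)
Under-1+2* {p} (below u) = below (Under-1+2* u)

Under-chain : ∀ {p p′ q} → Under p q → Under p′ q → p ≤ p′ → Under p p′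
Under-chain here      u′         p≤p′ with ≤-antisym p≤p′ (Under-≤ u′)
... | refl = here
Under-chain u         here       p≤p′ = u
Under-chain (below u) (below u′) p≤p′ = Under-chain u u′ p≤p′

Under-half : ∀ {p q} → Under p q → p ≢ q → Under p ⌊ q /2⌋
Under-half here      p≢q = ⊥-elim (p≢q refl)
Under-half (below u) _   = u

-- Ancestors of a position form a chain. If both siblings were ancestors of `q`, then `2 * p` would
-- be an ancestor of its sibling and hence at most the parent `p`.
Under-children : ∀ {p q} → 1 ≤ p → Under (2 * p) q → ¬ Under (suc (2 * p)) q
Under-children {p} 1≤p u u′ = <⇒≱ (p<2*p 1≤p) (subst (2 * p ≤_) (⌊1+2*p/2⌋ p)
  (Under-≤ (Under-half (Under-chain u u′ (n≤1+n _)) λ eq → 1+n≢n (sym eq))))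

module _ {A : Set} where

  treeOf : (ℕ → A) → ∀ h → ℕ → Tree A h
  treeOf a zero    p = leaf
  treeOf a (suc h) p = node (a p) (treeOf a h (2 * p)) (treeOf a h (suc (2 * p)))

  treeOf-cong : ∀ {a b : ℕ → A} h p → (∀ q → Under p q → a q ≡ b q) → treeOf a h p ≡ treeOf b h p
  treeOf-cong zero    p a≗b = refl
  treeOf-cong (suc h) p a≗b
    rewrite a≗b p here
          | treeOf-cong h (2 * p) (λ q u → a≗b q (Under-2* u))
          | treeOf-cong h (suc (2 * p)) (λ q u → a≗b q (Under-1+2* u)) = refl

-- Preorder and level order of the positions

positions : ℕ → ℕ → List ℕ
positions zero    p = []
positions (suc h) p = p ∷ positions h (2 * p) ++ positions h (suc (2 * p))

positions-Under : ∀ h p → All (Under p) (positions h p)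
positions-Under zero    p = []
positions-Under (suc h) p = here ∷ Allₚ.++⁺ (All.map Under-2* (positions-Under h (2 * p)))
                                           (All.map Under-1+2* (positions-Under h (suc (2 * p))))

length-positions : ∀ h p → length (positions h p) ≡ size h
length-positions zero    p = refl
length-positions (suc h) p = cong suc (trans (length-++ (positions h (2 * p)))
  (cong₂ _+_ (length-positions h (2 * p)) (length-positions h (suc (2 * p)))))

range : ℕ → ℕ → List ℕ
range a zero    = []
range a (suc k) = a ∷ range (suc a) k

range-++ : ∀ a k l → range a k ++ range (a + k) l ≡ range a (k + l)
range-++ a zero    l = cong (λ b → range b l) (+-identityʳ a)
range-++ a (suc k) l = cong (a ∷_) (trans (cong (λ b → range (suc a) k ++ range b l) (+-suc a k)) (range-++ (suc a) k l))

range-suc : ∀ a k → range (suc a) k ≡ map suc (range a k)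
range-suc a zero    = refl
range-suc a (suc k) = cong (suc a ∷_) (range-suc (suc a) k)

forest : ℕ → ℕ → ℕ → List ℕ
forest h a k = concatMap (positions h) (range a k)

-- Removing the roots of `k` neighbouring subtrees leaves `2 * k` neighbouring subtrees one level
-- lower.
forest-suc : ∀ h a k → forest (suc h) a k ↭ range a k ++ forest h (2 * a) (2 * k)
forest-suc h a zero    = ↭-refl
forest-suc h a (suc k) = Perm.prep a (begin
  (L ++ R) ++ forest (suc h) (suc a) k                          ↭⟨ ++⁺ˡ (L ++ R) (forest-suc h (suc a) k) ⟩
  (L ++ R) ++ range (suc a) k ++ forest h (2 * suc a) (2 * k)   ↭⟨ shifts (L ++ R) (range (suc a) k) ⟩
  range (suc a) k ++ (L ++ R) ++ forest h (2 * suc a) (2 * k)   ≡⟨ cong (range (suc a) k ++_) (++-assoc L R _) ⟩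
  range (suc a) k ++ L ++ R ++ forest h (2 * suc a) (2 * k)     ≡⟨ cong (λ b → range (suc a) k ++ L ++ R ++ forest h b (2 * k)) (2*suc a) ⟩
  range (suc a) k ++ forest h (2 * a) (suc (suc (2 * k)))       ≡⟨ cong (λ n → range (suc a) k ++ forest h (2 * a) n) (2*suc k) ⟨
  range (suc a) k ++ forest h (2 * a) (2 * suc k)               ∎)
  where
  open Perm.PermutationReasoning
  L = positions h (2 * a)
  R = positions h (suc (2 * a))

forest-zero : ∀ a k → forest 0 a k ≡ []
forest-zero a zero    = refl
forest-zero a (suc k) = forest-zero (suc a) k

-- The levels a , … , 2a ∸ 1 and 2a , … , 4a ∸ 1 and so on are consecutive.
forest-range : ∀ h a → forest h a a ↭ range a (a * size h)
forest-range zero    a = ↭-reflexive (trans (forest-zero a a) (cong (range a) (sym (*-zeroʳ a))))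
forest-range (suc h) a = begin
  forest (suc h) a a                              ↭⟨ forest-suc h a a ⟩
  range a a ++ forest h (2 * a) (2 * a)           ↭⟨ ++⁺ˡ (range a a) (forest-range h (2 * a)) ⟩
  range a a ++ range (2 * a) (2 * a * size h)     ≡⟨ cong (λ b → range a a ++ range b (2 * a * size h)) (cong (a +_) (+-identityʳ a)) ⟩
  range a a ++ range (a + a) (2 * a * size h)     ≡⟨ range-++ a a _ ⟩
  range a (a + 2 * a * size h)                    ≡⟨ cong (range a) (arith a (size h)) ⟩
  range a (a * size (suc h))                      ∎
  where
  open Perm.PermutationReasoning
  arith : ∀ a s → a + 2 * a * s ≡ a * (1 + (s + s))
  arith = solve-∀

range-positions : ∀ h → range 1 (size h) ↭ positions h 1
range-positions h = begin
  range 1 (size h)         ≡⟨ cong (range 1) (+-identityʳ (size h)) ⟨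
  range 1 (1 * size h)     ↭⟨ forest-range h 1 ⟨
  positions h 1 ++ []       ≡⟨ ++-identityʳ _ ⟩
  positions h 1             ∎
  where open Perm.PermutationReasoning

-- Random assignments of keys to positions

module Assign {A : Set} (d : A) where

  update : ℕ → A → (ℕ → A) → ℕ → A
  update p k a q = if does (q ≟ p) then k else a q

  assign : List ℕ → List A → ℕ → A
  assign []       _        = λ _ → d
  assign (p ∷ ps) []       = λ _ → d
  assign (p ∷ ps) (k ∷ ks) = update p k (assign ps ks)

  update-≡ : ∀ p k a → update p k a p ≡ k
  update-≡ p k a = cong (if_then k else a p) (dec-true (p ≟ p) refl)

  update-≢ : ∀ p k a {q} → q ≢ p → update p k a q ≡ a q
  update-≢ p k a {q} q≢p = cong (if_then k else a q) (dec-false (q ≟ p) q≢p)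

  update-cong : ∀ {p k a b} → (∀ q → a q ≡ b q) → ∀ q → update p k a q ≡ update p k b q
  update-cong {p} {k} a≗b q = cong (if does (q ≟ p) then k else_) (a≗b q)

  update-comm : ∀ {p p′ k k′ a} → p ≢ p′ → ∀ q → update p k (update p′ k′ a) q ≡ update p′ k′ (update p k a) q
  update-comm {p} {p′} {k} {k′} {a} p≢p′ q with q ≟ p | q ≟ p′
  ... | yes refl | yes refl = ⊥-elim (p≢p′ refl)
  ... | yes refl | no q≢p′  = trans (update-≡ p k (update p′ k′ a))
    (sym (trans (update-≢ p′ k′ (update p k a) q≢p′) (update-≡ p k a)))
  ... | no q≢p   | yes refl = trans (update-≢ p k (update p′ k′ a) q≢p)
    (trans (update-≡ p′ k′ a) (sym (update-≡ p′ k′ (update p k a))))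
  ... | no q≢p   | no q≢p′  = trans (trans (update-≢ p k (update p′ k′ a) q≢p) (update-≢ p′ k′ a q≢p′))
    (sym (trans (update-≢ p′ k′ (update p k a) q≢p′) (update-≢ p k a q≢p)))

  assign-∉ : ∀ {q ps} ks → All (q ≢_) ps → assign ps ks q ≡ d
  assign-∉ ks       []            = refl
  assign-∉ []       (q≢p ∷ q≢ps) = refl
  assign-∉ {q} {p ∷ ps} (k ∷ ks) (q≢p ∷ q≢ps) = trans (update-≢ p k (assign ps ks) q≢p) (assign-∉ ks q≢ps)

  assign-++ˡ : ∀ {q} ps {ps′} ks {ks′} → length ps ≡ length ks → All (q ≢_) ps′ →
               assign (ps ++ ps′) (ks ++ ks′) q ≡ assign ps ks q
  assign-++ˡ []       []       {ks′} eq q≢ = assign-∉ ks′ q≢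
  assign-++ˡ {q} (p ∷ ps) (k ∷ ks) eq q≢ =
    cong (if does (q ≟ p) then k else_) (assign-++ˡ ps ks (suc-injective eq) q≢)

  assign-++ʳ : ∀ {q} ps {ps′} ks {ks′} → length ps ≡ length ks → All (q ≢_) ps →
               assign (ps ++ ps′) (ks ++ ks′) q ≡ assign ps′ ks′ q
  assign-++ʳ []       []       eq _            = refl
  assign-++ʳ {q} (p ∷ ps) {ps′} (k ∷ ks) {ks′} eq (q≢p ∷ q≢ps) =
    trans (update-≢ p k (assign (ps ++ ps′) (ks ++ ks′)) q≢p) (assign-++ʳ ps ks (suc-injective eq) q≢ps)

  -- The positions of the two subtrees are disjoint, so each subtree sees only its own slice of the
  -- permutation, just as in `fill`.
  treeOf-assign : ∀ h p π → 1 ≤ p → length π ≡ size h → treeOf (assign (positions h p) π) h p ≡ fill d h π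
  treeOf-assign zero    p π       1≤p eq = refl
  treeOf-assign (suc h) p (y ∷ π) 1≤p eq = begin
    node (a p) (treeOf a h (2 * p)) (treeOf a h (suc (2 * p)))
      ≡⟨ cong₂ (λ l r → node (a p) l r) (treeOf-cong h (2 * p) left) (treeOf-cong h (suc (2 * p)) right) ⟩
    node (a p) (treeOf (assign L (take s π)) h (2 * p)) (treeOf (assign R (drop s π)) h (suc (2 * p)))
      ≡⟨ cong₂ (λ l r → node (a p) l r)
           (treeOf-assign h (2 * p) (take s π) (≤-trans 1≤p (<⇒≤ (p<2*p 1≤p))) |take|)
           (treeOf-assign h (suc (2 * p)) (drop s π) (s≤s z≤n) |drop|) ⟩
    node (a p) (fill d h (take s π)) (fill d h (drop s π))
      ≡⟨ cong (λ v → node v (fill d h (take s π)) (fill d h (drop s π))) (update-≡ p y (assign (L ++ R) π)) ⟩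
    node y (fill d h (take s π)) (fill d h (drop s π)) ∎
    where
    open ≡-Reasoning
    s = size h
    L = positions h (2 * p)
    R = positions h (suc (2 * p))
    a = assign (p ∷ L ++ R) (y ∷ π)
    |take| : length (take s π) ≡ s
    |take| = trans (length-take s π) (m≤n⇒m⊓n≡m (subst (s ≤_) (sym (suc-injective eq)) (m≤m+n s s)))
    |drop| : length (drop s π) ≡ s
    |drop| = trans (length-drop s π) (trans (cong (_∸ s) (suc-injective eq)) (m+n∸n≡m s s))
    a≗ : ∀ q → p < q → a q ≡ assign (L ++ R) (take s π ++ drop s π) q
    a≗ q p<q = trans (update-≢ p y (assign (L ++ R) π) λ q≡p → <-irrefl (sym q≡p) p<q)
      (cong (λ ρ → assign (L ++ R) ρ q) (sym (take++drop≡id s π)))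
    |L| = trans (length-positions h (2 * p)) (sym |take|)
    left : ∀ q → Under (2 * p) q → a q ≡ assign L (take s π) q
    left q u = trans (a≗ q (<-≤-trans (p<2*p 1≤p) (Under-≤ u))) (assign-++ˡ L (take s π) |L|
      (All.map (λ u′ → λ where refl → Under-children 1≤p u u′) (positions-Under h (suc (2 * p)))))
    right : ∀ q → Under (suc (2 * p)) q → a q ≡ assign R (drop s π) q
    right q u = trans (a≗ q (<-≤-trans (m<n⇒m<1+n (p<2*p 1≤p)) (Under-≤ u))) (assign-++ʳ L (take s π) |L|
      (All.map (λ u′ → λ where refl → Under-children 1≤p u′ u) (positions-Under h (2 * p))))

  -- Two successive draws without replacement are exchangeable; this settles the transposition of
  -- two positions in `∑-assign-↭`.
  ∑-picks-swap : ∀ (S : List A) (f : A → A → List A → ℕ) →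
    ∑[ (y , r) ∈ picks S ] ∑[ (z , r′) ∈ picks r ] f y z r′ ≡
    ∑[ (y , r) ∈ picks S ] ∑[ (z , r′) ∈ picks r ] f z y r′
  ∑-picks-swap []      f = refl
  ∑-picks-swap (x ∷ S) f = begin
    _ ≡⟨ expand f ⟩
    a f + (b f + c f)                     ≡⟨ cong (a f +_) (cong (b f +_) (∑-picks-swap S (λ y z r → f y z (x ∷ r)))) ⟩
    a f + (b f + c (λ y z → f z y))       ≡⟨ arith (a f) (b f) _ ⟩
    b f + (a f + c (λ y z → f z y))       ≡⟨ expand (λ y z → f z y) ⟨
    _ ∎
    where
    open ≡-Reasoning
    arith : ∀ a b c → a + (b + c) ≡ b + (a + c)
    arith = solve-∀
    a b c : (A → A → List A → ℕ) → ℕ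
    a f = ∑[ (z , r) ∈ picks S ] f x z r
    b f = ∑[ (y , r) ∈ picks S ] f y x r
    c f = ∑[ (y , r) ∈ picks S ] ∑[ (z , r′) ∈ picks r ] f y z (x ∷ r′)
    expand : ∀ f → ∑[ (y , r) ∈ picks (x ∷ S) ] ∑[ (z , r′) ∈ picks r ] f y z r′ ≡ a f + (b f + c f)
    expand f = cong (a f +_) (begin
      _ ≡⟨ ∑-map _ (picks S) _ ⟩
      _ ≡⟨ ∑-cong (picks S) (λ (y , r) → cong (f y x r +_) (∑-map _ (picks r) _)) ⟩
      _ ≡⟨ ∑-+ (picks S) _ _ ⟩
      _ ∎)

  -- The distribution of a random assignment of keys to positions does not depend
  -- on the order in which the positions are listed.
  ∑-assign-↭ : ∀ {ps ps′} → ps ↭ ps′ → ∀ S → length S ≡ length ps → (g : (ℕ → A) → ℕ) →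
    (∀ {a b} → (∀ q → a q ≡ b q) → g a ≡ g b) →
    ∑[ π ∈ permutations S ] g (assign ps π) ≡ ∑[ π ∈ permutations S ] g (assign ps′ π)
  ∑-assign-↭ Perm.refl S eq g ext = refl
  ∑-assign-↭ (Perm.prep p ps↭) (x ∷ S) eq g ext = begin
    _ ≡⟨ ∑-permutations-picks x S _ ⟩
    _ ≡⟨ ∑-congᴬ (All.map (λ {(y , r)} |r| → ∑-assign-↭ ps↭ r (suc-injective (trans |r| eq)) (λ a → g (update p y a))
           (λ a≗b → ext (update-cong {p} {y} a≗b))) (length-picks (x ∷ S))) ⟩
    _ ≡⟨ ∑-permutations-picks x S _ ⟨
    _ ∎
    where open ≡-Reasoning
  ∑-assign-↭ {_ ∷ _ ∷ ps} {_ ∷ _ ∷ ps′} (Perm.swap p p′ ps↭) (x ∷ S) eq g ext = begin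
    _ ≡⟨ twice (λ y z π → g (update p y (update p′ z (assign ps π)))) (λ y z π → refl) ⟩
    ∑[ (y , r) ∈ picks (x ∷ S) ] ∑[ (z , r′) ∈ picks r ] ∑[ π ∈ permutations r′ ] g (update p y (update p′ z (assign ps π)))
      ≡⟨ ∑-congᴬ (All.map (λ {(y , r)} |r| → ∑-congᴬ (All.map (λ {(z , r′)} |r′| →
           ∑-assign-↭ ps↭ r′ (suc-injective (suc-injective (trans (cong suc |r′|) (trans |r| eq)))) (λ a → g (update p y (update p′ z a)))
             (λ a≗b → ext (update-cong {p} {y} (update-cong {p′} {z} a≗b))))
           (length-picks r))) (length-picks (x ∷ S))) ⟩
    ∑[ (y , r) ∈ picks (x ∷ S) ] ∑[ (z , r′) ∈ picks r ] ∑[ π ∈ permutations r′ ] g (update p y (update p′ z (assign ps′ π)))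
      ≡⟨ exchange ⟩
    ∑[ (y , r) ∈ picks (x ∷ S) ] ∑[ (z , r′) ∈ picks r ] ∑[ π ∈ permutations r′ ] g (update p′ y (update p z (assign ps′ π)))
      ≡⟨ twice (λ y z π → g (update p′ y (update p z (assign ps′ π)))) (λ y z π → refl) ⟨
    _ ∎
    where
    open ≡-Reasoning
    twice : ∀ {f} (k : A → A → List A → ℕ) → (∀ y z π → f (y ∷ z ∷ π) ≡ k y z π) →
      ∑ (permutations (x ∷ S)) f ≡ ∑[ (y , r) ∈ picks (x ∷ S) ] ∑[ (z , r′) ∈ picks r ] ∑[ π ∈ permutations r′ ] k y z π
    twice {f} k f≗k = begin
      _ ≡⟨ ∑-permutations-picks x S f ⟩
      _ ≡⟨ ∑-congᴬ (All.map (λ {(y , r)} |r| → second y r (suc-injective (trans |r| eq))) (length-picks (x ∷ S))) ⟩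
      _ ∎
      where
      second : ∀ y r {n} → length r ≡ suc n →
        ∑[ π ∈ permutations r ] f (y ∷ π) ≡ ∑[ (z , r′) ∈ picks r ] ∑[ π ∈ permutations r′ ] k y z π
      second y (z ∷ r) _ = trans (∑-permutations-picks z r (λ π → f (y ∷ π)))
        (∑-cong (picks (z ∷ r)) λ (z , r′) → ∑-cong (permutations r′) (f≗k y z))
    F : A → A → List A → ℕ
    F y z r = ∑[ π ∈ permutations r ] g (update p y (update p′ z (assign ps′ π)))
    G : A → A → List A → ℕ
    G y z r = ∑[ π ∈ permutations r ] g (update p′ y (update p z (assign ps′ π)))
    exchange : ∑[ (y , r) ∈ picks (x ∷ S) ] ∑[ (z , r′) ∈ picks r ] F y z r′ ≡
               ∑[ (y , r) ∈ picks (x ∷ S) ] ∑[ (z , r′) ∈ picks r ] G y z r′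
    -- For equal positions both sides are literally the same. For distinct ones the updates commute,
    -- and only the names of the two drawn keys have to be exchanged.
    exchange with p ≟ p′
    ... | yes refl = refl
    ... | no p≢p′  = trans (∑-picks-swap (x ∷ S) F) (∑-cong (picks (x ∷ S)) λ (y , r) →
      ∑-cong (picks r) λ (z , r′) → ∑-cong (permutations r′) λ π → ext (update-comm {p} {p′} {z} {y} p≢p′))
  ∑-assign-↭ (Perm.trans ps↭ ps↭′) S eq g ext = trans (∑-assign-↭ ps↭ S eq g ext)
    (∑-assign-↭ ps↭′ S (trans eq (↭-length ps↭)) g ext)

  assign-map-suc : ∀ ps ks q → assign (map suc ps) ks (suc q) ≡ assign ps ks q
  assign-map-suc []       ks       q = refl
  assign-map-suc (p ∷ ps) []       q = refl
  assign-map-suc (p ∷ ps) (k ∷ ks) q =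
    cong (if does (q ≟ p) then k else_) (assign-map-suc ps ks q)

  -- The counterpart of `fromList` for entries, since the cost analysis permutes entries `[ k ]`
  -- rather than keys.
  fromEntries : List A → ℕ → A
  fromEntries []       _             = d
  fromEntries (k ∷ ks) zero          = d
  fromEntries (k ∷ ks) (suc zero)    = k
  fromEntries (k ∷ ks) (suc (suc p)) = fromEntries ks (suc p)

  fromEntries-assign : ∀ π q → fromEntries π q ≡ assign (range 1 (length π)) π q
  fromEntries-assign []      q             = refl
  fromEntries-assign (k ∷ π) zero          = sym (assign-∉ (k ∷ π) (range-≢ 1 (suc (length π)) (s≤s z≤n)))
    where
    range-≢ : ∀ a n → 1 ≤ a → All (0 ≢_) (range a n)
    range-≢ a zero    1≤a = []
    range-≢ a (suc n) 1≤a = (λ where refl → <⇒≱ 1≤a z≤n) ∷ range-≢ (suc a) n (s≤s z≤n)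
  fromEntries-assign (k ∷ π) (suc zero)    = refl
  fromEntries-assign (k ∷ π) (suc (suc q)) = begin
    fromEntries π (suc q)                                   ≡⟨ fromEntries-assign π (suc q) ⟩
    assign (range 1 (length π)) π (suc q)                   ≡⟨ assign-map-suc (range 1 (length π)) π (suc q) ⟨
    assign (map suc (range 1 (length π))) π (suc (suc q))   ≡⟨ cong (λ ps → assign ps π (suc (suc q))) (range-suc 1 (length π)) ⟨
    assign (range 2 (length π)) π (suc (suc q))             ≡⟨ update-≢ 1 k (assign (range 2 (length π)) π) (λ ()) ⟨
    _ ∎
    where open ≡-Reasoning

  -- The array stores the permutation in level order and `fill` in preorder. Both orders list the
  -- same positions, so the random trees have the same distribution.
  ∑-treeOf : ∀ h S → length S ≡ size h → (g : Tree A h → ℕ) →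
    ∑[ π ∈ permutations S ] g (treeOf (fromEntries π) h 1) ≡ ∑[ π ∈ permutations S ] g (fill d h π)
  ∑-treeOf h S eq g = begin
    _ ≡⟨ ∑-congᴬ (All.map (λ {π} |π| → cong g (treeOf-cong h 1 λ q _ → trans (fromEntries-assign π q)
           (cong (λ n → assign (range 1 n) π q) |π|))) lengths) ⟩
    _ ≡⟨ ∑-assign-↭ (range-positions h) S (trans eq (trans (sym (length-positions h 1)) (sym (↭-length (range-positions h)))))
           (λ a → g (treeOf a h 1)) (λ a≗b → cong g (treeOf-cong h 1 λ q _ → a≗b q)) ⟩
    _ ≡⟨ ∑-congᴬ (All.map (λ {π} |π| → cong g (treeOf-assign h 1 π (s≤s z≤n) |π|)) lengths) ⟩
    _ ∎
    where
    open ≡-Reasoning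
    lengths : All (λ π → length π ≡ size h) (permutations S)
    lengths = All.map (λ |π| → trans |π| eq) (permutations-length S)

-- Heights of the subtrees of an array heap

blockSize≡size : ∀ s → blockSize s ≡ size s
blockSize≡size s = cong (_∸ 1) (go s)
  where
  arith : ∀ n → 2 * suc n ≡ suc (suc (n + n))
  arith = solve-∀
  go : ∀ s → 2 ^ s ≡ suc (size s)
  go zero    = refl
  go (suc s) = trans (cong (2 *_) (go s)) (arith (size s))

2^≡1+size : ∀ s → 2 ^ s ≡ suc (size s)
2^≡1+size s = trans (sym (m+[n∸m]≡n (m^n>0 2 s))) (cong suc (blockSize≡size s))

⌊log₂⌋-1+2* : ∀ q → 1 ≤ q → ⌊log₂ suc (2 * q) ⌋ ≡ suc ⌊log₂ q ⌋
⌊log₂⌋-1+2* q 1≤q = begin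
  ⌊log₂ suc (2 * q) ⌋                 ≡⟨ m+[n∸m]≡n 1≤log ⟨
  suc (⌊log₂ suc (2 * q) ⌋ ∸ 1)       ≡⟨ cong suc (⌊log₂⌊n/2⌋⌋≡⌊log₂n⌋∸1 (suc (2 * q))) ⟨
  suc ⌊log₂ ⌊ suc (2 * q) /2⌋ ⌋       ≡⟨ cong (suc ∘ ⌊log₂_⌋) (⌊1+2*p/2⌋ q) ⟩
  suc ⌊log₂ q ⌋                       ∎
  where
  open ≡-Reasoning
  1≤log : 1 ≤ ⌊log₂ suc (2 * q) ⌋
  1≤log = ⌊log₂⌋-mono-≤ {2} (m≤n⇒m≤1+n (*-monoʳ-≤ 2 1≤q))

2^⌊log₂⌋≤ : ∀ q → 1 ≤ q → 2 ^ ⌊log₂ q ⌋ ≤ q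
2^⌊log₂⌋≤ = <-rec _ step
  where
  open ≤-Reasoning
  step : ∀ q → (∀ {p} → p < q → 1 ≤ p → 2 ^ ⌊log₂ p ⌋ ≤ p) → 1 ≤ q → 2 ^ ⌊log₂ q ⌋ ≤ q
  step (suc zero)      rec _ = ≤-refl
  step q@(suc (suc n)) rec _ = begin
    2 ^ ⌊log₂ q ⌋                       ≡⟨ cong (2 ^_) (m+[n∸m]≡n {1} (⌊log₂⌋-mono-≤ {2} {q} (s≤s (s≤s z≤n)))) ⟨
    2 * 2 ^ (⌊log₂ q ⌋ ∸ 1)             ≡⟨ cong (λ l → 2 * 2 ^ l) (⌊log₂⌊n/2⌋⌋≡⌊log₂n⌋∸1 q) ⟨
    2 * 2 ^ ⌊log₂ ⌊ q /2⌋ ⌋             ≤⟨ *-monoʳ-≤ 2 (rec (⌊n/2⌋<n (suc n)) (s≤s z≤n)) ⟩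
    2 * ⌊ q /2⌋                         ≡⟨ cong (⌊ q /2⌋ +_) (+-identityʳ _) ⟩
    ⌊ q /2⌋ + ⌊ q /2⌋                   ≤⟨ +-monoʳ-≤ ⌊ q /2⌋ (⌊n/2⌋≤⌈n/2⌉ q) ⟩
    ⌊ q /2⌋ + ⌈ q /2⌉                   ≡⟨ ⌊n/2⌋+⌈n/2⌉≡n q ⟩
    q                                   ∎

-- Full m k p: in a heap of size m, the subtree at p is complete of height k.
Full : ℕ → ℕ → ℕ → Set
Full m zero    p = m < p
Full m (suc k) p = p ≤ m × Full m k (2 * p) × Full m k (suc (2 * p))

module _ {A : Set} where

  treeOf-Full : ∀ {m} k p {a b : ℕ → A} → Full m k p → (∀ q → q ≤ m → a q ≡ b q) → treeOf a k p ≡ treeOf b k p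
  treeOf-Full zero    p full a≗b = refl
  treeOf-Full (suc k) p (p≤m , fl , fr) a≗b
    rewrite a≗b p p≤m | treeOf-Full k (2 * p) fl a≗b | treeOf-Full k (suc (2 * p)) fr a≗b = refl

module Heights (h : ℕ) where

  m : ℕ
  m = size h

  -- The height of the complete subtree at a position `q ≥ 1`; truncated subtraction makes it 0
  -- beyond `m`.
  height : ℕ → ℕ
  height q = h ∸ ⌊log₂ q ⌋

  height-2* : ∀ q → 1 ≤ q → height (2 * q) ≡ height q ∸ 1
  height-2* (suc q) _ = trans (cong (h ∸_) (⌊log₂[2*b]⌋≡1+⌊log₂b⌋ (suc q))) (trans (cong (h ∸_) (+-comm 1 ⌊log₂ suc q ⌋)) (sym (∸-+-assoc h ⌊log₂ suc q ⌋ 1)))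

  height-1+2* : ∀ q → 1 ≤ q → height (suc (2 * q)) ≡ height q ∸ 1
  height-1+2* q 1≤q = trans (cong (h ∸_) (⌊log₂⌋-1+2* q 1≤q)) (trans (cong (h ∸_) (+-comm 1 ⌊log₂ q ⌋)) (sym (∸-+-assoc h ⌊log₂ q ⌋ 1)))

  height≡0 : ∀ q → m < q → height q ≡ 0
  height≡0 q m<q = m≤n⇒m∸n≡0 (subst (_≤ ⌊log₂ q ⌋) (⌊log₂[2^n]⌋≡n h)
    (⌊log₂⌋-mono-≤ (≤-trans (≤-reflexive (2^≡1+size h)) m<q)))

  height-full : ∀ k q → 1 ≤ q → height q ≡ k → Full m k q
  height-full zero    q 1≤q eq = begin
    suc m              ≡⟨ 2^≡1+size h ⟨
    2 ^ h              ≤⟨ ^-monoʳ-≤ 2 (m∸n≡0⇒m≤n {h} {⌊log₂ q ⌋} eq) ⟩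
    2 ^ ⌊log₂ q ⌋      ≤⟨ 2^⌊log₂⌋≤ q 1≤q ⟩
    q                  ∎
    where open ≤-Reasoning
  height-full (suc k) q 1≤q eq =
    ≮⇒≥ (λ m<q → 0≢1+n (trans (sym (height≡0 q m<q)) eq)) ,
    height-full k (2 * q) (≤-trans 1≤q (m≤m+n q _)) (trans (height-2* q 1≤q) (cong (_∸ 1) eq)) ,
    height-full k (suc (2 * q)) (s≤s z≤n) (trans (height-1+2* q 1≤q) (cong (_∸ 1) eq))

-- Removal of the root on trees

module Pop {A : Set} (d : A) (_<ᵉ_ : A → A → Bool) (μ : A → ℕ) (μ≤1 : ∀ u → μ u ≤ 1) (μd≡0 : μ d ≡ 0) where

  open Costs d _<ᵉ_ μ μ≤1
  open Bounds d _<ᵉ_ μ μ≤1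

  root : ∀ {h} → Tree A (suc h) → A
  root (node v l r) = v

  -- The entry put into the hole is a dummy, so on the positions of the keys a removal only shifts a
  -- path upwards and leaves `d` at its end. The shape of the tree never changes.
  pop : ∀ {h} → Tree A (suc h) → Tree A (suc h)
  pop (node v leaf leaf) = node d leaf leaf
  pop (node v l@(node u _ _) r@(node w _ _)) = if u <ᵉ w then node w l (pop r) else node u (pop l) r

  popCost : ∀ {h} → Tree A (suc h) → ℕ
  popCost (node v leaf leaf) = 0
  popCost (node v l@(node u _ _) r@(node w _ _)) = μ u * μ w + (if u <ᵉ w then popCost r else popCost l)

  weight-pop : ∀ {h} (t : Tree A (suc h)) → μ (root t) + weightT (pop t) ≡ weightT t
  weight-pop (node v leaf leaf) = cong (λ z → μ v + (z + 0)) μd≡0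
  weight-pop (node v l@(node u _ _) r@(node w _ _)) with u <ᵉ w
  ... | true  = cong (μ v +_) (trans (arith (μ w) (weightT l) (weightT (pop r))) (cong (weightT l +_) (weight-pop r)))
    where
    arith : ∀ a b c → a + (b + c) ≡ b + (a + c)
    arith = solve-∀
  ... | false = cong (μ v +_) (trans (sym (+-assoc (μ u) (weightT (pop l)) (weightT r))) (cong (_+ weightT r) (weight-pop l)))

  -- A counted comparison takes the marked key `p` out of one part while the marked key `q` remains
  -- in the other, so `mergeCost` drops by at least 1 and pays for it.
  mergeCost-sucˡ : ∀ {p q a a′ b} → p ≤ 1 → q ≤ 1 → p + a′ ≡ a → q ≤ b → p * q + mergeCost a′ b ≤ mergeCost a b
  mergeCost-sucˡ z≤n       _         refl _ = ≤-refl
  mergeCost-sucˡ {a′ = zero}   (s≤s z≤n) z≤n       refl _ = z≤n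
  mergeCost-sucˡ {a′ = suc a′} {zero}  (s≤s z≤n) z≤n refl _ = z≤n
  mergeCost-sucˡ {a′ = suc a′} {suc b} (s≤s z≤n) z≤n refl _ = n≤1+n _
  mergeCost-sucˡ {a′ = zero}   (s≤s z≤n) (s≤s z≤n) refl (s≤s _) = s≤s z≤n
  mergeCost-sucˡ {a′ = suc a′} (s≤s z≤n) (s≤s z≤n) refl (s≤s _) = ≤-refl

  mergeCost-comm : ∀ a b → mergeCost a b ≡ mergeCost b a
  mergeCost-comm zero    zero    = refl
  mergeCost-comm zero    (suc b) = refl
  mergeCost-comm (suc a) zero    = refl
  mergeCost-comm (suc a) (suc b) = +-comm (suc a) (suc b)

  -- `outputCost` is a potential: at each node on the path of the hole the promoted key leaves its
  -- subtree, and the drop of the `mergeCost` of that node pays for the comparison. All removals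
  -- together then cost at most the initial value.
  pop-outputCost : ∀ {h} (t : Tree A (suc h)) → popCost t + outputCost (pop t) ≤ outputCost t
  pop-outputCost (node v leaf leaf) = z≤n
  pop-outputCost (node v l@(node u l₁ l₂) r@(node w r₁ r₂)) with u <ᵉ w
  ... | true  = begin
    μ u * μ w + popCost r + (mergeCost (weightT l) (weightT (pop r)) + (outputCost l + outputCost (pop r)))
      ≡⟨ arith (μ u) (μ w) (popCost r) (mergeCost (weightT l) (weightT (pop r))) (outputCost l) (outputCost (pop r)) ⟩
    μ w * μ u + mergeCost (weightT l) (weightT (pop r)) + (outputCost l + (popCost r + outputCost (pop r)))
      ≡⟨ cong (λ z → μ w * μ u + z + (outputCost l + (popCost r + outputCost (pop r)))) (mergeCost-comm (weightT l) _) ⟩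
    μ w * μ u + mergeCost (weightT (pop r)) (weightT l) + (outputCost l + (popCost r + outputCost (pop r)))
      ≤⟨ +-mono-≤ (mergeCost-sucˡ (μ≤1 w) (μ≤1 u) (weight-pop r) (m≤m+n (μ u) _)) (+-monoʳ-≤ (outputCost l) (pop-outputCost r)) ⟩
    mergeCost (weightT r) (weightT l) + (outputCost l + outputCost r)
      ≡⟨ cong (_+ (outputCost l + outputCost r)) (mergeCost-comm (weightT r) (weightT l)) ⟩
    _ ∎
    where
    open ≤-Reasoning
    arith : ∀ u w p c x y → u * w + p + (c + (x + y)) ≡ w * u + c + (x + (p + y))
    arith = solve-∀
  ... | false = begin
    μ u * μ w + popCost l + (mergeCost (weightT (pop l)) (weightT r) + (outputCost (pop l) + outputCost r))
      ≡⟨ arith (μ u) (μ w) (popCost l) (mergeCost (weightT (pop l)) (weightT r)) (outputCost (pop l)) (outputCost r) ⟩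
    μ u * μ w + mergeCost (weightT (pop l)) (weightT r) + (popCost l + outputCost (pop l) + outputCost r)
      ≤⟨ +-mono-≤ (mergeCost-sucˡ (μ≤1 u) (μ≤1 w) (weight-pop l) (m≤m+n (μ w) _)) (+-monoˡ-≤ (outputCost r) (pop-outputCost l)) ⟩
    _ ∎
    where
    open ≤-Reasoning
    arith : ∀ u w p c x y → u * w + p + (c + (x + y)) ≡ u * w + c + (p + x + y)
    arith = solve-∀

n≤size : ∀ h → h ≤ size h
n≤size zero    = z≤n
n≤size (suc h) = s≤s (≤-trans (n≤size h) (m≤m+n _ _))

cong₃ : ∀ {A B C D : Set} (f : A → B → C → D) {a a′ b b′ c c′} →
        a ≡ a′ → b ≡ b′ → c ≡ c′ → f a b c ≡ f a′ b′ c′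
cong₃ f refl refl refl = refl

-- The array program and its counted comparisons

module Comparisons (O : StrictTotalOrder 0ℓ 0ℓ 0ℓ) where
  open Heapsort O

  module Marked (P : Entry → Set) (P? : ∀ u → Dec (P u)) (¬P⊥ : ¬ P ⊥₋) where

    _<ᵉ_ : Entry → Entry → Bool
    u <ᵉ v = does (u <ᴱ? v)

    ≮ᵉ⊥₋ : ∀ u → u <ᵉ ⊥₋ ≡ false
    ≮ᵉ⊥₋ ⊥₋    = refl
    ≮ᵉ⊥₋ [ k ] = refl

    μ : Entry → ℕ
    μ u = if does (P? u) then 1 else 0

    μ≤1 : ∀ u → μ u ≤ 1
    μ≤1 u with does (P? u)
    ... | true  = ≤-refl
    ... | false = z≤n

    μ⊥₋≡0 : μ ⊥₋ ≡ 0
    μ⊥₋≡0 = cong (λ b → if b then 1 else 0) (dec-false (P? ⊥₋) ¬P⊥)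

    open Weights μ μ≤1 public
    open Costs ⊥₋ _<ᵉ_ μ μ≤1 public
    open Bounds ⊥₋ _<ᵉ_ μ μ≤1 public
    open Total ⊥₋ _<ᵉ_ μ μ≤1 public
    open Pop ⊥₋ _<ᵉ_ μ μ≤1 μ⊥₋≡0 public
    open Assign {Entry} ⊥₋ public

    count : List (Entry × Entry) → ℕ
    count w = length (filter (λ (u , v) → P? u ×-dec P? v) w)

    count-∷ : ∀ u v w → count ((u , v) ∷ w) ≡ μ u * μ v + count w
    count-∷ u v w with P? u | P? v
    ... | yes _ | yes _ = refl
    ... | yes _ | no _  = refl
    ... | no _  | _     = refl

    count-++ : ∀ w w′ → count (w ++ w′) ≡ count w + count w′
    count-++ w w′ = trans (cong length (filter-++ _ w w′)) (length-++ (filter _ w))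

    cost : ∀ {A : Set} → Logged A → ℕ
    cost = count ∘ proj₁

    -- Construction phase on arrays

    swap-≡ʳ : ∀ p c A → swap p c A c ≡ A p
    swap-≡ʳ p c A = update-≡ c (A p) (A [ p ≔ A c ])

    swap-≡ˡ : ∀ {p c} A → p < c → swap p c A p ≡ A c
    swap-≡ˡ {p} {c} A p<c = trans (update-≢ c (A p) (A [ p ≔ A c ]) (<⇒≢ p<c)) (update-≡ p (A c) A)

    swap-≢ : ∀ {p c q} A → q ≢ p → q ≢ c → swap p c A q ≡ A q
    swap-≢ {p} {c} A q≢p q≢c = trans (update-≢ c (A p) (A [ p ≔ A c ]) q≢c) (update-≢ p (A c) A q≢p)

    -- The effect of moving the entry at p to its child c and continuing below c,
    -- where c′ is the other child.
    module _ {p c c′ : ℕ} (p<c : p < c) (p<c′ : p < c′) (apart : ∀ {q} → Under c q → ¬ Under c′ q) where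

      frame-child : ∀ (A B : Array) → (∀ q → ¬ Under c q → B q ≡ swap p c A q) → B p ≡ A c
      frame-child A B frame = trans (frame p λ u → <⇒≱ p<c (Under-≤ u)) (swap-≡ˡ A p<c)

      frame-sibling : ∀ (A B : Array) → (∀ q → ¬ Under c q → B q ≡ swap p c A q) → ∀ k → treeOf B k c′ ≡ treeOf A k c′
      frame-sibling A B frame k = treeOf-cong k c′ λ q u′ → trans (frame q λ u → apart u u′)
        (swap-≢ A (λ where refl → <⇒≱ p<c′ (Under-≤ u′)) (λ where refl → apart here u′))

    swap-below : ∀ {p c} → 1 ≤ p → p < c → ∀ A k →
                 treeOf (swap p c A) k (2 * c) ≡ treeOf A k (2 * c) ×
                 treeOf (swap p c A) k (suc (2 * c)) ≡ treeOf A k (suc (2 * c))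
    swap-below {p} {c} 1≤p p<c A k =
      treeOf-cong k (2 * c) (λ q u → same q (<-≤-trans c<2c (Under-≤ u))) ,
      treeOf-cong k (suc (2 * c)) (λ q u → same q (<-≤-trans (m<n⇒m<1+n c<2c) (Under-≤ u)))
      where
      c<2c = p<2*p (≤-trans 1≤p (<⇒≤ p<c))
      same : ∀ q → c < q → swap p c A q ≡ A q
      same q c<q = swap-≢ A (λ where refl → <-asym p<c c<q) (λ where refl → <-irrefl refl c<q)

    -- The last clause is a frame condition: it preserves the sibling subtree during the sift and
    -- the other subheaps during BuildHeap.
    SiftsDown : ℕ → ℕ → Array → Logged Array → Set
    SiftsDown k p A R =
      treeOf (proj₂ R) (suc k) p ≡ sift (A p) (treeOf A k (2 * p)) (treeOf A k (suc (2 * p))) ×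
      cost R ≡ siftCost (A p) (treeOf A k (2 * p)) (treeOf A k (suc (2 * p))) ×
      (∀ q → ¬ Under p q → proj₂ R q ≡ A q)

    siftDown-unfold : ∀ fuel m p A → 2 * p ≤ m → suc (2 * p) ≤ m →
      let c = if A (2 * p) <ᵉ A (suc (2 * p)) then suc (2 * p) else 2 * p
          R = if A p <ᵉ A c then siftDown fuel m c (swap p c A) else return A
      in siftDown (suc fuel) m p A ≡ ((A (2 * p) , A (suc (2 * p))) ∷ (A p , A c) ∷ proj₁ R , proj₂ R)
    siftDown-unfold fuel m p A l≤m r≤m
      rewrite dec-true (2 * p ≤? m) l≤m | dec-true (suc (2 * p) ≤? m) r≤m = refl

    siftDown-spec : ∀ fuel m k p A → k ≤ fuel → 1 ≤ p → Full m (suc k) p →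
                    SiftsDown k p A (siftDown fuel m p A)
    siftDown-spec zero       m zero    p A k≤ 1≤p full = refl , refl , λ _ _ → refl
    siftDown-spec (suc fuel) m zero    p A k≤ 1≤p (p≤m , m<l , m<r)
      rewrite dec-false (2 * p ≤? m) (<⇒≱ m<l) = refl , refl , λ _ _ → refl
    siftDown-spec (suc fuel) m (suc k) p A (s≤s k≤) 1≤p (p≤m , fl , fr) =
      subst (SiftsDown (suc k) p A) (sym (siftDown-unfold fuel m p A (proj₁ fl) (proj₁ fr))) body
      where
      l = 2 * p
      r = suc (2 * p)
      p<l = p<2*p 1≤p
      p<r = m<n⇒m<1+n p<l
      c = if A l <ᵉ A r then r else l
      R = if A p <ᵉ A c then siftDown fuel m c (swap p c A) else return A
      body : SiftsDown (suc k) p A ((A l , A r) ∷ (A p , A c) ∷ proj₁ R , proj₂ R)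
      body with A l <ᵉ A r
      body | true with A p <ᵉ A r
      ... | false = refl , trans (count-∷ (A l) (A r) _) (cong (μ (A l) * μ (A r) +_) (count-∷ (A p) (A r) _)) , λ _ _ → refl
      ... | true  with siftDown-spec fuel m k r (swap p r A) k≤ (s≤s z≤n) fr
                     | swap-below 1≤p p<r A k
      ...   | tree , cost≡ , frame | bl , br =
        cong₃ node (frame-child p<r p<l apart A B frame) (frame-sibling p<r p<l apart A B frame (suc k))
                   (trans tree (cong₃ sift (swap-≡ʳ p r A) bl br)) ,
        trans (count-∷ (A l) (A r) _) (cong (μ (A l) * μ (A r) +_) (trans (count-∷ (A p) (A r) _)
          (cong (μ (A p) * μ (A r) +_) (trans cost≡ (cong₃ siftCost (swap-≡ʳ p r A) bl br))))) ,
        λ q ¬u → trans (frame q (λ u → ¬u (Under-1+2* u)))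
          (swap-≢ A (λ where refl → ¬u here) (λ where refl → ¬u (Under-1+2* here)))
        where
        B = proj₂ (siftDown fuel m r (swap p r A))
        apart : ∀ {q} → Under r q → ¬ Under l q
        apart u u′ = Under-children 1≤p u′ u
      body | false with A p <ᵉ A l
      ... | false = refl , trans (count-∷ (A l) (A r) _) (cong (μ (A l) * μ (A r) +_) (count-∷ (A p) (A l) _)) , λ _ _ → refl
      ... | true  with siftDown-spec fuel m k l (swap p l A) k≤ (≤-trans 1≤p (<⇒≤ p<l)) fl
                     | swap-below 1≤p p<l A k
      ...   | tree , cost≡ , frame | bl , br =
        cong₃ node (frame-child p<l p<r (Under-children 1≤p) A B frame)
                   (trans tree (cong₃ sift (swap-≡ʳ p l A) bl br))
                   (frame-sibling p<l p<r (Under-children 1≤p) A B frame (suc k)) ,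
        trans (count-∷ (A l) (A r) _) (cong (μ (A l) * μ (A r) +_) (trans (count-∷ (A p) (A l) _)
          (cong (μ (A p) * μ (A l) +_) (trans cost≡ (cong₃ siftCost (swap-≡ʳ p l A) bl br))))) ,
        λ q ¬u → trans (frame q (λ u → ¬u (Under-2* u)))
          (swap-≢ A (λ where refl → ¬u here) (λ where refl → ¬u (Under-2* here)))
        where
        B = proj₂ (siftDown fuel m l (swap p l A))

    module Construction (h : ℕ) (A₀ : Array) where
      open Heights h

      heapAt : ∀ k p → Tree Entry k
      heapAt k p = heapify (treeOf A₀ k p)

      costAt : ℕ → ℕ
      costAt q = buildCost (treeOf A₀ (height q) q)

      -- After the positions greater than p have been processed, the subtrees at
      -- p + 1 , … , 2 p + 1 are heaps.
      Invariant : ℕ → Array → Set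
      Invariant p B =
        (∀ q → q ≤ p → B q ≡ A₀ q) ×
        (∀ q → p < q → ⌊ q /2⌋ ≤ p → treeOf B (height q) q ≡ heapAt (height q) q)

      height-positive : ∀ q → 1 ≤ q → q ≤ m → ∃[ k ] height q ≡ suc k
      height-positive q 1≤q q≤m with height q in eq
      ... | zero  = ⊥-elim (<⇒≱ (height-full 0 q 1≤q eq) q≤m)
      ... | suc k = k , refl

      cost-frontier : ∀ p {k} → 1 ≤ p → height p ≡ suc k →
        siftCost (A₀ p) (heapAt k (2 * p)) (heapAt k (suc (2 * p))) + (costAt (2 * p) + costAt (suc (2 * p))) ≡ costAt p
      cost-frontier p {k} 1≤p eq = begin
        s + (costAt (2 * p) + costAt (suc (2 * p)))
          ≡⟨ cong (s +_) (cong₂ (λ a b → buildCost (treeOf A₀ a (2 * p)) + buildCost (treeOf A₀ b (suc (2 * p))))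
               (trans (height-2* p 1≤p) (cong (_∸ 1) eq)) (trans (height-1+2* p 1≤p) (cong (_∸ 1) eq))) ⟩
        s + (buildCost (treeOf A₀ k (2 * p)) + buildCost (treeOf A₀ k (suc (2 * p))))
          ≡⟨ +-comm s _ ⟩
        buildCost (treeOf A₀ (suc k) p)
          ≡⟨ cong (λ k → buildCost (treeOf A₀ k p)) eq ⟨
        costAt p ∎
        where
        open ≡-Reasoning
        s = siftCost (A₀ p) (heapAt k (2 * p)) (heapAt k (suc (2 * p)))

      -- With `q = suc p`, the frontier `q + 1 , … , 2 q + 1` consists of the positions that stay on
      -- it and the two children of `q`, which `q` is about to replace.
      ∑-frontier : ∀ p → ∑ (range (suc (suc p)) (suc (suc p))) costAt ≡
                   ∑ (range (suc (suc p)) p) costAt + (costAt (2 * suc p) + costAt (suc (2 * suc p)))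
      ∑-frontier p = begin
        ∑ (range a (suc (suc p))) costAt              ≡⟨ cong (λ n → ∑ (range a n) costAt) (+-comm 2 p) ⟩
        ∑ (range a (p + 2)) costAt                    ≡⟨ cong (λ qs → ∑ qs costAt) (range-++ a p 2) ⟨
        ∑ (range a p ++ range (a + p) 2) costAt       ≡⟨ ∑-++ (range a p) (range (a + p) 2) costAt ⟩
        ∑ (range a p) costAt + (costAt (a + p) + (costAt (suc (a + p)) + 0))
          ≡⟨ cong (λ z → ∑ (range a p) costAt + (costAt (a + p) + z)) (+-identityʳ _) ⟩
        ∑ (range a p) costAt + (costAt (a + p) + costAt (suc (a + p)))
          ≡⟨ cong (λ q → ∑ (range a p) costAt + (costAt q + costAt (suc q))) (arith p) ⟩
        _ ∎
        where
        open ≡-Reasoning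
        a = suc (suc p)
        arith : ∀ p → suc (suc p) + p ≡ 2 * suc p
        arith = solve-∀

      -- The cost still to be paid plus the costs stored on the frontier is conserved: the sift at
      -- `q` and the costs of its two children add up to `costAt q`. At `p = 0` the frontier is the
      -- root alone.
      siftDownFrom-spec : ∀ p B → p ≤ m → Invariant p B →
        treeOf (proj₂ (siftDownFrom p m B)) (height 1) 1 ≡ heapAt (height 1) 1 ×
        cost (siftDownFrom p m B) + ∑ (range (suc p) (suc p)) costAt ≡ costAt 1
      siftDownFrom-spec zero    B p≤m (_ , heap) = heap 1 (s≤s z≤n) z≤n , +-identityʳ _
      siftDownFrom-spec (suc p) B p≤m (same , heap) with height-positive (suc p) (s≤s z≤n) p≤m
      ... | k , eq = proj₁ rest , (begin
          count (proj₁ R ++ proj₁ (siftDownFrom p m C)) + ∑ (range (suc q) (suc q)) costAt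
            ≡⟨ cong₂ _+_ (count-++ (proj₁ R) _) (∑-frontier p) ⟩
          cost R + c + (f + g)
            ≡⟨ cong (λ z → z + c + (f + g)) (trans (proj₁ (proj₂ spec)) (cong₃ siftCost root-same left-heap right-heap)) ⟩
          s + c + (f + g)
            ≡⟨ arith s c f g ⟩
          c + ((s + g) + f)
            ≡⟨ cong (λ z → c + (z + f)) (cost-frontier q (s≤s z≤n) eq) ⟩
          c + ∑ (range q q) costAt
            ≡⟨ proj₂ rest ⟩
          costAt 1 ∎)
        where
        open ≡-Reasoning
        q = suc p
        R = siftDown m m q B
        C = proj₂ R
        k≤m : k ≤ m
        k≤m = ≤-trans (n≤1+n k) (≤-trans (≤-reflexive (sym eq)) (≤-trans (m∸n≤m h ⌊log₂ q ⌋) (n≤size h)))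
        spec = siftDown-spec m m k q B k≤m (s≤s z≤n) (height-full (suc k) q (s≤s z≤n) eq)
        root-same : B q ≡ A₀ q
        root-same = same q ≤-refl
        left-heap : treeOf B k (2 * q) ≡ heapAt k (2 * q)
        left-heap = subst (λ k → treeOf B k (2 * q) ≡ heapAt k (2 * q)) (trans (height-2* q (s≤s z≤n)) (cong (_∸ 1) eq))
          (heap (2 * q) (p<2*p (s≤s z≤n)) (≤-reflexive (⌊2*p/2⌋ q)))
        right-heap : treeOf B k (suc (2 * q)) ≡ heapAt k (suc (2 * q))
        right-heap = subst (λ k → treeOf B k (suc (2 * q)) ≡ heapAt k (suc (2 * q))) (trans (height-1+2* q (s≤s z≤n)) (cong (_∸ 1) eq))
          (heap (suc (2 * q)) (m<n⇒m<1+n (p<2*p (s≤s z≤n))) (≤-reflexive (⌊1+2*p/2⌋ q)))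
        heap′ : ∀ x → p < x → ⌊ x /2⌋ ≤ p → treeOf C (height x) x ≡ heapAt (height x) x
        heap′ x p<x half≤p with x ≟ q
        ... | yes refl = subst (λ k → treeOf C k q ≡ heapAt k q) (sym eq)
          (trans (proj₁ spec) (cong₃ sift root-same left-heap right-heap))
        -- A position below both `q` and `x` would put `x` strictly below `q`, hence the parent of
        -- `x` at or after `q`, contrary to `⌊ x /2⌋ ≤ p`.
        ... | no x≢q   = trans
          (treeOf-cong (height x) x λ y u → proj₂ (proj₂ spec) y λ u′ →
            <⇒≱ (s≤s half≤p) (Under-≤ (Under-half (Under-chain u′ u p<x) λ q≡x → x≢q (sym q≡x))))
          (heap x (≤∧≢⇒< p<x λ q≡x → x≢q (sym q≡x)) (m≤n⇒m≤1+n half≤p))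
        rest = siftDownFrom-spec p C (<⇒≤ p≤m)
          ((λ x x≤p → trans (proj₂ (proj₂ spec) x λ u → <⇒≱ (s≤s x≤p) (Under-≤ u)) (same x (m≤n⇒m≤1+n x≤p))) , heap′)
        c = cost (siftDownFrom p m C)
        f = ∑ (range (suc q) p) costAt
        g = costAt (2 * q) + costAt (suc (2 * q))
        s = siftCost (A₀ q) (heapAt k (2 * q)) (heapAt k (suc (2 * q)))
        arith : ∀ s c f g → s + c + (f + g) ≡ c + ((s + g) + f)
        arith = solve-∀

      -- At the start the frontier lies beyond `m`. Its subtrees are empty, hence heaps of cost 0,
      -- and the conserved quantity is the cost of `buildHeap` alone.
      buildHeap-spec :
        treeOf (proj₂ (buildHeap m A₀)) h 1 ≡ heapify (treeOf A₀ h 1) ×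
        cost (buildHeap m A₀) ≡ buildCost (treeOf A₀ h 1)
      buildHeap-spec with siftDownFrom-spec m A₀ ≤-refl ((λ _ _ → refl) , λ q m<q _ → beyond q (height≡0 q m<q))
        where
        beyond : ∀ q {k} → k ≡ 0 → treeOf A₀ k q ≡ heapAt k q
        beyond q refl = refl
      ... | tree , cost≡ = tree , trans (sym (trans (cong (cost (buildHeap m A₀) +_) (beyond (suc m) (suc m) ≤-refl)) (+-identityʳ _))) cost≡
        where
        beyond : ∀ a n → m < a → ∑ (range a n) costAt ≡ 0
        beyond a zero    m<a = refl
        beyond a (suc n) m<a = cong₂ _+_ (cong (λ k → buildCost (treeOf A₀ k a)) (height≡0 a m<a)) (beyond (suc a) n (m<n⇒m<1+n m<a))

    -- Sorting phase on arrays

    Dummies : ℕ → Array → Set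
    Dummies m A = ∀ q → m < q → A q ≡ ⊥₋

    count-⊥₋ : ∀ u v → u ≡ ⊥₋ → count ((u , v) ∷ []) ≡ 0
    count-⊥₋ u v refl = trans (count-∷ ⊥₋ v []) (cong (λ z → z * μ v + 0) μ⊥₋≡0)

    -- The hole is filled with a dummy afterwards, so it may be taken to contain one.
    Sinks : ℕ → ℕ → ℕ → Array → Logged (ℕ × Array) → Set
    Sinks m k p A (w , hole , B) =
      treeOf (B [ hole ≔ ⊥₋ ]) (suc k) p ≡ pop (treeOf A (suc k) p) ×
      count w ≡ popCost (treeOf A (suc k) p) ×
      Under p hole ×
      (∀ q → ¬ Under p q → B q ≡ A q) ×
      Dummies m B

    sinkHole-stop : ∀ fuel n p A → n < 2 * p → sinkHole fuel n p A ≡ return (p , A)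
    sinkHole-stop zero       n p A n<2p = refl
    sinkHole-stop (suc fuel) n p A n<2p rewrite dec-false (2 * p ≤? n) (<⇒≱ n<2p) = refl

    sinkHole-unfold : ∀ fuel n p A → 2 * p ≤ n → suc (2 * p) ≤ n →
      let c = if A (2 * p) <ᵉ A (suc (2 * p)) then suc (2 * p) else 2 * p
          R = sinkHole fuel n c (A [ p ≔ A c ])
      in sinkHole (suc fuel) n p A ≡ ((A (2 * p) , A (suc (2 * p))) ∷ proj₁ R , proj₂ R)
    sinkHole-unfold fuel n p A l≤n r≤n
      rewrite dec-true (2 * p ≤? n) l≤n | dec-true (suc (2 * p) ≤? n) r≤n = refl

    update-dummies : ∀ {m p e A} → p ≤ m → Dummies m A → Dummies m (A [ p ≔ e ])
    update-dummies {m} {p} {e} {A} p≤m dummies q m<q =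
      trans (update-≢ p e A λ where refl → <⇒≱ m<q p≤m) (dummies q m<q)

    sinkHole-leaf : ∀ m w c p A → p ≤ m → m < c → Under p c → count w ≡ 0 → Dummies m A →
                    Sinks m 0 p A (w , c , A [ p ≔ A c ])
    sinkHole-leaf m w c p A p≤m m<c u count≡0 dummies =
      cong (λ v → node v leaf leaf) (trans (update-≢ c ⊥₋ (A [ p ≔ A c ]) (<⇒≢ (≤-<-trans p≤m m<c)))
        (trans (update-≡ p (A c) A) (dummies c m<c))) ,
      count≡0 , u ,
      (λ q ¬u → update-≢ p (A c) A λ where refl → ¬u here) ,
      update-dummies {e = A c} {A = A} p≤m dummies

    module _ (m n : ℕ) (m<n : m < n) (n< : n < 2 * suc m) where

      -- The children of a bottom key are dummies, and `n < 2 * suc m` leaves these without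
      -- children. So the hole stops at `p` or one level lower; the cases are zero, one or two
      -- existing children.
      sinkHole-bottom : ∀ fuel p A → 1 ≤ p → p ≤ m → m < 2 * p → Dummies m A →
                        Sinks m 0 p A (sinkHole fuel n p A)
      sinkHole-bottom zero       p A 1≤p p≤m m<2p dummies =
        cong (λ v → node v leaf leaf) (update-≡ p ⊥₋ A) , refl , here , (λ _ _ → refl) , dummies
      sinkHole-bottom (suc fuel) p A 1≤p p≤m m<2p dummies with 2 * p ≤? n
      ... | no  l≰n rewrite dec-false (2 * p ≤? n) l≰n =
        cong (λ v → node v leaf leaf) (update-≡ p ⊥₋ A) , refl , here , (λ _ _ → refl) , dummies
      ... | yes l≤n with suc (2 * p) ≤? n
      ...   | no  r≰n rewrite dec-true (2 * p ≤? n) l≤n | dec-false (suc (2 * p) ≤? n) r≰n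
                            | sinkHole-stop fuel n (2 * p) (A [ p ≔ A (2 * p) ]) (<-≤-trans n< (*-monoʳ-≤ 2 m<2p)) =
        sinkHole-leaf m [] (2 * p) p A p≤m m<2p (Under-2* here) refl dummies
      ...   | yes r≤n = subst (Sinks m 0 p A) (sym (sinkHole-unfold fuel n p A l≤n r≤n)) (body (A (2 * p) <ᵉ A (suc (2 * p))))
        where
        w = (A (2 * p) , A (suc (2 * p))) ∷ []
        stop : ∀ c → m < c → Under p c → Sinks m 0 p A
          (w ++ proj₁ (sinkHole fuel n c (A [ p ≔ A c ])) , proj₂ (sinkHole fuel n c (A [ p ≔ A c ])))
        stop c m<c u rewrite sinkHole-stop fuel n c (A [ p ≔ A c ]) (<-≤-trans n< (*-monoʳ-≤ 2 m<c)) =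
          sinkHole-leaf m w c p A p≤m m<c u (count-⊥₋ (A (2 * p)) (A (suc (2 * p))) (dummies (2 * p) m<2p)) dummies
        body : ∀ b → let c = if b then suc (2 * p) else 2 * p
                         R = sinkHole fuel n c (A [ p ≔ A c ])
                     in Sinks m 0 p A (w ++ proj₁ R , proj₂ R)
        body true  = stop (suc (2 * p)) (m<n⇒m<1+n m<2p) (Under-1+2* here)
        body false = stop (2 * p) m<2p (Under-2* here)

      -- Shared by the two choices of the promoted child `c`: the sink below `c` affects neither the
      -- promoted entry at `p` nor the subtree of the sibling `c′`.
      module Sink-child {p c c′ : ℕ} (p≤m : p ≤ m) (p<c : p < c) (p<c′ : p < c′)
                        (apart : ∀ {q} → Under c q → ¬ Under c′ q) (A : Array) (k : ℕ) (dummies : Dummies m A)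
                        {w : List (Entry × Entry)} {hole : ℕ} {B : Array} (sinks : Sinks m k c (A [ p ≔ A c ]) (w , hole , B)) where

        B′ : Array
        B′ = B [ hole ≔ ⊥₋ ]

        u : Under c hole
        u = proj₁ (proj₂ (proj₂ sinks))

        frame : ∀ q → ¬ Under c q → B q ≡ (A [ p ≔ A c ]) q
        frame = proj₁ (proj₂ (proj₂ (proj₂ sinks)))

        at-root : B′ p ≡ A c
        at-root = trans (update-≢ hole ⊥₋ B (<⇒≢ (<-≤-trans p<c (Under-≤ u))))
          (trans (frame p λ u → <⇒≱ p<c (Under-≤ u)) (update-≡ p (A c) A))

        sibling : treeOf B′ (suc k) c′ ≡ treeOf A (suc k) c′
        sibling = treeOf-cong (suc k) c′ λ q u′ → trans (update-≢ hole ⊥₋ B λ where refl → apart u u′)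
          (trans (frame q λ u → apart u u′) (update-≢ p (A c) A λ where refl → <⇒≱ p<c′ (Under-≤ u′)))

        unchanged : treeOf (A [ p ≔ A c ]) (suc k) c ≡ treeOf A (suc k) c
        unchanged = treeOf-cong (suc k) c λ q u → update-≢ p (A c) A λ where refl → <⇒≱ p<c (Under-≤ u)

        below-child : treeOf B′ (suc k) c ≡ pop (treeOf A (suc k) c)
        below-child = trans (proj₁ sinks) (cong pop unchanged)

        count≡ : count w ≡ popCost (treeOf A (suc k) c)
        count≡ = trans (proj₁ (proj₂ sinks)) (cong popCost unchanged)

        frame′ : (∀ {q} → Under c q → Under p q) → ∀ q → ¬ Under p q → B q ≡ A q
        frame′ up q ¬u = trans (frame q λ u → ¬u (up u)) (update-≢ p (A c) A λ where refl → ¬u here)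

        dummies′ : Dummies m B
        dummies′ = proj₂ (proj₂ (proj₂ (proj₂ sinks)))

      sinkHole-spec : ∀ fuel k p A → k ≤ fuel → 1 ≤ p → Full m (suc k) p → Dummies m A →
                      Sinks m k p A (sinkHole fuel n p A)
      sinkHole-spec fuel       zero    p A k≤ 1≤p (p≤m , m<l , _) dummies = sinkHole-bottom fuel p A 1≤p p≤m m<l dummies
      sinkHole-spec (suc fuel) (suc k) p A (s≤s k≤) 1≤p (p≤m , fl , fr) dummies =
        subst (Sinks m (suc k) p A)
          (sym (sinkHole-unfold fuel n p A (≤-trans (proj₁ fl) (<⇒≤ m<n)) (≤-trans (proj₁ fr) (<⇒≤ m<n)))) body
        where
        l = 2 * p
        r = suc (2 * p)
        p<l = p<2*p 1≤p
        p<r = m<n⇒m<1+n p<l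
        c = if A l <ᵉ A r then r else l
        R = sinkHole fuel n c (A [ p ≔ A c ])
        apart : ∀ {q} → Under r q → ¬ Under l q
        apart u u′ = Under-children 1≤p u′ u
        body : Sinks m (suc k) p A ((A l , A r) ∷ proj₁ R , proj₂ R)
        body with A l <ᵉ A r
        ... | true  = cong₃ node at-root sibling below-child ,
                      trans (count-∷ (A l) (A r) (proj₁ Q)) (cong (μ (A l) * μ (A r) +_) count≡) ,
                      Under-1+2* u , frame′ Under-1+2* , dummies′
          where
          Q = sinkHole fuel n r (A [ p ≔ A r ])
          open Sink-child p≤m p<r p<l apart A k dummies {w = proj₁ Q} {hole = proj₁ (proj₂ Q)} {B = proj₂ (proj₂ Q)}
            (sinkHole-spec fuel k r (A [ p ≔ A r ]) k≤ (s≤s z≤n) fr (update-dummies {e = A r} {A = A} p≤m dummies))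
        ... | false = cong₃ node at-root below-child sibling ,
                      trans (count-∷ (A l) (A r) (proj₁ Q)) (cong (μ (A l) * μ (A r) +_) count≡) ,
                      Under-2* u , frame′ Under-2* , dummies′
          where
          Q = sinkHole fuel n l (A [ p ≔ A l ])
          open Sink-child p≤m p<l p<r (Under-children 1≤p) A k dummies {w = proj₁ Q} {hole = proj₁ (proj₂ Q)} {B = proj₂ (proj₂ Q)}
            (sinkHole-spec fuel k l (A [ p ≔ A l ]) k≤ (≤-trans 1≤p (<⇒≤ p<l)) fl (update-dummies {e = A l} {A = A} p≤m dummies))

      -- A dummy is never larger than its parent, so the sift stops after at most one comparison,
      -- which involves the dummy and is not counted.
      siftUp-dummy : ∀ fuel p A → A p ≡ ⊥₋ → cost (siftUp fuel p A) ≡ 0 × proj₂ (siftUp fuel p A) ≡ A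
      siftUp-dummy zero       p A eq = refl , refl
      siftUp-dummy (suc fuel) p A eq with does (2 ≤? p)
      ... | false = refl , refl
      ... | true rewrite eq | ≮ᵉ⊥₋ (A ⌊ p /2⌋) =
        trans (count-∷ (A ⌊ p /2⌋) ⊥₋ []) (trans (+-identityʳ _) (trans (cong (μ (A ⌊ p /2⌋) *_) μ⊥₋≡0) (*-zeroʳ (μ (A ⌊ p /2⌋))))) , refl

      fillHole-spec : ∀ hole B → B n ≡ ⊥₋ →
        let R = if does (hole ≟ n) then return B else siftUp hole hole (B [ hole ≔ B n ])
        in cost R ≡ 0 × (∀ q → proj₂ R q ≡ (B [ hole ≔ ⊥₋ ]) q)
      fillHole-spec hole B eq with hole ≟ n
      -- The hole is the last position, which is about to leave the heap; it already holds a dummy,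
      -- so writing one there changes nothing.
      ... | yes refl rewrite dec-true (hole ≟ hole) refl = refl , unchanged
        where
        unchanged : ∀ q → B q ≡ (B [ hole ≔ ⊥₋ ]) q
        unchanged q with q ≟ hole
        ... | yes refl = trans eq (sym (update-≡ q ⊥₋ B))
        ... | no q≢    = sym (update-≢ hole ⊥₋ B q≢)
      ... | no hole≢n rewrite dec-false (hole ≟ n) hole≢n =
        proj₁ dummy , λ q → trans (cong (λ A → A q) (proj₂ dummy)) (cong (λ e → (B [ hole ≔ e ]) q) eq)
        where
        dummy = siftUp-dummy hole hole (B [ hole ≔ B n ]) (trans (update-≡ hole (B n) B) eq)

      removeRoot-spec : ∀ k A → k ≤ n → Full m (suc k) 1 → Dummies m A →
        treeOf (proj₂ (removeRoot n A)) (suc k) 1 ≡ pop (treeOf A (suc k) 1) ×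
        cost (removeRoot n A) ≡ popCost (treeOf A (suc k) 1) ×
        Dummies m (proj₂ (removeRoot n A))
      removeRoot-spec k A k≤n full dummies =
        trans (treeOf-cong (suc k) 1 λ q _ → proj₂ fillHole q) tree ,
        trans (count-++ w _) (trans (cong (count w +_) (proj₁ fillHole)) (trans (+-identityʳ _) count≡)) ,
        λ q m<q → trans (proj₂ fillHole q) (dummy q m<q)
        where
        sunk = sinkHole n n 1 A
        w    = proj₁ sunk
        hole = proj₁ (proj₂ sunk)
        B    = proj₂ (proj₂ sunk)
        spec = sinkHole-spec n k 1 A k≤n ≤-refl full dummies
        tree = proj₁ spec
        count≡ = proj₁ (proj₂ spec)
        dummies′ : Dummies m B
        dummies′ = proj₂ (proj₂ (proj₂ (proj₂ spec)))
        fillHole = fillHole-spec hole B (dummies′ n m<n)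
        dummy : Dummies m (B [ hole ≔ ⊥₋ ])
        dummy q m<q with q ≟ hole
        ... | yes refl = update-≡ q ⊥₋ B
        ... | no q≢    = trans (update-≢ hole ⊥₋ B q≢) (dummies′ q m<q)

    -- With `j` removals left the heap has `m + j + 1` entries. Thus before every removal
    -- `m < n < 2 * suc m`, and the last position is a dummy. The marks of the output are bounded
    -- too, for the merges that follow.
    output-spec : ∀ k m → k ≤ m → Full m (suc k) 1 → ∀ j n A out → j ≤ m → n ≡ suc (m + j) → Dummies m A →
      cost (output j n A out) ≤ outputCost (treeOf A (suc k) 1) ×
      weight (proj₂ (output j n A out)) ≤ weight out + weightT (treeOf A (suc k) 1)
    output-spec k m k≤m full zero    n A out j≤m eq dummies = z≤n , m≤m+n _ _
    output-spec k m k≤m full (suc j) n A out j≤m eq dummies = (begin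
        count (proj₁ R ++ proj₁ (output j (n ∸ 1) (proj₂ R) (A 1 ∷ out)))
          ≡⟨ count-++ (proj₁ R) _ ⟩
        cost R + cost (output j (n ∸ 1) (proj₂ R) (A 1 ∷ out))
          ≤⟨ +-mono-≤ (≤-reflexive (proj₁ (proj₂ spec))) (proj₁ rest) ⟩
        popCost t + outputCost (treeOf (proj₂ R) (suc k) 1)
          ≡⟨ cong (λ t′ → popCost t + outputCost t′) (proj₁ spec) ⟩
        popCost t + outputCost (pop t)
          ≤⟨ pop-outputCost t ⟩
        outputCost t ∎) , (begin
        weight (proj₂ (output j (n ∸ 1) (proj₂ R) (A 1 ∷ out)))
          ≤⟨ proj₂ rest ⟩
        μ (A 1) + weight out + weightT (treeOf (proj₂ R) (suc k) 1)
          ≡⟨ cong (λ t′ → μ (A 1) + weight out + weightT t′) (proj₁ spec) ⟩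
        μ (A 1) + weight out + weightT (pop t)
          ≡⟨ arith (μ (A 1)) (weight out) (weightT (pop t)) ⟩
        weight out + (μ (A 1) + weightT (pop t))
          ≡⟨ cong (weight out +_) (weight-pop t) ⟩
        weight out + weightT t ∎)
      where
      open ≤-Reasoning
      t = treeOf A (suc k) 1
      R = removeRoot n A
      m<n : m < n
      m<n = ≤-trans (s≤s (m≤m+n m (suc j))) (≤-reflexive (sym eq))
      n<  : n < 2 * suc m
      n<  = ≤-trans (s≤s (≤-trans (≤-reflexive eq) (s≤s (+-monoʳ-≤ m j≤m)))) (≤-reflexive (arith₂ m))
        where
        arith₂ : ∀ m → suc (suc (m + m)) ≡ 2 * suc m
        arith₂ = solve-∀
      spec = removeRoot-spec m n m<n n< k A (≤-trans k≤m (<⇒≤ m<n)) full dummies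
      rest = output-spec k m k≤m full j (n ∸ 1) (proj₂ R) (A 1 ∷ out) (<⇒≤ j≤m)
        (trans (cong (_∸ 1) eq) (+-suc m j)) (proj₂ (proj₂ spec))
      arith : ∀ a b c → a + b + c ≡ b + (a + c)
      arith = solve-∀

    weight-sift : ∀ {h} y (l r : Tree Entry h) → weightT (sift y l r) ≡ μ y + (weightT l + weightT r)
    weight-sift y leaf leaf = refl
    weight-sift y l@(node u l₁ l₂) r@(node v r₁ r₂) with u <ᵉ v
    ... | true with y <ᵉ v
    ...   | false = refl
    ...   | true  = trans (cong (λ z → μ v + (weightT l + z)) (weight-sift y r₁ r₂))
                          (arith (μ v) (weightT l) (μ y) (weightT r₁ + weightT r₂))
      where
      arith : ∀ v l y r → v + (l + (y + r)) ≡ y + (l + (v + r))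
      arith = solve-∀
    weight-sift y l@(node u l₁ l₂) r@(node v r₁ r₂) | false with y <ᵉ u
    ...   | false = refl
    ...   | true  = trans (cong (λ z → μ u + (z + weightT r)) (weight-sift y l₁ l₂))
                          (arith (μ u) (weightT l₁ + weightT l₂) (μ y) (weightT r))
      where
      arith : ∀ u l y r → u + (y + l + r) ≡ y + (u + l + r)
      arith = solve-∀

    weight-heapify : ∀ {h} (t : Tree Entry h) → weightT (heapify t) ≡ weightT t
    weight-heapify leaf         = refl
    weight-heapify (node y l r) = trans (weight-sift y (heapify l) (heapify r))
      (cong (μ y +_) (cong₂ _+_ (weight-heapify l) (weight-heapify r)))

    weight-positions : ∀ A h p → weightT (treeOf A h p) ≡ ∑[ q ∈ positions h p ] μ (A q)
    weight-positions A zero    p = refl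
    weight-positions A (suc h) p = cong (μ (A p) +_) (trans
      (cong₂ _+_ (weight-positions A h (2 * p)) (weight-positions A h (suc (2 * p))))
      (sym (∑-++ (positions h (2 * p)) _ _)))

    weight-fromEntries : ∀ π → ∑[ q ∈ range 1 (length π) ] μ (fromEntries π q) ≡ weight π
    weight-fromEntries []      = refl
    weight-fromEntries (k ∷ π) = cong (μ k +_) (trans
      (trans (cong (λ qs → ∑ qs (λ q → μ (fromEntries (k ∷ π) q))) (range-suc 1 (length π)))
             (∑-map suc (range 1 (length π)) _))
      (trans (shift 1 (length π) ≤-refl) (weight-fromEntries π)))
      where
      shift : ∀ a n → 1 ≤ a → ∑[ q ∈ range a n ] μ (fromEntries (k ∷ π) (suc q)) ≡ ∑[ q ∈ range a n ] μ (fromEntries π q)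
      shift a       zero    1≤a = refl
      shift (suc a) (suc n) 1≤a = cong (μ (fromEntries π (suc a)) +_) (shift (suc (suc a)) n (s≤s z≤n))

    weight-treeOf : ∀ h π → length π ≡ size h → weightT (treeOf (fromEntries π) h 1) ≡ weight π
    weight-treeOf h π eq = begin
      _ ≡⟨ weight-positions (fromEntries π) h 1 ⟩
      _ ≡⟨ sum-↭ (↭ₚ.map⁺ (λ q → μ (fromEntries π q)) (range-positions h)) ⟨
      ∑[ q ∈ range 1 (size h) ] μ (fromEntries π q) ≡⟨ cong (λ n → ∑[ q ∈ range 1 n ] μ (fromEntries π q)) eq ⟨
      _ ≡⟨ weight-fromEntries π ⟩
      weight π ∎
      where open ≡-Reasoning

    fromList-fromEntries : ∀ ks q → fromList ks q ≡ fromEntries (map [_] ks) q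
    fromList-fromEntries []       q             = refl
    fromList-fromEntries (k ∷ ks) zero          = refl
    fromList-fromEntries (k ∷ ks) (suc zero)    = refl
    fromList-fromEntries (k ∷ ks) (suc (suc q)) = fromList-fromEntries ks (suc q)

    arrayCost : ℕ → List Entry → ℕ
    arrayCost h π = blockCost (treeOf (fromEntries π) h 1)

    SortsWithin : ℕ → List Key → Logged (List Entry) → Set
    SortsWithin h ks R = cost R ≤ arrayCost h (map [_] ks) × weight (proj₂ R) ≤ weight (map [_] ks)

    sortBlock-spec : ∀ h ks → length ks ≡ size h → SortsWithin h ks (sortBlock ks)
    sortBlock-spec zero    []  eq = z≤n , z≤n
    sortBlock-spec (suc k) ks  eq = subst (λ m → SortsWithin (suc k) ks
        (buildHeap m (fromList ks) >>= λ A → output m (suc (2 * m)) (addDummies m A) []))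
      (sym eq) ((begin
        count (proj₁ R ++ proj₁ (output m (suc (2 * m)) B []))
          ≡⟨ count-++ (proj₁ R) _ ⟩
        cost R + cost (output m (suc (2 * m)) B [])
          ≤⟨ +-mono-≤ (≤-reflexive (proj₂ built)) (proj₁ sorted) ⟩
        buildCost t + outputCost (treeOf B (suc k) 1)
          ≡⟨ cong (λ t′ → buildCost t + outputCost t′) heap ⟩
        blockCost t
          ≡⟨ cong blockCost t≡ ⟩
        arrayCost (suc k) (map [_] ks) ∎) , (begin
        weight (proj₂ (output m (suc (2 * m)) B []))
          ≤⟨ proj₂ sorted ⟩
        weightT (treeOf B (suc k) 1)
          ≡⟨ trans (cong weightT heap) (trans (weight-heapify t) (cong weightT t≡)) ⟩
        weightT (treeOf (fromEntries (map [_] ks)) (suc k) 1)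
          ≡⟨ weight-treeOf (suc k) (map [_] ks) (trans (length-map [_] ks) eq) ⟩
        weight (map [_] ks) ∎))
      where
      open ≤-Reasoning
      m = size (suc k)
      R = buildHeap m (fromList ks)
      A = proj₂ R
      B = addDummies m A
      t = treeOf (fromList ks) (suc k) 1
      t≡ : t ≡ treeOf (fromEntries (map [_] ks)) (suc k) 1
      t≡ = treeOf-cong (suc k) 1 λ q _ → fromList-fromEntries ks q
      built = Construction.buildHeap-spec (suc k) (fromList ks)
      full : Full m (suc k) 1
      full = Heights.height-full (suc k) (suc k) 1 ≤-refl refl
      heap : treeOf B (suc k) 1 ≡ heapify t
      heap = trans (treeOf-Full (suc k) 1 full λ q q≤m → cong (if_then A q else ⊥₋) (dec-true (q ≤? m) q≤m)) (proj₁ built)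
      dummies : Dummies m B
      dummies q m<q = cong (if_then A q else ⊥₋) (dec-false (q ≤? m) (<⇒≱ m<q))
      sorted = output-spec k m (≤-trans (n≤1+n k) (n≤size (suc k))) full m (suc (2 * m)) B [] ≤-refl
        (cong (λ z → suc (m + z)) (+-identityʳ m)) dummies

    -- Merging

    Merges : List Entry → List Entry → Logged (List Entry) → Set
    Merges us vs R = cost R ≤ weight us + weight vs × weight (proj₂ R) ≡ weight us + weight vs

    -- A counted comparison is charged to the key output next, which is then marked. The answer of
    -- the comparison is a parameter, so both recursive results can be supplied in advance.
    merge-step : ∀ b u us v vs →
      Merges (u ∷ us) vs (merge (u ∷ us) vs) → Merges us (v ∷ vs) (merge us (v ∷ vs)) →
      let R = if b then (merge (u ∷ us) vs >>= λ ws → return (v ∷ ws))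
                   else (merge us (v ∷ vs) >>= λ ws → return (u ∷ ws))
      in Merges (u ∷ us) (v ∷ vs) ((v , u) ∷ proj₁ R , proj₂ R)
    merge-step true u us v vs (cost≤ , weight≡) _ = (begin
        count ((v , u) ∷ proj₁ R ++ [])      ≡⟨ trans (count-∷ v u _) (cong (μ v * μ u +_) (trans (count-++ (proj₁ R) []) (+-identityʳ _))) ⟩
        μ v * μ u + cost R                   ≤⟨ +-mono-≤ (≤-trans (*-monoʳ-≤ (μ v) (μ≤1 u)) (≤-reflexive (*-identityʳ (μ v)))) cost≤ ⟩
        μ v + (weight (u ∷ us) + weight vs)  ≡⟨ arith (μ v) (weight (u ∷ us)) (weight vs) ⟩
        weight (u ∷ us) + weight (v ∷ vs)    ∎) ,
        trans (cong (μ v +_) weight≡) (arith (μ v) (weight (u ∷ us)) (weight vs))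
      where
      open ≤-Reasoning
      R = merge (u ∷ us) vs
      arith : ∀ v a b → v + (a + b) ≡ a + (v + b)
      arith = solve-∀
    merge-step false u us v vs _ (cost≤ , weight≡) = (begin
        count ((v , u) ∷ proj₁ R ++ [])        ≡⟨ trans (count-∷ v u _) (cong (μ v * μ u +_) (trans (count-++ (proj₁ R) []) (+-identityʳ _))) ⟩
        μ v * μ u + cost R                     ≤⟨ +-mono-≤ (≤-trans (*-monoˡ-≤ (μ u) (μ≤1 v)) (≤-reflexive (*-identityˡ (μ u)))) cost≤ ⟩
        μ u + (weight us + weight (v ∷ vs))    ≡⟨ +-assoc (μ u) (weight us) (weight (v ∷ vs)) ⟨
        weight (u ∷ us) + weight (v ∷ vs)      ∎) ,
        trans (cong (μ u +_) weight≡) (sym (+-assoc (μ u) (weight us) (weight (v ∷ vs))))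
      where
      open ≤-Reasoning
      R = merge us (v ∷ vs)

    merge-spec : ∀ us vs → Merges us vs (merge us vs)
    merge-spec []       vs       = z≤n , refl
    merge-spec (u ∷ us) []       = z≤n , sym (+-identityʳ _)
    merge-spec (u ∷ us) (v ∷ vs) =
      merge-step (v <ᵉ u) u us v vs (merge-spec (u ∷ us) vs) (merge-spec us (v ∷ vs))

    -- The weight of the merged output is bounded alongside the cost because the next merge is
    -- charged to it.
    sortAndMerge-spec : ∀ ss ks → length ks ≡ sum (map size ss) →
      let S = sortBlocks (splitBlocks ss ks) in
      cost S + cost (mergeBlocks (proj₂ S)) ≤ totalCost arrayCost ss (map [_] ks) ×
      weight (proj₂ (mergeBlocks (proj₂ S))) ≤ weight (map [_] ks)
    sortAndMerge-spec []       ks eq = z≤n , z≤n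
    sortAndMerge-spec (s ∷ ss) ks eq rewrite blockSize≡size s = (begin
        count (proj₁ R ++ proj₁ S ++ []) + count (proj₁ M ++ proj₁ N)
          ≡⟨ cong₂ _+_ (trans (count-++ (proj₁ R) _) (cong (cost R +_) (trans (count-++ (proj₁ S) []) (+-identityʳ _))))
                       (count-++ (proj₁ M) (proj₁ N)) ⟩
        cost R + cost S + (cost M + cost N)
          ≡⟨ arith (cost R) (cost S) (cost M) (cost N) ⟩
        cost R + cost N + (cost S + cost M)
          ≤⟨ +-mono-≤ (+-mono-≤ (proj₁ sorted) (≤-trans (proj₁ merged) weight≤)) (proj₁ rest) ⟩
        arrayCost s (map [_] (take b ks)) + weight (map [_] ks) + totalCost arrayCost ss (map [_] (drop b ks))
          ≡⟨ cong₂ (λ π ρ → arrayCost s π + weight (map [_] ks) + totalCost arrayCost ss ρ) (sym (take-map b ks)) (sym (drop-map b ks)) ⟩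
        _ ∎) , ≤-trans (≤-reflexive (proj₂ merged)) weight≤
      where
      open ≤-Reasoning
      b = size s
      R = sortBlock (take b ks)
      S = sortBlocks (splitBlocks ss (drop b ks))
      M = mergeBlocks (proj₂ S)
      N = merge (proj₂ R) (proj₂ M)
      arith : ∀ r s m n → r + s + (m + n) ≡ r + n + (s + m)
      arith = solve-∀
      sorted = sortBlock-spec s (take b ks) (trans (length-take b ks)
        (m≤n⇒m⊓n≡m (≤-trans (m≤m+n b _) (≤-reflexive (sym eq)))))
      rest = sortAndMerge-spec ss (drop b ks) (trans (length-drop b ks) (trans (cong (_∸ b) eq) (m+n∸m≡n b _)))
      merged = merge-spec (proj₂ R) (proj₂ M)
      weight≤ : weight (proj₂ R) + weight (proj₂ M) ≤ weight (map [_] ks)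
      weight≤ = ≤-trans (+-mono-≤ (proj₂ sorted) (proj₂ rest)) (≤-reflexive (trans
        (cong₂ (λ π ρ → weight π + weight ρ) (sym (take-map b ks)) (sym (drop-map b ks)))
        (trans (sym (weight-++ (take b (map [_] ks)) _)) (cong weight (take++drop≡id b (map [_] ks))))))

    modifiedHeapsort-cost : ∀ ss ks → length ks ≡ sum (map size ss) →
      cost (modifiedHeapsort ss ks) ≤ totalCost arrayCost ss (map [_] ks)
    modifiedHeapsort-cost ss ks eq = ≤-trans
      (≤-reflexive (count-++ (proj₁ (sortBlocks (splitBlocks ss ks))) _))
      (proj₁ (sortAndMerge-spec ss ks eq))

-- The marked interval, rational logarithms and the final estimate

AllPairs-reverse : ∀ {A : Set} {R : A → A → Set} {xs} → AllPairs R xs → AllPairs (flip R) (reverse xs)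
AllPairs-reverse []                     = []
AllPairs-reverse {R = R} {x ∷ xs} (px ∷ pxs) = subst (AllPairs (flip R)) (sym (unfold-reverse x xs))
  (AllPairsₚ.++⁺ (AllPairs-reverse pxs) ([] ∷ [])
    (All.map (_∷ []) (↭ₚ.All-resp-↭ (↭-sym (↭ₚ.↭-reverse xs)) px)))

∑-interval : ∀ n (g : Fin n → ℕ) i r → (∀ j → g j ≤ 1) → (∀ j → toℕ j < i → g j ≡ 0) →
             (∀ j → i + r ≤ toℕ j → g j ≡ 0) → sum (tabulate g) ≤ r
∑-interval zero    g i       r       g≤1 lo hi = z≤n
∑-interval (suc n) g (suc i) r       g≤1 lo hi rewrite lo Fin.zero (s≤s z≤n) =
  ∑-interval n (g ∘ Fin.suc) i r (g≤1 ∘ Fin.suc) (λ j → lo (Fin.suc j) ∘ s≤s) (λ j → hi (Fin.suc j) ∘ s≤s)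
∑-interval (suc n) g zero    zero    g≤1 lo hi rewrite hi Fin.zero z≤n =
  ∑-interval n (g ∘ Fin.suc) 0 0 (g≤1 ∘ Fin.suc) (λ _ ()) (λ j _ → hi (Fin.suc j) z≤n)
∑-interval (suc n) g zero    (suc r) g≤1 lo hi = +-mono-≤ (g≤1 Fin.zero)
  (∑-interval n (g ∘ Fin.suc) 0 r (g≤1 ∘ Fin.suc) (λ _ ()) (λ j → hi (Fin.suc j) ∘ s≤s))

-- For `q = p / d`, combining `2 ^ L ≤ r` with `r ^ d ≤ 2 ^ p` gives `2 ^ (L * d) ≤ 2 ^ p`, so `L`
-- lies below every rational in the upper cut of log₂ r.
log-lower : ∀ L r q → 2 ^ L ≤ r → Log₂ r ≤ q → (ℤ.+ L) ℚᵘ./ 1 ℚᵘ.≤ q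
log-lower L r (mkℚᵘ (ℤ.+ p) d) lo (mkLog₂≤ _ r^d≤2^p) = *≤* (subst₂ ℤ._≤_ (pos-* L (suc d)) (pos-* p 1)
  (ℤ.+≤+ (≤-trans (≮⇒≥ λ p<Ld → <⇒≱ (^-monoʳ-< 2 (s≤s (s≤s z≤n)) p<Ld) (begin
    2 ^ (L * suc d)   ≡⟨ ^-*-assoc 2 L (suc d) ⟨
    (2 ^ L) ^ suc d   ≤⟨ ^-monoˡ-≤ (suc d) lo ⟩
    r ^ suc d         ≤⟨ r^d≤2^p ⟩
    2 ^ p             ∎)) (≤-reflexive (sym (*-identityʳ p))))))
  where open ≤-Reasoning
log-lower L r (mkℚᵘ (ℤ.-[1+ p ]) d) lo (mkLog₂≤ (*≤* ()) _)

/-≤ : ∀ s N b .{{_ : NonZero N}} → s ≤ N * b → (ℤ.+ s) ℚᵘ./ N ℚᵘ.≤ (ℤ.+ b) ℚᵘ./ 1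
/-≤ s (suc d) b s≤ = *≤* (subst₂ ℤ._≤_ (pos-* s 1) (pos-* b (suc d))
  (ℤ.+≤+ (≤-trans (≤-reflexive (*-identityʳ s)) (≤-trans s≤ (≤-reflexive (*-comm (suc d) b))))))

linear-≃ : ∀ r L c → (ℤ.+ (r * (L + c))) ℚᵘ./ 1 ℚᵘ.≃
                     ((ℤ.+ r) ℚᵘ./ 1) ℚᵘ.* ((ℤ.+ L) ℚᵘ./ 1) ℚᵘ.+ ((ℤ.+ c) ℚᵘ./ 1) ℚᵘ.* ((ℤ.+ r) ℚᵘ./ 1)
linear-≃ r L c
  rewrite sym (pos-* r L) | sym (pos-* c r) | sym (pos-* (r * L) 1) | sym (pos-* (c * r) 1)
        | sym (pos-+ (r * L * 1) (c * r * 1)) = *≡* (cong (ℤ._* ℤ.+ 1) (cong ℤ.+_ (arith r L c)))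
  where
  arith : ∀ r L c → r * (L + c) ≡ r * L * 1 + c * r * 1
  arith = solve-∀

module Theorem (O : StrictTotalOrder 0ℓ 0ℓ 0ℓ) where
  open Heapsort O
  open StrictTotalOrder O using (irrefl; asym; compare; module Eq)

  module _ {n : ℕ} (x : Fin n → Key) (increasing : StrictlyIncreasing x) (i r : ℕ) where

    open Comparisons O
    open Marked (InRange x i r) (inRange? x i r) id

    injective : ∀ {j k} → x j ≈ x k → toℕ j ≡ toℕ k
    injective {j} {k} eq with <-cmp (toℕ j) (toℕ k)
    ... | tri< j<k _ _ = contradiction (increasing j<k) (irrefl eq)
    ... | tri≈ _ j≡k _ = j≡k
    ... | tri> _ _ k<j = contradiction (increasing k<j) (irrefl (Eq.sym eq))

    outside : ∀ j → ¬ (i ≤ toℕ j × toℕ j < i + r) → μ [ x j ] ≡ 0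
    outside j ¬in = cong (if_then 1 else 0) (dec-false (inRange? x i r [ x j ])
      λ (k , i≤k , k<i+r , eq) → ¬in (subst (λ t → i ≤ t × t < i + r) (sym (injective eq)) (i≤k , k<i+r)))

    -- Reversed, because `heaps` takes decreasing lists while `x` is increasing.
    keys : List Entry
    keys = reverse (map [_] (tabulate x))

    keys-↭ : keys ↭ map [_] (tabulate x)
    keys-↭ = ↭ₚ.↭-reverse (map [_] (tabulate x))

    length-keys : length keys ≡ n
    length-keys = trans (length-reverse (map [_] (tabulate x))) (trans (length-map [_] (tabulate x)) (length-tabulate x))

    keys-decreasing : AllPairs _≻_ keys
    keys-decreasing = AllPairs-reverse (subst (AllPairs (flip _≻_)) (sym (map-tabulate x [_])) (AllPairsₚ.tabulate⁺-< λ {j} {k} j<k →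
      dec-true ([ x j ] <ᴱ? [ x k ]) AddInfimum.[ increasing j<k ] ,
      dec-false ([ x k ] <ᴱ? [ x j ]) λ where AddInfimum.[ k<j ] → asym (increasing j<k) k<j))

    weight-keys : weight keys ≤ r
    weight-keys = begin
      weight keys                           ≡⟨ sum-↭ (↭ₚ.map⁺ μ keys-↭) ⟩
      weight (map [_] (tabulate x))         ≡⟨ ∑-map [_] (tabulate x) μ ⟩
      ∑ (tabulate x) (μ ∘ [_])              ≡⟨ cong sum (map-tabulate x (μ ∘ [_])) ⟩
      sum (tabulate (μ ∘ [_] ∘ x))          ≤⟨ ∑-interval n _ i r (λ j → μ≤1 [ x j ])
                                                 (λ j j<i → outside j λ (i≤j , _) → <⇒≱ j<i i≤j)
                                                 (λ j i+r≤j → outside j λ (_ , j<i+r) → <⇒≱ j<i+r i+r≤j) ⟩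
      r                                     ∎
      where open ≤-Reasoning

    ∑-comparisons : ∀ ss → AlmostBinaryExpansion n ss → ∀ L → r < 2 ^ suc L →
      ∑ (permutations (tabulate x)) (comparisonsWithin ss x i r) ≤ length (tabulate x) ! * (r * (L + 22))
    ∑-comparisons ss expansion L r< = begin
      ∑ (permutations (tabulate x)) (comparisonsWithin ss x i r)
        ≤⟨ ∑-monoᴬ (All.map (λ {π} |π| → modifiedHeapsort-cost ss π
             (trans |π| (trans (length-tabulate x) (sym sum-sizes)))) (permutations-length (tabulate x))) ⟩
      ∑[ π ∈ permutations (tabulate x) ] totalCost arrayCost ss (map [_] π)
        ≡⟨ ∑-permutations-map [_] (tabulate x) _ ⟨
      ∑ (permutations (map [_] (tabulate x))) (totalCost arrayCost ss)
        ≡⟨ ∑-permutations-↭ keys-↭ _ ⟨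
      ∑ (permutations keys) (totalCost arrayCost ss)
        ≤⟨ totalCost-bound arrayCost L
             (λ s S |S| desc w< → ≤-trans (≤-reflexive (∑-treeOf s S |S| blockCost)) (block-bound L s S |S| desc w<))
             ss (subst DominatesTails sizes E.dominating) keys (trans length-keys (sym sum-sizes)) keys-decreasing
             (≤-<-trans weight-keys r<) ⟩
      length keys ! * (weight keys * (L + 22))
        ≤⟨ *-mono-≤ (≤-reflexive (cong _! (trans length-keys (sym (length-tabulate x))))) (*-monoˡ-≤ (L + 22) weight-keys) ⟩
      length (tabulate x) ! * (r * (L + 22)) ∎
      where
      open ≤-Reasoning
      module E = AlmostBinaryExpansion expansion
      sizes : map blockSize ss ≡ map size ss
      sizes = map-cong blockSize≡size ss
      sum-sizes : sum (map size ss) ≡ n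
      sum-sizes = trans (cong sum (sym sizes)) E.sums-to

mainTheorem1 : Σ[ c ∈ ℚᵘ ]
    ((O : StrictTotalOrder 0ℓ 0ℓ 0ℓ) → let open Heapsort O in
    (n : ℕ) (ss : List ℕ) → AlmostBinaryExpansion n ss →
    (x : Fin n → Key) → StrictlyIncreasing x →
    (i r : ℕ) → 1 ≤ r → i + r ≤ n →
    expectedComparisons ss x i r ≤[ r log₂ r + c · r ])
-- The constant consists of 16 for the construction, 4 for the lower levels in the sorting phase and
-- 2 for the merges.
mainTheorem1 = (ℤ.+ 22) ℚᵘ./ 1 , λ O n ss expansion x increasing i r 1≤r _ q log₂r≤q →
  -- `L` is the integer part of log₂ r: `hi` limits the pairs that remain after `L` levels, and `lo`
  -- gives `L ≤ q` for every admissible `q`.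
  let L , lo , hi = floorLog r 1≤r
      open ℚᵘₚ.≤-Reasoning
  in begin
    _ ≤⟨ /-≤ _ (length (tabulate x) !) (r * (L + 22)) {{(length (tabulate x)) !≢0}} (Theorem.∑-comparisons O x increasing i r ss expansion L hi) ⟩
    (ℤ.+ (r * (L + 22))) ℚᵘ./ 1
      ≃⟨ linear-≃ r L 22 ⟩
    ((ℤ.+ r) ℚᵘ./ 1) ℚᵘ.* ((ℤ.+ L) ℚᵘ./ 1) ℚᵘ.+ ((ℤ.+ 22) ℚᵘ./ 1) ℚᵘ.* ((ℤ.+ r) ℚᵘ./ 1)
      ≤⟨ ℚᵘₚ.+-monoˡ-≤ (((ℤ.+ 22) ℚᵘ./ 1) ℚᵘ.* ((ℤ.+ r) ℚᵘ./ 1))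
           (ℚᵘₚ.*-monoʳ-≤-nonNeg ((ℤ.+ r) ℚᵘ./ 1) (log-lower L r q lo log₂r≤q)) ⟩
    ((ℤ.+ r) ℚᵘ./ 1) ℚᵘ.* q ℚᵘ.+ ((ℤ.+ 22) ℚᵘ./ 1) ℚᵘ.* ((ℤ.+ r) ℚᵘ./ 1) ∎
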